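{- Let $G=(V,E)$ be a finite simple bipartite graph with maximum degree $\Delta$, let $k\ge\Delta$, and let $M(G,k)$ be the Markov chain on the edge $k$-colorings of $G$ defined in the context. Then the inverse of the acceptance ratio in the Metropolis-Hastings algorithm applied with a constant function $g$ (i.e. with the uniform target distribution on edge $k$-colorings of $G$) and with the Markov chain $M(G,k)$ is upper bounded by $96|V|^2(|V|-1)$.
   Context: **Colorings.** An edge $k$-coloring of $G=(V,E)$ is a map $C:E\to\{c_1,\dots,c_k\}$ such that no two adjacent edges have the same color. For a map $C:E\to\{c_1,\dots,c_k\}$, a vertex $v$ has a $(+c-c')$-deficiency (and is called deficient) if exactly two $c$-colored edges are incident to $v$, all other edges incident to $v$ have different colors, and no $c'$-colored edge is incident to $v$. An almost edge $k$-coloring is a map $C:E\to\{c_1,\dots,c_k\}$ such that at most two vertices have deficiency and all other vertices have no two incident edges of the same color. Flipping the colors along an alternating path, walk or cycle with colors $a,b$ means interchanging $a$ and $b$ on its edges. Eliminating a $(+a-b)$-deficiency at a vertex $v$ means: select uniformly one of the two $a$-edges at $v$ and flip the colors along the appropriate maximal alternating path (walk) with colors $a,b$ starting at $v$ with the selected edge. **The Markov chain $M(G,k)$.** $G$ is bipartite and $k\ge\Delta$. The states are the edge $k$-colorings of $G$. From the current coloring $C$, a random edge $k$-coloring is drawn as follows. (1) With probability $\frac12$, do nothing. (2) With probability $\frac14$, select two colors $c,c'$ uniformly among the $\binom{k}{2}$ unordered pairs. Let $H$ be the subgraph of $G$ formed by the edges of colors $c$ and $c'$; its non-trivial components are paths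 and cycles. Select one of the following: (a) with probability $\frac13$, do nothing; (b) with probability $\frac13$, uniformly select a sub-path or a cycle of $H$ from all sub-paths and cycles in $H$; (c) with probability $\frac13$, uniformly select two sub-paths of $H$ from all possible pairs of sub-paths such that both of them have exactly one end vertex which is also an end vertex in $H$. Flip the colors in the selected sub-paths (or cycle). If there is any deficient vertex, select one of them uniformly, then select uniformly one of the edges with the same color incident to the selected vertex and change its color from $c$ to $c'$ or from $c'$ to $c$. Otherwise, with probability $\frac12$ select an edge uniformly from all edges of color $c$ or $c'$ and change its color to the opposite ($c'$ or $c$), and with probability $\frac12$ do nothing. Finally eliminate all deficiencies by flipping the colors on appropriate alternating paths, selecting uniformly from the two edges with the same color incident to a deficient vertex. (3) With probability $\frac14$, select three colors uniformly from all $\binom{k}{3}$ unordered triples, and select uniformly one of the three as distinguished. Let $c''$ be the distinguished color and $c,c'$ the other two. Let $H$ be the subgraph consisting of the edges of colors $c$ and $c'$; its non-trivial components are paths and cycles. Select one of the following: (a) with probability $\frac13$, do nothing; (b) with probability $\frac13$, uniformly select a sub-path of $H$ from all sub-paths such that at least one of its end vertices is not an end vertex in $H$; (c) with probability $\frac13$, uniformly select two sub-paths of $H$ from all possible pairs of sub-paths such that both of them have exactly one end vertex which is also an end vertex in $H$. Flip the colors in the selected sub-paths. If there are two deficient vertices, select one of them uniformly. If there is only one deficient vertex, then with probability $\frac12$ select it, and with probability $\frac12$ select uniformly a non-deficient vertex among those incident to both a $c''$-edge and at least one of a $c$- or a $c'$-edge. If there is no deficient vertex, select uniformly a non-deficient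 vertex among those incident to both a $c''$-edge and at least one of a $c$- or a $c'$-edge. - If a deficient vertex is selected, select uniformly one of the edges with the same color incident to it, and let this color be $\tilde c$. Consider the maximal alternating path or cycle with colors $\tilde c$ and $c''$ containing the selected edge, and flip the colors in it. - If a non-deficient vertex is selected, let $e$ be its incident edge of color $c''$ and $f$ its incident edge of color $c$ or $c'$ (if it has incident edges of both colors, one of them is selected uniformly), and let $\tilde c$ be the color of $f$. Take the maximal alternating path with colors $c''$ and $\tilde c$ that contains $e$ but does not contain $f$, and flip the colors in it. Finally eliminate all deficiencies by flipping the colors on appropriate alternating paths, selecting uniformly from the two edges with the same color incident to a deficient vertex. **Metropolis-Hastings algorithm (variant used).** Given a positive function $g$ on the states, a proposal $y$ is drawn from the current state $x$ by the primary chain via some way $w$ among the several possible ways $w_1,\dots,w_t$ to transform $x$ to $y$; there is a one-to-one map $w_i\mapsto w_i'$ onto the ways of transforming $y$ back to $x$. $P(y,w\mid x)$ denotes the probability that $y$ is proposed from $x$ via way $w$. The proposal is accepted with probability $\min\left\{1,\frac{g(y)P(x,w'\mid y)}{g(x)P(y,w\mid x)}\right\}$ and otherwise the chain stays at $x$. For $g$ constant and states $C_1,C_2$, the Metropolis-Hastings ratio is $\frac{P(C_1,w'\mid C_2)}{P(C_2,w\mid C_1)}$. A way $w$ of transforming $C_1$ into $C_2$ in $M(G,k)$ consists of the selection of 2 or 3 colors (with the distinguished color if there are 3), followed by three consecutive transformations: $\varphi_1^{ -1}$ (flipping the colors on the selected sub-paths or cycle, which creates at most two deficient vertices), $f$ (the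 subsequent perturbation, i.e. the change of color of one edge, the flip along a path or cycle involving $c''$, or nothing), and $\varphi_2$ (elimination of all deficiencies); the inverse way $w'$ selects the same colors and applies $\varphi_2^{ -1}$, $f^{ -1}$, $\varphi_1$. If nothing is done, the ratio is $1$. The bound on the inverse of the acceptance ratio means that for all states $C_1,C_2$ and every way $w$ by which $C_2$ can be proposed from $C_1$ the inverse of the acceptance probability is at most the stated quantity.
   Formalization: The bound is proved for |V| ≥ 2 (it is 0 for |V| ≤ 1) and for ways w whose inverse way w′ has positive probability; for some ways of M(G,k), e.g. on a path with 6 vertices and k = 2, w′ has probability 0 and the inverse acceptance is infinite. -}

module Defs where

open import Data.Bool.Base using (Bool; if_then_else_; _∨_)
import Data.Bool.Properties as Bool
open import Data.Fin.Base using (Fin)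
open import Data.Fin.Properties using (_≟_; all?; any?)
open import Data.Fin.Subset using (Subset; ⊥; ⊤; ⁅_⁆; _∪_)
open import Data.Fin.Subset.Properties using (_∈?_)
open import Data.Integer.Base using (+_)
open import Data.List.Base using (List; []; _∷_; _++_; map; concatMap; filter; foldr; length; allFin; upTo; deduplicate)
import Data.List.Relation.Unary.Any as Any
open import Data.Nat.Base using (ℕ; zero; suc; _≤_; _⊔_)
import Data.Nat.Properties as ℕ
open import Data.Product.Base using (Σ; ∃; _×_; _,_)
import Data.Product.Properties as Product
open import Data.Rational.Base using (ℚ; 0ℚ; 1ℚ; ½; _+_; _*_; _÷_; 1/_; _⊓_; _/_; Positive)
import Data.Rational.Properties as ℚ
open import Data.Sum.Base using (_⊎_; inj₁; inj₂)
open import Data.Vec.Base using (Vec; lookup; tabulate)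
import Data.Vec.Properties as Vec
open import Relation.Binary.Definitions using (DecidableEquality)
open import Relation.Binary.PropositionalEquality.Core using (_≡_; _≢_; refl; sym; subst)
open import Relation.Nullary.Decidable.Core using (Dec; yes; no; does; map′; ¬?; _×-dec_; _⊎-dec_; _→-dec_)
open import Relation.Nullary.Negation.Core using (¬_)

------------------------------------------------------------------------
-- Graphs

-- The order of the two ends of an edge carries no information.
record Graph : Set where
  field
    ∣V∣ ∣E∣  : ℕ
    src tgt  : Fin ∣E∣ → Fin ∣V∣
    loopless : ∀ e → src e ≢ tgt e
    simple   : ∀ e f →
               (src e ≡ src f × tgt e ≡ tgt f) ⊎ (src e ≡ tgt f × tgt e ≡ src f) →
               e ≡ f

  Incident : Fin ∣E∣ → Fin ∣V∣ → Set
  Incident e v = (src e ≡ v) ⊎ (tgt e ≡ v)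

  incident? : ∀ e v → Dec (Incident e v)
  incident? e v = (src e ≟ v) ⊎-dec (tgt e ≟ v)

  -- The end of e other than v, for an edge e incident to v.
  opposite : Fin ∣E∣ → Fin ∣V∣ → Fin ∣V∣
  opposite e v = if does (src e ≟ v) then tgt e else src e

  -- The degree of v in the subgraph formed by the edges in S.
  degreeIn : Subset ∣E∣ → Fin ∣V∣ → ℕ
  degreeIn S v = length (filter (λ e → (e ∈? S) ×-dec incident? e v) (allFin ∣E∣))

  maxDegree : ℕ
  maxDegree = foldr _⊔_ 0 (map (degreeIn ⊤) (allFin ∣V∣))

open Graph using (∣V∣; ∣E∣; maxDegree)

Bipartite : Graph → Set
Bipartite G = Σ (Fin (∣V∣ G) → Bool) λ side → ∀ e → side (Graph.src G e) ≢ side (Graph.tgt G e)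

------------------------------------------------------------------------
-- Finite lists

module _ {A : Set} where

  -- For a list without repetitions: the unordered pairs and triples of
  -- distinct members.
  pairs : List A → List (A × A)
  pairs []       = []
  pairs (x ∷ xs) = map (x ,_) xs ++ pairs xs

  triples : List A → List (A × A × A)
  triples []       = []
  triples (x ∷ xs) = map (x ,_) (pairs xs) ++ triples xs

------------------------------------------------------------------------
-- Random experiments with finitely many outcomes: a list of outcomes with
-- their probabilities, where one outcome may be listed several times.

Dist : Set → Set
Dist A = List (ℚ × A)

module _ {A : Set} where

  pure : A → Dist A
  pure x = (1ℚ , x) ∷ []

  mix : List (ℚ × Dist A) → Dist A
  mix = concatMap λ (p , d) → map (λ (q , x) → (p * q , x)) d

  prob : {Q : A → Set} → (∀ x → Dec (Q x)) → Dist A → ℚ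
  prob Q? []            = 0ℚ
  prob Q? ((p , x) ∷ d) = (if does (Q? x) then p else 0ℚ) + prob Q? d

module _ {A B : Set} where

  infixl 1 _>>=_
  _>>=_ : Dist A → (A → Dist B) → Dist B
  d >>= f = mix (map (λ (p , x) → (p , f x)) d)

  -- Choose a member of xs uniformly and continue with f; if there is nothing
  -- to choose from, continue with d.
  choose : (xs : List A) (d : Dist B) (f : A → Dist B) → Dist B
  choose []       d f = d
  choose (x ∷ xs) d f = mix (map (λ y → (+ 1 / suc (length xs) , f y)) (x ∷ xs))

------------------------------------------------------------------------
-- The chain M(G,k)

module Chain (G : Graph) (k : ℕ) where

  open Graph G using (src; tgt; Incident; incident?; opposite; degreeIn)

  private
    n m : ℕ
    n = ∣V∣ G
    m = ∣E∣ G

  Vertex Edge Color EdgeSet EdgeMap : Set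
  Vertex  = Fin n
  Edge    = Fin m
  Color   = Fin k
  EdgeSet = Subset m
  EdgeMap = Vec Color m

  -- Edge k-colorings, the states of the chain.
  IsColoring : EdgeMap → Set
  IsColoring C = ∀ e f v → e ≢ f → Incident e v → Incident f v → lookup C e ≢ lookup C f

  edgesAt : EdgeMap → Vertex → Color → List Edge
  edgesAt C v a = filter (λ e → incident? e v ×-dec (lookup C e ≟ a)) (allFin m)

  -- C has a (+a-b)-deficiency at v.
  Deficiency : EdgeMap → Vertex → Color → Color → Set
  Deficiency C v a b = length (edgesAt C v a) ≡ 2
                     × (∀ d → d ≢ a → length (edgesAt C v d) ≤ 1)
                     × length (edgesAt C v b) ≡ 0

  deficiency? : ∀ C v a b → Dec (Deficiency C v a b)
  deficiency? C v a b = (length (edgesAt C v a) ℕ.≟ 2)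
    ×-dec all? (λ d → ¬? (d ≟ a) →-dec (length (edgesAt C v d) ℕ.≤? 1))
    ×-dec (length (edgesAt C v b) ℕ.≟ 0)

  Deficient : EdgeMap → Vertex → Set
  Deficient C v = ∃ λ a → ∃ λ b → Deficiency C v a b

  deficient? : ∀ C v → Dec (Deficient C v)
  deficient? C v = any? λ a → any? λ b → deficiency? C v a b

  deficientVertices : EdgeMap → List Vertex
  deficientVertices C = filter (deficient? C) (allFin n)

  -- At a deficient vertex: the two incident edges of the same color.
  doubledEdges : EdgeMap → Vertex → List Edge
  doubledEdges C v =
    filter (λ e → incident? e v ×-dec (length (edgesAt C v (lookup C e)) ℕ.≟ 2)) (allFin m)

  swap : Color → Color → Color → Color
  swap a b d = if does (d ≟ a) then b else if does (d ≟ b) then a else d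

  flip : Color → Color → EdgeSet → EdgeMap → EdgeMap
  flip a b S C = tabulate λ e → if does (e ∈? S) then swap a b (lookup C e) else lookup C e

  -- The edges of colors a and b, i.e. the edge set of the subgraph H.
  twoColored : Color → Color → EdgeMap → EdgeSet
  twoColored a b C = tabulate λ e → does (lookup C e ≟ a) ∨ does (lookup C e ≟ b)

  ----------------------------------------------------------------------
  -- Sub-paths and cycles of H, as edge sets

  -- The paths in H with ℓ edges that start in v and avoid the vertices in
  -- `seen`, each with its last vertex.
  pathsFrom : (H : EdgeSet) (ℓ : ℕ) (seen : Subset n) (v : Vertex) → List (Vertex × EdgeSet)
  pathsFrom H zero    seen v = (v , ⊥) ∷ []
  pathsFrom H (suc ℓ) seen v =
    concatMap (λ e → map (λ (w , S) → (w , ⁅ e ⁆ ∪ S)) (pathsFrom H ℓ (seen ∪ ⁅ v ⁆) (opposite e v)))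
      (filter (λ e → (e ∈? H) ×-dec incident? e v ×-dec ¬? (opposite e v ∈? seen ∪ ⁅ v ⁆)) (allFin m))

  -- Paths with at least one edge, with their first and last vertex; every
  -- path is listed once for each of its two directions.
  orientedPaths : EdgeSet → List (Vertex × Vertex × EdgeSet)
  orientedPaths H =
    concatMap (λ v → concatMap (λ ℓ → map (v ,_) (pathsFrom H (suc ℓ) ⊥ v)) (upTo n)) (allFin n)

  distinct : List EdgeSet → List EdgeSet
  distinct = deduplicate (Vec.≡-dec Bool._≟_)

  subPaths : EdgeSet → List EdgeSet
  subPaths H = distinct (map (λ (_ , _ , S) → S) (orientedPaths H))

  -- A cycle is a path together with a further edge joining its ends.
  cycles : EdgeSet → List EdgeSet
  cycles H = distinct (concatMap
    (λ (u , v , S) → map (λ e → ⁅ e ⁆ ∪ S)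
      (filter (λ e → (e ∈? H) ×-dec ¬? (e ∈? S) ×-dec incident? e u ×-dec incident? e v) (allFin m)))
    (orientedPaths H))

  -- Used both for the end vertices of a sub-path S and for the end vertices
  -- in H, i.e. those of the path components of H.
  End : EdgeSet → Vertex → Set
  End S v = degreeIn S v ≡ 1

  end? : ∀ S v → Dec (End S v)
  end? S v = degreeIn S v ℕ.≟ 1

  HasInnerEnd : (H S : EdgeSet) → Set
  HasInnerEnd H S = ∃ λ v → End S v × ¬ End H v

  hasInnerEnd? : ∀ H S → Dec (HasInnerEnd H S)
  hasInnerEnd? H S = any? λ v → end? S v ×-dec ¬? (end? H v)

  OneOuterEnd : (H S : EdgeSet) → Set
  OneOuterEnd H S = length (filter (λ v → end? S v ×-dec end? H v) (allFin n)) ≡ 1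

  oneOuterEnd? : ∀ H S → Dec (OneOuterEnd H S)
  oneOuterEnd? H S = length (filter (λ v → end? S v ×-dec end? H v) (allFin n)) ℕ.≟ 1

  ----------------------------------------------------------------------
  -- Maximal alternating paths

  -- Prolong the alternating trail T, which currently ends in w and avoids the
  -- edges in X, beyond w as far as possible, the next edge having color a, the
  -- one after it color b, and so on.  If the next edge would be one of T, then
  -- T has closed to a cycle.  At most two edges can qualify, and two only at a
  -- deficient vertex; then one of them is taken uniformly.  The number of
  -- edges bounds the number t of steps.
  prolong : (t : ℕ) → EdgeMap → (X T : EdgeSet) → Vertex → (a b : Color) → Dist EdgeSet
  prolong zero    C X T w a b = pure T
  prolong (suc t) C X T w a b with filter (λ e → ¬? (e ∈? X)) (edgesAt C w a)
  ... | next with Any.any? (_∈? T) next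
  ...   | yes _ = pure T
  ...   | no  _ = choose next (pure T) λ e → prolong t C X (T ∪ ⁅ e ⁆) (opposite e w) b a

  ----------------------------------------------------------------------
  -- One step

  -- The selected colors; in `three c c′ c″` the distinguished color is c″.
  data Selection : Set where
    two   : (c c′ : Color) → Selection
    three : (c c′ c″ : Color) → Selection

  -- The colors b for which a (+a-b)-deficiency at v is eliminated: one of c, c′
  -- whenever that is possible, otherwise the distinguished color.
  partners : Selection → EdgeMap → Vertex → Color → List Color
  partners (two c c′)      C v a = filter (deficiency? C v a) (c ∷ c′ ∷ [])
  partners (three c c′ c″) C v a with filter (deficiency? C v a) (c ∷ c′ ∷ [])
  ... | []         = filter (deficiency? C v a) (c″ ∷ [])
  ... | bs@(_ ∷ _) = bs

  -- Eliminate the deficiency at v, if there is one.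
  eliminateAt : Selection → EdgeMap → Vertex → Dist EdgeMap
  eliminateAt s C v =
    choose (doubledEdges C v) (pure C) λ e →
    let a = lookup C e in
    choose (partners s C v a) (pure C) λ b →
    prolong m C ⊥ ⁅ e ⁆ (opposite e v) b a >>= λ T →
    pure (flip a b T C)

  -- Eliminating one deficiency may also remove another one, so the deficient
  -- vertices are determined anew each time; they are treated in the order of
  -- their labels, and t bounds their number.
  eliminate : (t : ℕ) → Selection → EdgeMap → Dist EdgeMap
  eliminate zero    s C = pure C
  eliminate (suc t) s C with deficientVertices C
  ... | []    = pure C
  ... | v ∷ _ = eliminateAt s C v >>= eliminate t s

  -- φ₁⁻¹
  flipSelected : Selection → EdgeMap → Dist EdgeMap
  flipSelected s C = mix ( (+ 1 / 3 , pure C)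
                         ∷ (+ 1 / 3 , one s)
                         ∷ (+ 1 / 3 , both s)
                         ∷ [] )
    where
    pairOf : Color → Color → Dist EdgeMap
    pairOf c c′ = let H = twoColored c c′ C in
      choose (pairs (filter (oneOuterEnd? H) (subPaths H))) (pure C)
        λ (S , S′) → pure (flip c c′ S′ (flip c c′ S C))

    one both : Selection → Dist EdgeMap
    one (two c c′)      = let H = twoColored c c′ C in
      choose (subPaths H ++ cycles H) (pure C) λ S → pure (flip c c′ S C)
    one (three c c′ c″) = let H = twoColored c c′ C in
      choose (filter (hasInnerEnd? H) (subPaths H)) (pure C) λ S → pure (flip c c′ S C)
    both (two c c′)      = pairOf c c′
    both (three c c′ c″) = pairOf c c′

  -- f for two colors
  perturb₂ : (c c′ : Color) → EdgeMap → Dist EdgeMap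
  perturb₂ c c′ K with deficientVertices K
  ... | []           = mix ( (½ , choose (filter (_∈? twoColored c c′ K) (allFin m)) (pure K)
                                    λ e → pure (flip c c′ ⁅ e ⁆ K))
                           ∷ (½ , pure K)
                           ∷ [] )
  ... | vs@(_ ∷ _)   = choose vs (pure K) λ v →
                       choose (doubledEdges K v) (pure K) λ e →
                       pure (flip c c′ ⁅ e ⁆ K)

  -- f for three colors
  perturb₃ : (c c′ c″ : Color) → EdgeMap → Dist EdgeMap
  perturb₃ c c′ c″ K = byDeficient (deficientVertices K)
    where
    atDeficient : Vertex → Dist EdgeMap
    atDeficient v =
      choose (doubledEdges K v) (pure K) λ e →
      let a = lookup K e in
      prolong m K ⊥ ⁅ e ⁆ (opposite e v) c″ a >>= λ T →
      prolong m K ⊥ T v c″ a >>= λ T′ →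
      pure (flip a c″ T′ K)

    atNondeficient : Vertex → Dist EdgeMap
    atNondeficient v =
      choose (edgesAt K v c″) (pure K) λ e →
      choose (edgesAt K v c ++ edgesAt K v c′) (pure K) λ f →
      let a = lookup K f in
      prolong m K ⁅ f ⁆ ⁅ e ⁆ (opposite e v) a c″ >>= λ T →
      pure (flip a c″ T K)

    candidates : List Vertex
    candidates = filter
      (λ v → ¬? (deficient? K v)
         ×-dec (1 ℕ.≤? length (edgesAt K v c″))
         ×-dec (1 ℕ.≤? length (edgesAt K v c ++ edgesAt K v c′)))
      (allFin n)

    nondeficient : Dist EdgeMap
    nondeficient = choose candidates (pure K) atNondeficient

    byDeficient : List Vertex → Dist EdgeMap
    byDeficient []             = nondeficient
    byDeficient (v ∷ [])       = mix ( (½ , atDeficient v) ∷ (½ , nondeficient) ∷ [] )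
    byDeficient vs@(_ ∷ _ ∷ _) = choose vs (pure K) atDeficient

  perturb : Selection → EdgeMap → Dist EdgeMap
  perturb (two c c′)      = perturb₂ c c′
  perturb (three c c′ c″) = perturb₃ c c′ c″

  -- A way of transforming C₁ into C₂: doing nothing, or a selection of colors
  -- and the transformations C₁ ↦ K₁ ↦ K₂ ↦ C₂ (namely φ₁⁻¹, f and φ₂),
  -- recorded by the intermediate maps.
  data Way : Set where
    nothing : Way
    via     : (s : Selection) (K₁ K₂ : EdgeMap) → Way

  selections₂ selections₃ : List Selection
  selections₂ = map (λ (c , c′) → two c c′) (pairs (allFin k))
  selections₃ = concatMap
    (λ (a , b , d) → three a b d ∷ three a d b ∷ three b d a ∷ [])
    (triples (allFin k))

  stay : EdgeMap → Dist (Way × EdgeMap)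
  stay C = pure (nothing , C)

  transform : EdgeMap → Selection → Dist (Way × EdgeMap)
  transform C s =
    flipSelected s C   >>= λ K₁ →
    perturb s K₁       >>= λ K₂ →
    eliminate n s K₂   >>= λ C′ →
    pure (via s K₁ K₂ , C′)

  -- Choosing uniformly from `selections₃` is the same as choosing one of the
  -- triples uniformly and then one of its members as distinguished.
  step : EdgeMap → Dist (Way × EdgeMap)
  step C = mix ( (½       , stay C)
               ∷ (+ 1 / 4 , choose selections₂ (stay C) (transform C))
               ∷ (+ 1 / 4 , choose selections₃ (stay C) (transform C))
               ∷ [] )

  ----------------------------------------------------------------------
  -- Probability of a way

  _≟ᵐ_ : DecidableEquality EdgeMap
  _≟ᵐ_ = Vec.≡-dec _≟_

  _≟ˢ_ : DecidableEquality Selection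
  two c c′      ≟ˢ two d d′      = map′ (λ { (refl , refl) → refl }) (λ { refl → refl , refl })
                                     (c ≟ d ×-dec c′ ≟ d′)
  two _ _       ≟ˢ three _ _ _   = no λ ()
  three _ _ _   ≟ˢ two _ _       = no λ ()
  three c c′ c″ ≟ˢ three d d′ d″ = map′ (λ { (refl , refl , refl) → refl }) (λ { refl → refl , refl , refl })
                                     (c ≟ d ×-dec c′ ≟ d′ ×-dec c″ ≟ d″)

  _≟ʷ_ : DecidableEquality Way
  nothing     ≟ʷ nothing     = yes refl
  nothing     ≟ʷ via _ _ _   = no λ ()
  via _ _ _   ≟ʷ nothing     = no λ ()
  via s K₁ K₂ ≟ʷ via t L₁ L₂ = map′ (λ { (refl , refl , refl) → refl }) (λ { refl → refl , refl , refl })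
                                 (s ≟ˢ t ×-dec K₁ ≟ᵐ L₁ ×-dec K₂ ≟ᵐ L₂)

  -- P⟨ C₂ , w ∣ C₁ ⟩: the probability that C₂ is proposed from C₁ via w.
  P⟨_,_∣_⟩ : EdgeMap → Way → EdgeMap → ℚ
  P⟨ C₂ , w ∣ C₁ ⟩ = prob (λ x → Product.≡-dec _≟ʷ_ _≟ᵐ_ x (w , C₂)) (step C₁)

  -- w is one of the ways by which C₂ can be proposed from C₁.  The algorithm
  -- presupposes that the inverses of such ways are themselves ways from C₂ to
  -- C₁.  Not every w satisfies this: with two colors, if K₁ has two deficient
  -- vertices and f recolors the last edge of a path, K₂ has one deficient
  -- vertex, from which f cannot recolor that edge back; with three colors,
  -- φ₂ may have to flip a path that uses c″.
  IsWay : (C₁ C₂ : EdgeMap) → Way → Set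
  IsWay C₁ C₂ w = Positive P⟨ C₂ , w ∣ C₁ ⟩

  -- w′ is an inverse, leading from C₂ back to C₁, of the way w from C₁ to C₂.
  -- By `reversed`, it undoes φ₁⁻¹, f and φ₂ in reverse order.  When φ₁⁻¹ flips
  -- a cycle or a whole path component, no deficiency arises whose elimination
  -- could undo it, so that w′ = `via s K₂ K₁` is not among the ways from C₂ to
  -- C₁; such a flip is undone by repeating it.  In general, for two colors the
  -- flips commute and are involutions, so w is also undone by repeating the
  -- same flips (of D₁, then D₂, then finally of what φ₂ flips).
  data Inverse (C₁ C₂ : EdgeMap) : Way → Way → Set where
    nothing  : Inverse C₁ C₂ nothing nothing
    reversed : ∀ {s K₁ K₂} → Inverse C₁ C₂ (via s K₁ K₂) (via s K₂ K₁)
    repeated : ∀ {c c′ K₁ K₂ L₁ L₂} (D₁ D₂ : EdgeSet) →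
               K₁ ≡ flip c c′ D₁ C₁ → K₂ ≡ flip c c′ D₂ K₁ →
               L₁ ≡ flip c c′ D₁ C₂ → L₂ ≡ flip c c′ D₂ L₁ →
               Inverse C₁ C₂ (via (two c c′) K₁ K₂) (via (two c c′) L₁ L₂)

  ----------------------------------------------------------------------
  -- The Metropolis-Hastings algorithm

  module MetropolisHastings (g : EdgeMap → ℚ) (g⁺ : ∀ C → Positive (g C)) where

    weight : (C C′ : EdgeMap) → Way → ℚ
    weight C C′ w = g C * P⟨ C′ , w ∣ C ⟩

    weight⁺ : ∀ C C′ w → IsWay C C′ w → Positive (weight C C′ w)
    weight⁺ C C′ w p = ℚ.pos*pos⇒pos (g C) {{g⁺ C}} P⟨ C′ , w ∣ C ⟩ {{p}}

    ratio : ∀ C₁ C₂ w w′ → IsWay C₁ C₂ w → ℚ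
    ratio C₁ C₂ w w′ p = _÷_ (weight C₂ C₁ w′) (weight C₁ C₂ w)
      {{ℚ.pos⇒nonZero (weight C₁ C₂ w) {{weight⁺ C₁ C₂ w p}}}}

    ratio⁺ : ∀ C₁ C₂ w w′ (p : IsWay C₁ C₂ w) → IsWay C₂ C₁ w′ → Positive (ratio C₁ C₂ w w′ p)
    ratio⁺ C₁ C₂ w w′ p p′ = ℚ.pos*pos⇒pos
      (weight C₂ C₁ w′) {{weight⁺ C₂ C₁ w′ p′}}
      ((1/ weight C₁ C₂ w) {{ℚ.pos⇒nonZero (weight C₁ C₂ w) {{weight⁺ C₁ C₂ w p}}}})
      {{ℚ.1/pos⇒pos (weight C₁ C₂ w) {{weight⁺ C₁ C₂ w p}}}}

    -- Acceptance probability of the proposal C₂ made from C₁ via w, where the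
    -- inverse way of w is w′.
    acceptance : ∀ C₁ C₂ w w′ → IsWay C₁ C₂ w → ℚ
    acceptance C₁ C₂ w w′ p = 1ℚ ⊓ ratio C₁ C₂ w w′ p

    acceptance⁺ : ∀ C₁ C₂ w w′ (p : IsWay C₁ C₂ w) → IsWay C₂ C₁ w′ →
                  Positive (acceptance C₁ C₂ w w′ p)
    acceptance⁺ C₁ C₂ w w′ p p′ with ℚ.⊓-sel 1ℚ (ratio C₁ C₂ w w′ p)
    ... | inj₁ eq = subst Positive (sym eq) _
    ... | inj₂ eq = subst Positive (sym eq) (ratio⁺ C₁ C₂ w w′ p p′)

    acceptance⁻¹ : ∀ C₁ C₂ w w′ → IsWay C₁ C₂ w → IsWay C₂ C₁ w′ → ℚ
    acceptance⁻¹ C₁ C₂ w w′ p p′ = 1/_ (acceptance C₁ C₂ w w′ p)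
      {{ℚ.pos⇒nonZero (acceptance C₁ C₂ w w′ p) {{acceptance⁺ C₁ C₂ w w′ p p′}}}}

{-# OPTIONS --safe #-}
module Submission where

-- Given the selected colors, P(C₂ , w ∣ C₁) is at most the probability of
-- selecting them, so it suffices to bound the probability of φ₁⁻¹, f and φ₂ in
-- the inverse way from below.  Write n = |V|, and let H be the graph of the
-- colors c, c′.
--   Since G is bipartite, H can be oriented so that every vertex has at most one
-- outgoing and one incoming edge: c-edges lead from one side to the other and
-- c′-edges back.  Hence a sub-path is determined by its first vertex and its
-- length, which gives at most n² sub-paths and at most n² cycles, and a sub-path
-- with exactly one outer end is determined by its inner end and a direction,
-- which gives at most 2n(2n − 1)/2 pairs of them.  So φ₁⁻¹ has probability at
-- least 1/(3n²) for one flipped path and three colors, and 1/(6n²) otherwise.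
--   At most two vertices are deficient at any time.  By bipartiteness an
-- alternating path from a deficient vertex v never returns to v, so an
-- elimination removes the deficiency of v and creates none, and φ₂ has
-- probability at least 1/4.  With two colors f has probability at least
-- 1/(4(n − 1)), and (6n²)(4(n − 1))4 is the bound.  With three colors an
-- alternating path branches at most once, so f has probability at least
-- 1/(8(n − 1)), and (3n²)(8(n − 1))4 is the bound when one path was flipped.  A
-- flipped pair leaves either no deficient vertex, and f has probability at least
-- 1/(2n), or two of them, and f has probability at least 1/8.

open import Defs
open import Data.Bool.Base using (Bool; true; false; not; if_then_else_; _xor_; _∨_)
import Data.Bool.Properties as Bool
open import Data.Empty using (⊥-elim)
open import Data.Fin.Base using (Fin)
open import Data.Fin.Properties using (_≟_; any?; injective⇒≤)
open import Data.Fin.Subset using (Subset; ⁅_⁆; _∪_; ∣_∣; _⊆_) renaming (_∈_ to _∈ₛ_; _∉_ to _∉ₛ_; ⊥ to ∅)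
open import Data.Fin.Subset.Properties
  using (_∈?_; x∈⁅x⁆; x∈⁅y⁆⇒x≡y; x∈p∪q⁺; x∈p∪q⁻; ∪-assoc; ∪-comm; ∉⊥; p⊂q⇒∣p∣<∣q∣; ∣p∣≤n; p⊆p∪q; ∣⁅x⁆∣≡1)
open import Data.Integer.Base using (+_)
import Data.Integer.Base as ℤ
import Data.Integer.Properties as ℤ
open import Data.List.Base
  using (List; []; _∷_; _++_; map; concatMap; filter; length; allFin; upTo; cartesianProduct)
import Data.List.Base as List
open import Data.List.Membership.Propositional using (_∈_; lose; find)
open import Data.List.Membership.Propositional.Properties
  using (∈-++⁻; ∈-map⁻; ∈-filter⁺; ∈-filter⁻; ∈-allFin; ∈-concatMap⁻; ∈-deduplicate⁻; ∈-cartesianProduct⁺; ∈-lookup)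
import Data.List.Membership.Setoid.Properties as SetoidMembership
open import Data.List.Properties
  using (length-++; length-map; length-filter; filter-notAll; filter-accept; filter-reject; filter-none; length-tabulate; length-upTo)
open import Data.List.Relation.Unary.All as All using (All; []; _∷_)
import Data.List.Relation.Unary.All.Properties as All
open import Data.List.Relation.Unary.AllPairs using ([]; _∷_)
open import Data.List.Relation.Unary.Any as Any using (Any; here; there; index)
open import Data.List.Relation.Unary.Unique.DecPropositional.Properties using (deduplicate-!)
open import Data.List.Relation.Unary.Unique.Propositional using (Unique)
open import Data.List.Relation.Unary.Unique.Propositional.Properties using (allFin⁺; filter⁺)
open import Data.Nat.Base using (ℕ; zero; suc; _≤_; _<_; z≤n; s≤s; _∸_; _*_; _^_)
import Data.Nat.Base as ℕ
import Data.Nat.Properties as ℕ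
open import Data.Nat.Tactic.RingSolver using (solve-∀)
open import Data.Product.Base using (∃; ∃-syntax; _×_; _,_; proj₁; proj₂)
import Data.Product.Properties as Product
open import Data.Rational.Base as ℚ using (ℚ; 0ℚ; 1ℚ; ½; Positive; _/_; NonNegative)
import Data.Rational.Properties as ℚ
import Data.Rational.Unnormalised.Base as ℚᵘ
import Data.Rational.Unnormalised.Properties as ℚᵘ
open import Data.Sum.Base using (_⊎_; inj₁; inj₂; [_,_]′)
open import Data.Unit.Base using (tt)
open import Data.Vec.Base using (lookup; tabulate; zipWith)
open import Data.Vec.Properties
  using (lookup∘tabulate; tabulate-cong; lookup-zipWith; []=⇒lookup; lookup⇒[]=; ≡-dec)
open import Function.Base using (_∘_; id)
open import Relation.Binary.PropositionalEquality
  using (_≡_; _≢_; refl; sym; trans; cong; cong₂; subst; subst₂; ≢-sym; setoid)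
open import Relation.Nullary.Decidable using (Dec; yes; no; does; dec-true; dec-false; map′; ¬?; _×-dec_; _⊎-dec_)
open import Relation.Nullary.Negation.Core using (¬_; contradiction)

-- Only one entry of the experiment is followed in the inverse way: an outcome may be listed several
-- times, but a single entry of weight at least 1/N already bounds its probability from below. The
-- obstacle is that φ₂ of the inverse way works on `K₁`. With three colors f may recolor edges of
-- color `c″`, so the run of the inverse way alone does not control `K₁`. The given way, however,
-- reaches `K₁` from the coloring `C₁` by flipping `c` and `c′` only. Hence both ways are used, and
-- what is carried along is the invariant `Tame`, which such flips preserve. Trails are treated in
-- two ways. In a coloring the orientation is deterministic and sub-paths are walks in it. At a
-- deficient vertex two edges point the same way, so eliminations are followed by an invariant of
-- the growing trail instead. With three colors the estimate for φ₁⁻¹ is worse by a factor 2 for a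
-- flipped pair than for a single path. The better bounds for f with no or two deficient vertices
-- make up for it, which is why the number of deficient vertices is recorded.

-- Counting in lists without repetitions

module _ {A B : Set} where

  -- Keys are attached by a relation and not by a function, because the objects counted later
  -- (sub-paths, for instance) have several descriptions, none of them canonical. The position of a
  -- chosen key in `ys` is an injective function of the position in `xs`.
  length-≤-via : {R : A → B → Set} {xs : List A} {ys : List B} → Unique xs →
                 (∀ {x} → x ∈ xs → ∃ λ y → y ∈ ys × R x y) →
                 (∀ {x x′ y} → x ∈ xs → x′ ∈ xs → R x y → R x′ y → x ≡ x′) →
                 length xs ≤ length ys
  length-≤-via {R} {xs} {ys} u key inj = injective⇒≤ {f = f} f-injective
    where
    f : Fin (length xs) → Fin (length ys)
    f i = index (proj₁ (proj₂ (key (∈-lookup i))))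

    lookup-injective : ∀ {zs : List A} → Unique zs → ∀ i j → List.lookup zs i ≡ List.lookup zs j → i ≡ j
    lookup-injective (_ ∷ _)  Fin.zero    Fin.zero    _  = refl
    lookup-injective (p ∷ _)  Fin.zero    (Fin.suc j) eq = contradiction eq (All.lookup p (∈-lookup j))
    lookup-injective (p ∷ _)  (Fin.suc i) Fin.zero    eq = contradiction (sym eq) (All.lookup p (∈-lookup i))
    lookup-injective (_ ∷ us) (Fin.suc i) (Fin.suc j) eq = cong Fin.suc (lookup-injective us i j eq)

    f-injective : ∀ {i j} → f i ≡ f j → i ≡ j
    f-injective {i} {j} eq with key (∈-lookup i) | key (∈-lookup j)
    ... | y , y∈ , r | y′ , y′∈ , r′
      with refl ← SetoidMembership.index-injective (setoid B) y∈ y′∈ eq =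
      lookup-injective u i j (inj (∈-lookup i) (∈-lookup j) r r′)

  length-cartesianProduct : (xs : List A) (ys : List B) → length (cartesianProduct xs ys) ≡ length xs * length ys
  length-cartesianProduct []       ys = refl
  length-cartesianProduct (x ∷ xs) ys = trans (length-++ (map (x ,_) ys))
    (cong₂ ℕ._+_ (length-map (x ,_) ys) (length-cartesianProduct xs ys))

module _ {A : Set} where

  length-≤-⊆ : {xs ys : List A} → Unique xs → (∀ {x} → x ∈ xs → x ∈ ys) → length xs ≤ length ys
  length-≤-⊆ u sub = length-≤-via {R = _≡_} u (λ x∈ → _ , sub x∈ , refl) (λ _ _ eq eq′ → trans eq (sym eq′))

  length-≤1 : {xs : List A} → Unique xs → (∀ {x y} → x ∈ xs → y ∈ xs → x ≡ y) → length xs ≤ 1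
  length-≤1 {[]}         _             _  = z≤n
  length-≤1 {_ ∷ []}     _             _  = s≤s z≤n
  length-≤1 {_ ∷ _ ∷ _} ((x≢y ∷ _) ∷ _) eq = contradiction (eq (here refl) (there (here refl))) x≢y

  length-≤2 : {xs : List A} → Unique xs →
              (∀ {x y z} → x ∈ xs → y ∈ xs → z ∈ xs → x ≡ y ⊎ x ≡ z ⊎ y ≡ z) → length xs ≤ 2
  length-≤2 {[]}             _ _ = z≤n
  length-≤2 {_ ∷ []}         _ _ = s≤s z≤n
  length-≤2 {_ ∷ _ ∷ []}     _ _ = s≤s (s≤s z≤n)
  length-≤2 {_ ∷ _ ∷ _ ∷ _} ((x≢y ∷ x≢z ∷ _) ∷ (y≢z ∷ _) ∷ _) eq
    with eq (here refl) (there (here refl)) (there (there (here refl)))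
  ... | inj₁ p        = contradiction p x≢y
  ... | inj₂ (inj₁ p) = contradiction p x≢z
  ... | inj₂ (inj₂ p) = contradiction p y≢z

  length-≤1⇒≡ : {xs : List A} → length xs ≤ 1 → ∀ {x y} → x ∈ xs → y ∈ xs → x ≡ y
  length-≤1⇒≡ {_ ∷ []} _ (here refl) (here refl) = refl
  length-≤1⇒≡ {_ ∷ _ ∷ _} (s≤s ()) _ _

  ≢⇒2≤length : {xs : List A} {x y : A} → x ∈ xs → y ∈ xs → x ≢ y → 2 ≤ length xs
  ≢⇒2≤length {_ ∷ []}     (here refl) (here refl) x≢y = contradiction refl x≢y
  ≢⇒2≤length {_ ∷ _ ∷ _} _ _ _ = s≤s (s≤s z≤n)

  ∈⇒0<length : {xs : List A} {x : A} → x ∈ xs → 1 ≤ length xs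
  ∈⇒0<length {_ ∷ _} _ = s≤s z≤n

  0<length⇒∈ : {xs : List A} → 1 ≤ length xs → ∃[ x ] x ∈ xs
  0<length⇒∈ {x ∷ _} _ = x , here refl

  2≤length⇒≢ : {xs : List A} → Unique xs → 2 ≤ length xs → ∃[ x ] ∃[ y ] x ∈ xs × y ∈ xs × x ≢ y
  2≤length⇒≢ {x ∷ y ∷ _} ((x≢y ∷ _) ∷ _) _ = x , y , here refl , there (here refl) , x≢y
  2≤length⇒≢ {_ ∷ []} _ (s≤s ())

  among-two : {xs : List A} → length xs ≤ 2 → ∀ {x} → x ∈ xs → ∃[ y ] (∀ {z} → z ∈ xs → z ≡ x ⊎ z ≡ y)
  among-two {x ∷ []}     _ (here refl)         = x , λ { (here refl) → inj₁ refl }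
  among-two {x ∷ y ∷ []} _ (here refl)         = y , λ { (here refl) → inj₁ refl ; (there (here refl)) → inj₂ refl }
  among-two {x ∷ y ∷ []} _ (there (here refl)) = x , λ { (here refl) → inj₂ refl ; (there (here refl)) → inj₁ refl }
  among-two {_ ∷ _ ∷ _ ∷ _} (s≤s (s≤s ())) _

  pairs⁻ : ∀ {xs : List A} {x y} → Unique xs → (x , y) ∈ pairs xs → x ∈ xs × y ∈ xs × x ≢ y
  pairs⁻ {x ∷ xs} (x∉ ∷ u) p∈ with ∈-++⁻ (map (x ,_) xs) p∈
  ... | inj₁ q∈ with y , y∈ , refl ← ∈-map⁻ (x ,_) q∈ = here refl , there y∈ , All.lookup x∉ y∈
  ... | inj₂ q∈ with y∈ , z∈ , y≢z ← pairs⁻ u q∈ = there y∈ , there z∈ , y≢z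

  triples⁻ : ∀ {xs : List A} {x y z} → Unique xs → (x , y , z) ∈ triples xs →
             x ≢ y × x ≢ z × y ≢ z
  triples⁻ {x ∷ xs} (x∉ ∷ u) p∈ with ∈-++⁻ (map (x ,_) (pairs xs)) p∈
  ... | inj₂ q∈ = triples⁻ u q∈
  ... | inj₁ q∈ with (y , z) , yz∈ , refl ← ∈-map⁻ (x ,_) q∈
                with y∈ , z∈ , y≢z ← pairs⁻ u yz∈ = All.lookup x∉ y∈ , All.lookup x∉ z∈ , y≢z

  -- Twice the number of pairs is a(a - 1) for a list of length a. Rounding it up to a² gives 2N²,
  -- for N = n the same number as the bound for sub-paths and cycles together.
  length-pairs-≤ : ∀ (xs : List A) {N} → length xs ≤ 2 * N → length (pairs xs) ≤ 2 * (N * N)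
  length-pairs-≤ xs {N} le = ℕ.*-cancelˡ-≤ 2 (begin
    2 * length (pairs xs)              ≤⟨ ℕ.m≤m+n _ _ ⟩
    2 * length (pairs xs) ℕ.+ length xs ≡⟨ twice xs ⟩
    length xs * length xs              ≤⟨ ℕ.*-mono-≤ le le ⟩
    2 * N * (2 * N)                    ≡⟨ arith N ⟩
    2 * (2 * (N * N))                  ∎)
    where
    open ℕ.≤-Reasoning
    arith : ∀ N → 2 * N * (2 * N) ≡ 2 * (2 * (N * N))
    arith = solve-∀
    step : ∀ a p → 2 * (a ℕ.+ p) ℕ.+ suc a ≡ (2 * p ℕ.+ a) ℕ.+ (a ℕ.+ suc a)
    step = solve-∀
    square : ∀ a → a * a ℕ.+ (a ℕ.+ suc a) ≡ suc a * suc a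
    square = solve-∀
    twice : ∀ ys → 2 * length (pairs ys) ℕ.+ length ys ≡ length ys * length ys
    twice []       = refl
    twice (y ∷ ys)
      rewrite length-++ (map (y ,_) ys) {pairs ys} | length-map (y ,_) ys
            | step (length ys) (length (pairs ys)) | twice ys = square (length ys)

-- Naturals among the rationals, and lower bounds of the form 1/N

ι : ℕ → ℚ
ι n = + n / 1

private
  -- Division in `ℚ` cancels the greatest common divisor and does not compute for a variable `n`, so
  -- the identities for `ι` are checked among the unnormalised rationals.
  toℚᵘ-ι : ∀ n → ℚ.toℚᵘ (ι n) ℚᵘ.≃ ℚᵘ.mkℚᵘ (+ n) 0
  toℚᵘ-ι n = ℚ.toℚᵘ-fromℚᵘ (ℚᵘ.mkℚᵘ (+ n) 0)

ι-* : ∀ m n → ι (m * n) ≡ ι m ℚ.* ι n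
ι-* m n = ℚ.toℚᵘ-injective (begin-equality
  ℚ.toℚᵘ (ι (m * n))                       ≃⟨ toℚᵘ-ι (m * n) ⟩
  ℚᵘ.mkℚᵘ (+ (m * n)) 0                    ≡⟨ cong (λ i → ℚᵘ.mkℚᵘ i 0) (ℤ.pos-* m n) ⟩
  ℚᵘ.mkℚᵘ (+ m) 0 ℚᵘ.* ℚᵘ.mkℚᵘ (+ n) 0      ≃⟨ ℚᵘ.*-cong (toℚᵘ-ι m) (toℚᵘ-ι n) ⟨
  ℚ.toℚᵘ (ι m) ℚᵘ.* ℚ.toℚᵘ (ι n)            ≃⟨ ℚ.toℚᵘ-homo-* (ι m) (ι n) ⟨
  ℚ.toℚᵘ (ι m ℚ.* ι n)                     ∎)
  where open ℚᵘ.≤-Reasoning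

ι-suc : ∀ n → ι (suc n) ≡ 1ℚ ℚ.+ ι n
ι-suc n = ℚ.toℚᵘ-injective (begin-equality
  ℚ.toℚᵘ (ι (suc n))                       ≃⟨ toℚᵘ-ι (suc n) ⟩
  ℚᵘ.mkℚᵘ (+ suc n) 0                      ≃⟨ ℚᵘ.*≡* (cong (λ i → (+ 1 ℤ.+ i) ℤ.* + 1) (sym (ℤ.*-identityʳ (+ n)))) ⟩
  ℚᵘ.1ℚᵘ ℚᵘ.+ ℚᵘ.mkℚᵘ (+ n) 0               ≃⟨ ℚᵘ.+-congʳ ℚᵘ.1ℚᵘ (toℚᵘ-ι n) ⟨
  ℚᵘ.1ℚᵘ ℚᵘ.+ ℚ.toℚᵘ (ι n)                  ≃⟨ ℚ.toℚᵘ-homo-+ 1ℚ (ι n) ⟨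
  ℚ.toℚᵘ (1ℚ ℚ.+ ι n)                      ∎)
  where open ℚᵘ.≤-Reasoning

ι-mono : ∀ {m n} → m ≤ n → ι m ℚ.≤ ι n
ι-mono {m} {n} m≤n = ℚ.toℚᵘ-cancel-≤ (begin
  ℚ.toℚᵘ (ι m)      ≃⟨ toℚᵘ-ι m ⟩
  ℚᵘ.mkℚᵘ (+ m) 0   ≤⟨ ℚᵘ.*≤* (ℤ.*-monoʳ-≤-nonNeg (+ 1) (ℤ.+≤+ m≤n)) ⟩
  ℚᵘ.mkℚᵘ (+ n) 0   ≃⟨ toℚᵘ-ι n ⟨
  ℚ.toℚᵘ (ι n)      ∎)
  where open ℚᵘ.≤-Reasoning

ι-nonNegative : ∀ n → NonNegative (ι n)
ι-nonNegative n = ℚ.nonNegative (ι-mono {0} {n} z≤n)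

1/suc*suc : ∀ k → + 1 / suc k ℚ.* ι (suc k) ≡ 1ℚ
1/suc*suc k = ℚ.toℚᵘ-injective (begin-equality
  ℚ.toℚᵘ (+ 1 / suc k ℚ.* ι (suc k))               ≃⟨ ℚ.toℚᵘ-homo-* (+ 1 / suc k) (ι (suc k)) ⟩
  ℚ.toℚᵘ (+ 1 / suc k) ℚᵘ.* ℚ.toℚᵘ (ι (suc k))      ≃⟨ ℚᵘ.*-cong (ℚ.toℚᵘ-fromℚᵘ (ℚᵘ.mkℚᵘ (+ 1) k)) (toℚᵘ-ι (suc k)) ⟩
  ℚᵘ.mkℚᵘ (+ 1) k ℚᵘ.* ℚᵘ.mkℚᵘ (+ suc k) 0          ≃⟨ ℚᵘ.*≡* (arith (+ suc k)) ⟩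
  ℚᵘ.1ℚᵘ                                           ∎)
  where
  open ℚᵘ.≤-Reasoning
  open import Data.Integer.Tactic.RingSolver renaming (solve-∀ to solveℤ)
  arith : ∀ i → (+ 1 ℤ.* i) ℤ.* + 1 ≡ + 1 ℤ.* (i ℤ.* + 1)
  arith = solveℤ

1/suc≥0 : ∀ k → 0ℚ ℚ.≤ + 1 / suc k
1/suc≥0 k = ℚ.nonNegative⁻¹ (+ 1 / suc k) {{ℚ.normalize-nonNeg 1 (suc k)}}

-- r ≥ 1/N, without division.
record Recip (r : ℚ) (N : ℕ) : Set where
  constructor recip
  field 1≤* : 1ℚ ℚ.≤ r ℚ.* ι N
open Recip public

recip-1/suc : ∀ k → Recip (+ 1 / suc k) (suc k)
recip-1/suc k = recip (ℚ.≤-reflexive (sym (1/suc*suc k)))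

recip-1 : Recip 1ℚ 1
recip-1 = recip ℚ.≤-refl

recip-* : ∀ {p q N M} → Recip p N → Recip q M → Recip (p ℚ.* q) (N * M)
recip-* {p} {q} {N} {M} (recip a) (recip b) = recip (begin
  1ℚ                                ≤⟨ a ⟩
  p ℚ.* ι N                         ≡⟨ ℚ.*-identityʳ _ ⟨
  p ℚ.* ι N ℚ.* 1ℚ                  ≤⟨ ℚ.*-monoˡ-≤-nonNeg (p ℚ.* ι N) {{ℚ.nonNegative (ℚ.≤-trans 0≤1 a)}} b ⟩
  p ℚ.* ι N ℚ.* (q ℚ.* ι M)         ≡⟨ interchange p (ι N) q (ι M) ⟩
  p ℚ.* q ℚ.* (ι N ℚ.* ι M)         ≡⟨ cong (p ℚ.* q ℚ.*_) (ι-* N M) ⟨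
  p ℚ.* q ℚ.* ι (N * M)             ∎)
  where
  open ℚ.≤-Reasoning
  open import Algebra.Bundles using (CommutativeMonoid)
  open import Algebra.Properties.CommutativeSemigroup
    (CommutativeMonoid.commutativeSemigroup ℚ.*-1-commutativeMonoid) using (interchange)
  0≤1 : 0ℚ ℚ.≤ 1ℚ
  0≤1 = ι-mono {0} {1} z≤n

-- If r ≤ 0, then r N ≤ 0 < 1; so r is positive and N may be enlarged.
recip-mono : ∀ {r N M} → N ≤ M → Recip r N → Recip r M
recip-mono {r} {N} {M} N≤M (recip a) with ℚ.≤-total r 0ℚ
... | inj₂ 0≤r = recip (ℚ.≤-trans a (ℚ.*-monoˡ-≤-nonNeg r {{ℚ.nonNegative 0≤r}} (ι-mono N≤M)))
... | inj₁ r≤0 = contradiction 1≤0 λ { (ℚ.*≤* (ℤ.+≤+ ())) }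
  where
  1≤0 : 1ℚ ℚ.≤ 0ℚ
  1≤0 = ℚ.≤-trans a (ℚ.≤-trans (ℚ.*-monoʳ-≤-nonNeg (ι N) {{ι-nonNegative N}} r≤0) (ℚ.≤-reflexive (ℚ.*-zeroˡ (ι N))))

-- Entries of a random experiment and their weights

module _ {A : Set} where

  ∈-pure⁻ : ∀ {r} {x y : A} → (r , x) ∈ pure y → r ≡ 1ℚ × x ≡ y
  ∈-pure⁻ (here refl) = refl , refl

  ∈-mix⁻ : ∀ {ds : List (ℚ × Dist A)} {r x} → (r , x) ∈ mix ds →
           ∃[ p ] ∃[ d ] ∃[ q ] (p , d) ∈ ds × (q , x) ∈ d × r ≡ p ℚ.* q
  ∈-mix⁻ {ds} x∈ with (p , d) , pd∈ , x∈′ ← find (∈-concatMap⁻ (λ (p , d) → map (λ (q , y) → (p ℚ.* q , y)) d) {xs = ds} x∈)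
                 with (q , _) , q∈ , refl ← ∈-map⁻ (λ (q , y) → (p ℚ.* q , y)) x∈′ = p , d , q , pd∈ , q∈ , refl

  mix₂-elim : ∀ {p₁ p₂} {d₁ d₂ : Dist A} (P : ℚ → Set) {r x} →
              (∀ {q} → (q , x) ∈ d₁ → P (p₁ ℚ.* q)) → (∀ {q} → (q , x) ∈ d₂ → P (p₂ ℚ.* q)) →
              (r , x) ∈ mix ((p₁ , d₁) ∷ (p₂ , d₂) ∷ []) → P r
  mix₂-elim {p₁} {p₂} {d₁} {d₂} P {r} {x} f₁ f₂ x∈ = cases (∈-mix⁻ {ds = (p₁ , d₁) ∷ (p₂ , d₂) ∷ []} x∈)
    where
    cases : ∃[ p ] ∃[ d ] ∃[ q ] (p , d) ∈ (p₁ , d₁) ∷ (p₂ , d₂) ∷ [] × (q , x) ∈ d × r ≡ p ℚ.* q → P r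
    cases (_ , _ , _ , here refl         , x∈ , refl) = f₁ x∈
    cases (_ , _ , _ , there (here refl) , x∈ , refl) = f₂ x∈

  mix₃-elim : ∀ {p₁ p₂ p₃} {d₁ d₂ d₃ : Dist A} (P : ℚ → Set) {r x} →
              (∀ {q} → (q , x) ∈ d₁ → P (p₁ ℚ.* q)) → (∀ {q} → (q , x) ∈ d₂ → P (p₂ ℚ.* q)) →
              (∀ {q} → (q , x) ∈ d₃ → P (p₃ ℚ.* q)) →
              (r , x) ∈ mix ((p₁ , d₁) ∷ (p₂ , d₂) ∷ (p₃ , d₃) ∷ []) → P r
  mix₃-elim {p₁} {p₂} {p₃} {d₁} {d₂} {d₃} P {r} {x} f₁ f₂ f₃ x∈ =
    cases (∈-mix⁻ {ds = (p₁ , d₁) ∷ (p₂ , d₂) ∷ (p₃ , d₃) ∷ []} x∈)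
    where
    cases : ∃[ p ] ∃[ d ] ∃[ q ] (p , d) ∈ (p₁ , d₁) ∷ (p₂ , d₂) ∷ (p₃ , d₃) ∷ [] × (q , x) ∈ d × r ≡ p ℚ.* q → P r
    cases (_ , _ , _ , here refl                 , x∈ , refl) = f₁ x∈
    cases (_ , _ , _ , there (here refl)         , x∈ , refl) = f₂ x∈
    cases (_ , _ , _ , there (there (here refl)) , x∈ , refl) = f₃ x∈

module _ {A B : Set} where

  ∈->>=⁻ : ∀ {d : Dist A} {f : A → Dist B} {r x} → (r , x) ∈ (d >>= f) →
           ∃[ p ] ∃[ y ] ∃[ q ] (p , y) ∈ d × (q , x) ∈ f y × r ≡ p ℚ.* q
  ∈->>=⁻ {d} {f} x∈ with p , d′ , q , pd∈ , q∈ , eq ← ∈-mix⁻ {ds = map (λ (p , y) → (p , f y)) d} x∈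
                    with (_ , y) , y∈ , refl ← ∈-map⁻ (λ (p , y) → (p , f y)) pd∈ = p , y , q , y∈ , q∈ , eq

  -- Of the weight only the lower bounds that it inherits are recorded: a choice among at most N
  -- members costs a factor N. The bounds for whole runs are products of such factors.
  ∈-choose⁻ : ∀ {xs : List A} {d : Dist B} {f : A → Dist B} {r z} → (r , z) ∈ choose xs d f →
              (xs ≡ [] × (r , z) ∈ d) ⊎
              (∃[ y ] ∃[ q ] y ∈ xs × (q , z) ∈ f y ×
                 (∀ {N M} → length xs ≤ N → Recip q M → Recip r (N * M)))
  ∈-choose⁻ {[]}                 z∈ = inj₁ (refl , z∈)
  ∈-choose⁻ {x ∷ xs} {f = f} {r} {z} z∈ = inj₂ (uniform (+ 1 / suc (length xs)) (recip-1/suc (length xs)) (x ∷ xs) z∈)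
    where
    uniform : ∀ w → Recip w (suc (length xs)) → ∀ ys → (r , z) ∈ mix (map (λ y → (w , f y)) ys) →
              ∃[ y ] ∃[ q ] y ∈ ys × (q , z) ∈ f y × (∀ {N M} → suc (length xs) ≤ N → Recip q M → Recip r (N * M))
    uniform w rec ys z∈ =
      let p , d , q , pd∈ , q∈ , r≡ = ∈-mix⁻ {ds = map (λ y → (w , f y)) ys} z∈
          y , y∈ , pd≡ = ∈-map⁻ (λ y → (w , f y)) pd∈
      in y , q , y∈ , subst (λ e → (q , z) ∈ proj₂ e) pd≡ q∈ ,
         λ {N} {M} le rec′ → subst (λ r → Recip r (N * M)) (sym (trans r≡ (cong (λ e → proj₁ e ℚ.* q) pd≡))) (recip-* (recip-mono le rec) rec′)

  ∈-choose⁻-∈ : ∀ {xs : List A} {w} {d : Dist B} {f : A → Dist B} {r z} → w ∈ xs → (r , z) ∈ choose xs d f →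
              ∃[ y ] ∃[ q ] y ∈ xs × (q , z) ∈ f y ×
                 (∀ {N M} → length xs ≤ N → Recip q M → Recip r (N * M))
  ∈-choose⁻-∈ {xs} w∈ z∈ with ∈-choose⁻ {xs} z∈
  ... | inj₂ y = y
  ... | inj₁ (refl , _) with () ← w∈

  ∈-choose-pure⁻ : ∀ (xs : List A) {z₀ : B} {h : A → B} {r z} → (r , z) ∈ choose xs (pure z₀) (λ x → pure (h x)) →
                   (z ≡ z₀ × (∀ {N} → 1 ≤ N → Recip r N)) ⊎ (∃[ x ] x ∈ xs × z ≡ h x × (∀ {N} → length xs ≤ N → Recip r N))
  ∈-choose-pure⁻ xs {z₀} {h} {r} {z} z∈ = cases (∈-choose⁻ {xs = xs} {d = pure z₀} {f = λ x → pure (h x)} z∈)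
    where
    chosen : ∀ {q x} → q ≡ 1ℚ × z ≡ h x → x ∈ xs → (∀ {N M} → length xs ≤ N → Recip q M → Recip r (N * M)) →
             z ≡ h x × (∀ {N} → length xs ≤ N → Recip r N)
    chosen (refl , eq) x∈ bd = eq , λ {N} le → subst (Recip r) (ℕ.*-identityʳ N) (bd le recip-1)

    cases : (xs ≡ [] × (r , z) ∈ pure z₀) ⊎
            (∃[ x ] ∃[ q ] x ∈ xs × (q , z) ∈ pure (h x) × (∀ {N M} → length xs ≤ N → Recip q M → Recip r (N * M))) →
            (z ≡ z₀ × (∀ {N} → 1 ≤ N → Recip r N)) ⊎ (∃[ x ] x ∈ xs × z ≡ h x × (∀ {N} → length xs ≤ N → Recip r N))
    cases (inj₁ (_ , z∈)) = let r≡ , z≡ = ∈-pure⁻ z∈ in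
      inj₁ (z≡ , λ {N} 1≤N → subst (λ r → Recip r N) (sym r≡) (recip-mono 1≤N recip-1))
    cases (inj₂ (x , q , x∈ , z∈ , bd)) = inj₂ (x , x∈ , chosen (∈-pure⁻ z∈) x∈ bd)

  -- The inequality `1 ≤ N * M` serves the empty list, where the default is taken with weight 1.
  choose-recip : ∀ {xs : List A} {x : B} {f : A → Dist B} {r z} N M → length xs ≤ N → 1 ≤ N * M →
                 (∀ {y q} → y ∈ xs → (q , z) ∈ f y → Recip q M) → (r , z) ∈ choose xs (pure x) f → Recip r (N * M)
  choose-recip {xs} {x} {f} N M len 1≤ each z∈ with ∈-choose⁻ {xs = xs} {d = pure x} {f = f} z∈
  ... | inj₁ (_ , z∈′) with refl , _ ← ∈-pure⁻ z∈′ = recip-mono 1≤ recip-1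
  ... | inj₂ (_ , _ , y∈ , z∈′ , bd) = bd len (each y∈ z∈′)

-- Total weight and probabilities of outcomes

module _ {A : Set} where

  mass : Dist A → ℚ
  mass = prob λ _ → yes tt

  -- Nonnegativity makes the weight of an entry a lower bound for the probability of its outcome,
  -- and the bound on the mass makes 1 an upper bound for every probability. The two directions of a
  -- way are compared by means of these two facts.
  record SubProbability (d : Dist A) : Set where
    constructor subProbability
    field
      nonNeg : All (λ e → 0ℚ ℚ.≤ proj₁ e) d
      mass≤1 : mass d ℚ.≤ 1ℚ
  open SubProbability public

  module _ {Q : A → Set} (Q? : ∀ x → Dec (Q x)) where

    prob-++ : ∀ d d′ → prob Q? (d ++ d′) ≡ prob Q? d ℚ.+ prob Q? d′
    prob-++ []      d′ = sym (ℚ.+-identityˡ _)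
    prob-++ ((p , x) ∷ d) d′ = trans (cong (w ℚ.+_) (prob-++ d d′)) (sym (ℚ.+-assoc w (prob Q? d) (prob Q? d′)))
      where w = if does (Q? x) then p else 0ℚ

    prob-scale : ∀ p d → prob Q? (map (λ (q , x) → (p ℚ.* q , x)) d) ≡ p ℚ.* prob Q? d
    prob-scale p []            = sym (ℚ.*-zeroʳ p)
    prob-scale p ((q , x) ∷ d) = trans (cong₂ ℚ._+_ (scale-if (does (Q? x))) (prob-scale p d)) (sym (ℚ.*-distribˡ-+ p _ _))
      where
      scale-if : ∀ b → (if b then p ℚ.* q else 0ℚ) ≡ p ℚ.* (if b then q else 0ℚ)
      scale-if true  = refl
      scale-if false = sym (ℚ.*-zeroʳ p)

    prob-mix-∷ : ∀ p d ds → prob Q? (mix ((p , d) ∷ ds)) ≡ p ℚ.* prob Q? d ℚ.+ prob Q? (mix ds)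
    prob-mix-∷ p d ds = trans (prob-++ (map _ d) (mix ds)) (cong (ℚ._+ _) (prob-scale p d))

    prob≥0 : ∀ {d} → All (λ e → 0ℚ ℚ.≤ proj₁ e) d → 0ℚ ℚ.≤ prob Q? d
    prob≥0 [] = ℚ.≤-refl
    prob≥0 {(p , x) ∷ _} (0≤p ∷ ps) with does (Q? x)
    ... | true  = ℚ.+-mono-≤ {0ℚ} {p} 0≤p (prob≥0 ps)
    ... | false = ℚ.+-mono-≤ {0ℚ} {0ℚ} ℚ.≤-refl (prob≥0 ps)

    prob≤mass : ∀ {d} → All (λ e → 0ℚ ℚ.≤ proj₁ e) d → prob Q? d ℚ.≤ mass d
    prob≤mass [] = ℚ.≤-refl
    prob≤mass {(p , x) ∷ _} (0≤p ∷ ps) with does (Q? x)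
    ... | true  = ℚ.+-monoʳ-≤ p (prob≤mass ps)
    ... | false = ℚ.+-mono-≤ 0≤p (prob≤mass ps)

    entry≤prob : ∀ {d r x} → All (λ e → 0ℚ ℚ.≤ proj₁ e) d → (r , x) ∈ d → Q x → r ℚ.≤ prob Q? d
    entry≤prob {_ ∷ d} {r} {x} (_ ∷ ps) (here refl) q rewrite dec-true (Q? x) q =
      subst (ℚ._≤ r ℚ.+ prob Q? d) (ℚ.+-identityʳ r) (ℚ.+-monoʳ-≤ r (prob≥0 ps))
    entry≤prob {(p , y) ∷ d} {r} (0≤p ∷ ps) (there x∈) q =
      subst (ℚ._≤ _) (ℚ.+-identityˡ r) (ℚ.+-mono-≤ (if≥0 (does (Q? y))) (entry≤prob ps x∈ q))
      where
      if≥0 : ∀ b → 0ℚ ℚ.≤ (if b then p else 0ℚ)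
      if≥0 true  = 0≤p
      if≥0 false = ℚ.≤-refl

    prob>0⇒entry : ∀ d → Positive (prob Q? d) → ∃[ r ] ∃[ x ] (r , x) ∈ d × Q x
    prob>0⇒entry []            ()
    prob>0⇒entry ((p , x) ∷ d) pos with Q? x
    ... | yes q = p , x , here refl , q
    ... | no _  with r , y , y∈ , q ← prob>0⇒entry d (subst Positive (ℚ.+-identityˡ (prob Q? d)) pos) = r , y , there y∈ , q

    prob-none : ∀ d → (∀ {r x} → (r , x) ∈ d → ¬ Q x) → prob Q? d ≡ 0ℚ
    prob-none []            _    = refl
    prob-none ((p , x) ∷ d) none rewrite dec-false (Q? x) (none (here refl)) =
      trans (ℚ.+-identityˡ (prob Q? d)) (prob-none d (none ∘ there))

  pure-sub : ∀ x → SubProbability (pure x)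
  pure-sub x = subProbability (ι-mono {0} {1} z≤n ∷ []) ℚ.≤-refl

  mix-sub : ∀ {ds : Dist (Dist A)} → All (λ e → 0ℚ ℚ.≤ proj₁ e) ds →
            prob (λ _ → yes tt) ds ℚ.≤ 1ℚ → All (SubProbability ∘ proj₂) ds → SubProbability (mix ds)
  mix-sub {ds} nn m≤1 subs = subProbability (nonNeg-mix nn subs) (ℚ.≤-trans (mass-mix nn subs) m≤1)
    where
    nonNeg-mix : ∀ {ds : Dist (Dist A)} → All (λ e → 0ℚ ℚ.≤ proj₁ e) ds → All (SubProbability ∘ proj₂) ds →
                 All (λ e → 0ℚ ℚ.≤ proj₁ e) (mix ds)
    nonNeg-mix [] [] = []
    nonNeg-mix {(p , _) ∷ _} (0≤p ∷ nn) (s ∷ ss) =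
      All.++⁺ (All.map⁺ (All.map (λ {e} 0≤q → ℚ.nonNegative⁻¹ _
        {{ℚ.nonNeg*nonNeg⇒nonNeg p {{ℚ.nonNegative 0≤p}} (proj₁ e) {{ℚ.nonNegative 0≤q}}}}) (nonNeg s))) (nonNeg-mix nn ss)

    mass-mix : ∀ {ds : Dist (Dist A)} → All (λ e → 0ℚ ℚ.≤ proj₁ e) ds → All (SubProbability ∘ proj₂) ds →
               mass (mix ds) ℚ.≤ prob (λ _ → yes tt) ds
    mass-mix [] [] = ℚ.≤-refl
    mass-mix {(p , d) ∷ ds} (0≤p ∷ nn) (s ∷ ss) = begin
      mass (mix ((p , d) ∷ ds))         ≡⟨ prob-mix-∷ (λ _ → yes tt) p d ds ⟩
      p ℚ.* mass d ℚ.+ mass (mix ds)    ≤⟨ ℚ.+-mono-≤ (ℚ.*-monoˡ-≤-nonNeg p {{ℚ.nonNegative 0≤p}} (mass≤1 s)) (mass-mix nn ss) ⟩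
      p ℚ.* 1ℚ ℚ.+ prob _ ds            ≡⟨ cong (ℚ._+ prob _ ds) (ℚ.*-identityʳ p) ⟩
      p ℚ.+ prob _ ds                   ∎
      where open ℚ.≤-Reasoning

module _ {A B : Set} where

  >>=-sub : ∀ {d : Dist A} {f : A → Dist B} → SubProbability d → (∀ x → SubProbability (f x)) → SubProbability (d >>= f)
  >>=-sub {d} {f} s fs = mix-sub (All.map⁺ (nonNeg s)) (subst (ℚ._≤ 1ℚ) (mass-map d) (mass≤1 s)) (All.map⁺ (All.universal (λ (_ , x) → fs x) d))
    where
    mass-map : ∀ d → mass d ≡ prob (λ _ → yes tt) (map (λ (p , x) → (p , f x)) d)
    mass-map []            = refl
    mass-map ((p , _) ∷ d) = cong (p ℚ.+_) (mass-map d)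

  choose-sub : ∀ xs {d : Dist B} {f : A → Dist B} → SubProbability d → (∀ x → SubProbability (f x)) → SubProbability (choose xs d f)
  choose-sub []           s _  = s
  choose-sub (x ∷ xs) {_} {f} _ fs = mix-sub
    (All.map⁺ (All.universal (λ _ → 1/suc≥0 (length xs)) (x ∷ xs)))
    (ℚ.≤-reflexive (trans (mass-uniform (x ∷ xs)) (1/suc*suc (length xs))))
    (All.map⁺ (All.universal fs (x ∷ xs)))
    where
    w = + 1 / suc (length xs)
    mass-uniform : ∀ ys → prob (λ _ → yes tt) (map (λ y → (w , f y)) ys) ≡ w ℚ.* ι (length ys)
    mass-uniform []       = sym (ℚ.*-zeroʳ w)
    mass-uniform (y ∷ ys) = trans (cong₂ ℚ._+_ (sym (ℚ.*-identityʳ w)) (mass-uniform ys))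
      (trans (sym (ℚ.*-distribˡ-+ w 1ℚ (ι (length ys)))) (cong (w ℚ.*_) (sym (ι-suc (length ys)))))

-- Edge sets as Boolean vectors

∈?-lookup : ∀ {m} (S : Subset m) e → does (e ∈? S) ≡ lookup S e
∈?-lookup S e with e ∈? S
... | yes e∈S = sym ([]=⇒lookup e∈S)
... | no  e∉S with lookup S e in eq
...   | true  = contradiction (lookup⇒[]= e S eq) e∉S
...   | false = refl

∉⇒lookup : ∀ {m} {S : Subset m} {e} → e ∉ₛ S → lookup S e ≡ false
∉⇒lookup {S = S} {e} e∉S = trans (sym (∈?-lookup S e)) (dec-false (e ∈? S) e∉S)

lookup-≡ : ∀ {m} {S : Subset m} {e f} → (e ∈ₛ S → f ∈ₛ S) → (f ∈ₛ S → e ∈ₛ S) → lookup S e ≡ lookup S f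
lookup-≡ {S = S} {e} {f} to from with e ∈? S
... | yes e∈ = trans ([]=⇒lookup e∈) (sym ([]=⇒lookup (to e∈)))
... | no  e∉ = trans (∉⇒lookup e∉) (sym (∉⇒lookup (e∉ ∘ from)))

lookup-≢ : ∀ {m} {S : Subset m} {e f} → e ∈ₛ S → f ∉ₛ S → lookup S e ≢ lookup S f
lookup-≢ e∈ f∉ eq with () ← trans (sym ([]=⇒lookup e∈)) (trans eq (∉⇒lookup f∉))

-- Symmetric difference. Swapping two colors is an involution, so flipping two sets one after the
-- other flips their symmetric difference.
infixl 6 _⊕_
_⊕_ : ∀ {m} → Subset m → Subset m → Subset m
_⊕_ = zipWith _xor_

-- Deficient vertices and flips of two colors

module Coloring (G : Graph) (k : ℕ) where

  open Graph G
  open Chain G k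

  n m : ℕ
  n = ∣V∣
  m = ∣E∣

  ends : ∀ {e v} → Incident e v →
         (src e ≡ v × opposite e v ≡ tgt e) ⊎ (tgt e ≡ v × opposite e v ≡ src e)
  ends {e} {v} inc with src e ≟ v
  ... | yes p = inj₁ (p , refl)
  ... | no ¬p with inc
  ...   | inj₁ p = contradiction p ¬p
  ...   | inj₂ p = inj₂ (p , refl)

  opposite-incident : ∀ {e v} → Incident e v → Incident e (opposite e v)
  opposite-incident inc with ends inc
  ... | inj₁ (_ , eq) = inj₂ (sym eq)
  ... | inj₂ (_ , eq) = inj₁ (sym eq)

  opposite-≢ : ∀ {e v} → Incident e v → opposite e v ≢ v
  opposite-≢ {e} inc eq with ends inc
  ... | inj₁ (p , q) = loopless e (trans p (trans (sym eq) q))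
  ... | inj₂ (p , q) = loopless e (trans (sym q) (trans eq (sym p)))

  incident-cases : ∀ {e v w} → Incident e v → Incident e w → w ≡ v ⊎ w ≡ opposite e v
  incident-cases inc inc′ with ends inc | inc′
  ... | inj₁ (p , _) | inj₁ q = inj₁ (trans (sym q) p)
  ... | inj₁ (_ , p) | inj₂ q = inj₂ (trans (sym q) (sym p))
  ... | inj₂ (_ , p) | inj₁ q = inj₂ (trans (sym q) (sym p))
  ... | inj₂ (p , _) | inj₂ q = inj₁ (trans (sym q) p)

  opposite-involutive : ∀ {e v} → Incident e v → opposite e (opposite e v) ≡ v
  opposite-involutive inc
    with incident-cases (opposite-incident inc) inc
  ... | inj₁ eq = contradiction (sym eq) (opposite-≢ inc)
  ... | inj₂ eq = sym eq

  opposite-injective : ∀ {e f v} → Incident e v → Incident f v → opposite e v ≡ opposite f v → e ≡ f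
  opposite-injective {e} {f} i j eq with ends i | ends j
  ... | inj₁ (p , q) | inj₁ (p′ , q′) = simple e f (inj₁ (trans p (sym p′) , trans (sym q) (trans eq q′)))
  ... | inj₁ (p , q) | inj₂ (p′ , q′) = simple e f (inj₂ (trans p (sym p′) , trans (sym q) (trans eq q′)))
  ... | inj₂ (p , q) | inj₁ (p′ , q′) = simple e f (inj₂ (trans (sym q) (trans eq q′) , trans p (sym p′)))
  ... | inj₂ (p , q) | inj₂ (p′ , q′) = simple e f (inj₁ (trans (sym q) (trans eq q′) , trans p (sym p′)))

  length-allFin : ∀ p → length (allFin p) ≡ p
  length-allFin p = length-tabulate {n = p} id

  -- The graph is simple, so the two edges lead to different neighbours. This is what yields n - 1 ≥
  -- 2 when a flipped pair leaves deficient vertices.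
  degree≥2⇒3≤n : ∀ {e f v} → Incident e v → Incident f v → e ≢ f → 3 ≤ n
  degree≥2⇒3≤n {e} {f} {v} i j e≢f = subst (3 ≤_) (length-allFin n)
    (length-≤-⊆ {xs = v ∷ opposite e v ∷ opposite f v ∷ []}
      (((≢-sym (opposite-≢ i)) ∷ (≢-sym (opposite-≢ j)) ∷ []) ∷ ((e≢f ∘ opposite-injective i j) ∷ []) ∷ [] ∷ [])
      (λ {x} _ → ∈-allFin x))

  module _ {K : EdgeMap} {v : Vertex} {a : Color} where

    ∈-edgesAt⁺ : ∀ {e} → Incident e v → lookup K e ≡ a → e ∈ edgesAt K v a
    ∈-edgesAt⁺ {e} i eq = ∈-filter⁺ (λ e → incident? e v ×-dec (lookup K e ≟ a)) (∈-allFin e) (i , eq)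

    ∈-edgesAt⁻ : ∀ {e} → e ∈ edgesAt K v a → Incident e v × lookup K e ≡ a
    ∈-edgesAt⁻ e∈ = proj₂ (∈-filter⁻ (λ e → incident? e v ×-dec (lookup K e ≟ a)) {xs = allFin m} e∈)

    edgesAt-unique : Unique (edgesAt K v a)
    edgesAt-unique = filter⁺ (λ e → incident? e v ×-dec (lookup K e ≟ a)) (allFin⁺ m)

  ∈-deficientVertices⁺ : ∀ {K v} → Deficient K v → v ∈ deficientVertices K
  ∈-deficientVertices⁺ {K} {v} d = ∈-filter⁺ (deficient? K) (∈-allFin v) d

  ∈-deficientVertices⁻ : ∀ {K v} → v ∈ deficientVertices K → Deficient K v
  ∈-deficientVertices⁻ {K} v∈ = proj₂ (∈-filter⁻ (deficient? K) {xs = allFin n} v∈)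

  deficientVertices-unique : ∀ K → Unique (deficientVertices K)
  deficientVertices-unique K = filter⁺ (deficient? K) (allFin⁺ n)

  -- The part of a deficiency that is easy to carry through flips. For tame maps it already implies
  -- the remaining conditions, see `doubled⇒deficiency`.
  record Doubled (K : EdgeMap) (v : Vertex) : Set where
    constructor doubled
    field
      {e f}     : Edge
      incident₁ : Incident e v
      incident₂ : Incident f v
      different : e ≢ f
      sameColor : lookup K e ≡ lookup K f

  2≤edgesAt⇒doubled : ∀ {K v a} → 2 ≤ length (edgesAt K v a) → ∃[ d ] lookup K (Doubled.e {K} {v} d) ≡ a
  2≤edgesAt⇒doubled {K} {v} {a} 2≤
    with e , f , e∈ , f∈ , e≢f ← 2≤length⇒≢ (edgesAt-unique {K} {v} {a}) 2≤
    with i , p ← ∈-edgesAt⁻ {K} e∈ | j , q ← ∈-edgesAt⁻ {K} f∈ = doubled i j e≢f (trans p (sym q)) , p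

  deficient⇒doubled : ∀ {K v} → Deficient K v → Doubled K v
  deficient⇒doubled {K} (a , _ , two≡ , _) = proj₁ (2≤edgesAt⇒doubled {K} {a = a} (ℕ.≤-reflexive (sym two≡)))

  coloring⇒¬deficient : ∀ {K v} → IsColoring K → ¬ Deficient K v
  coloring⇒¬deficient {K} {v} col d with doubled {e} {f} i j e≢f eq ← deficient⇒doubled {K} d = col e f v e≢f i j eq

  coloring-≡ : ∀ {K} → IsColoring K → ∀ {e f v} → Incident e v → Incident f v → lookup K e ≡ lookup K f → e ≡ f
  coloring-≡ col {e} {f} {v} i j eq with e ≟ f
  ... | yes e≡f = e≡f
  ... | no  e≢f = contradiction eq (col e f v e≢f i j)

  module TwoColors (c c′ : Color) (c≢c′ : c ≢ c′) where

    Selected : Color → Set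
    Selected d = d ≡ c ⊎ d ≡ c′

    selected? : ∀ d → Dec (Selected d)
    selected? d = (d ≟ c) ⊎-dec (d ≟ c′)

    swap-c : swap c c′ c ≡ c′
    swap-c rewrite dec-true (c ≟ c) refl = refl

    swap-c′ : swap c c′ c′ ≡ c
    swap-c′ rewrite dec-false (c′ ≟ c) (c≢c′ ∘ sym) | dec-true (c′ ≟ c′) refl = refl

    swap-unselected : ∀ {d} → ¬ Selected d → swap c c′ d ≡ d
    swap-unselected {d} ¬s rewrite dec-false (d ≟ c) (¬s ∘ inj₁) | dec-false (d ≟ c′) (¬s ∘ inj₂) = refl

    swap-selected : ∀ {d} → Selected d → Selected (swap c c′ d)
    swap-selected (inj₁ refl) = inj₂ swap-c
    swap-selected (inj₂ refl) = inj₁ swap-c′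

    swap-selected⁻ : ∀ {d} → Selected (swap c c′ d) → Selected d
    swap-selected⁻ {d} s with selected? d
    ... | yes s′ = s′
    ... | no ¬s  = subst Selected (swap-unselected ¬s) s

    swap-≢ : ∀ {d} → Selected d → swap c c′ d ≢ d
    swap-≢ (inj₁ refl) eq = c≢c′ (trans (sym eq) swap-c)
    swap-≢ (inj₂ refl) eq = c≢c′ (trans (sym swap-c′) eq)

    selected-≢ : ∀ {d d′} → Selected d → Selected d′ → d ≢ d′ → d′ ≡ swap c c′ d
    selected-≢ (inj₁ refl) (inj₁ refl) p = contradiction refl p
    selected-≢ (inj₁ refl) (inj₂ refl) _ = sym swap-c
    selected-≢ (inj₂ refl) (inj₁ refl) _ = sym swap-c′
    selected-≢ (inj₂ refl) (inj₂ refl) p = contradiction refl p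

    swap-involutive : ∀ d → swap c c′ (swap c c′ d) ≡ d
    swap-involutive d with selected? d
    ... | yes (inj₁ refl) = trans (cong (swap c c′) swap-c) swap-c′
    ... | yes (inj₂ refl) = trans (cong (swap c c′) swap-c′) swap-c
    ... | no ¬s           = trans (cong (swap c c′) (swap-unselected ¬s)) (swap-unselected ¬s)

    lookup-flip : ∀ S K e → lookup (flip c c′ S K) e ≡ (if lookup S e then swap c c′ (lookup K e) else lookup K e)
    lookup-flip S K e = trans (lookup∘tabulate _ e)
      (cong (λ b → if b then swap c c′ (lookup K e) else lookup K e) (∈?-lookup S e))

    lookup-flip-∈ : ∀ {S} K {e} → e ∈ₛ S → lookup (flip c c′ S K) e ≡ swap c c′ (lookup K e)
    lookup-flip-∈ {S} K {e} e∈ = trans (lookup-flip S K e)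
      (cong (λ b → if b then swap c c′ (lookup K e) else lookup K e) ([]=⇒lookup e∈))

    lookup-flip-∉ : ∀ {S} K {e} → e ∉ₛ S → lookup (flip c c′ S K) e ≡ lookup K e
    lookup-flip-∉ {S} K {e} e∉ = trans (lookup-flip S K e)
      (cong (λ b → if b then swap c c′ (lookup K e) else lookup K e) (∉⇒lookup e∉))

    flip-⊕ : ∀ S S′ K → flip c c′ S′ (flip c c′ S K) ≡ flip c c′ (S ⊕ S′) K
    flip-⊕ S S′ K = tabulate-cong λ e → trans
      (cong₂ (λ b d → if b then swap c c′ d else d) (∈?-lookup S′ e) (lookup-flip S K e))
      (trans (xor-swap (lookup S e) (lookup S′ e) (lookup K e))
        (cong (λ b → if b then swap c c′ (lookup K e) else lookup K e)
          (sym (trans (∈?-lookup (S ⊕ S′) e) (lookup-zipWith _xor_ e S S′)))))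
      where
      xor-swap : ∀ s s′ d →
        (if s′ then swap c c′ (if s then swap c c′ d else d) else (if s then swap c c′ d else d))
        ≡ (if s xor s′ then swap c c′ d else d)
      xor-swap true  true  d = swap-involutive d
      xor-swap true  false d = refl
      xor-swap false true  d = refl
      xor-swap false false d = refl

    flip-cancel : ∀ S K {e f} → lookup S e ≡ lookup S f →
                  lookup (flip c c′ S K) e ≡ lookup (flip c c′ S K) f → lookup K e ≡ lookup K f
    flip-cancel S K {e} {f} same eq =
      unflip (lookup S e) (lookup S f) same (trans (sym (lookup-flip S K e)) (trans eq (lookup-flip S K f)))
      where
      unflip : ∀ b b′ → b ≡ b′ → ∀ {d d′} → (if b then swap c c′ d else d) ≡ (if b′ then swap c c′ d′ else d′) → d ≡ d′
      unflip true  _ refl p = trans (sym (swap-involutive _)) (trans (cong (swap c c′) p) (swap-involutive _))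
      unflip false _ refl p = p

    -- Where two edges of colors `c` and `c′` meet, `S` contains both or neither, so that flipping
    -- `S` cannot give them a common color if they had none. With at most one such edge the
    -- condition is empty.
    Even : EdgeMap → EdgeSet → Vertex → Set
    Even K S z = ∀ {h h′} → Incident h z → Incident h′ z → Selected (lookup K h) → Selected (lookup K h′) →
                 lookup S h ≡ lookup S h′

    -- This invariant of flips of c and c′ holds for all colorings, hence for all
    -- the maps K₁ and K₂ that occur along a way with an inverse.
    record Tame (K : EdgeMap) : Set where
      field
        repeated-selected : ∀ {e f v} → Incident e v → Incident f v → e ≢ f →
                            lookup K e ≡ lookup K f → Selected (lookup K e)
        atMostTwo : ∀ {e f g v} → Incident e v → Incident f v → Incident g v →
                    Selected (lookup K e) → Selected (lookup K f) → Selected (lookup K g) →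
                    e ≡ f ⊎ e ≡ g ⊎ f ≡ g
    open Tame

    coloring⇒tame : ∀ {K} → IsColoring K → Tame K
    coloring⇒tame {K} col = record
      { repeated-selected = λ {e} {f} {v} i j e≢f eq → contradiction eq (col e f v e≢f i j)
      ; atMostTwo = λ i j l → pigeon i j l }
      where
      pigeon : ∀ {e f g v} → Incident e v → Incident f v → Incident g v →
               Selected (lookup K e) → Selected (lookup K f) → Selected (lookup K g) →
               e ≡ f ⊎ e ≡ g ⊎ f ≡ g
      pigeon i j l (inj₁ p) (inj₁ q) _        = inj₁ (coloring-≡ {K} col i j (trans p (sym q)))
      pigeon i j l (inj₂ p) (inj₂ q) _        = inj₁ (coloring-≡ {K} col i j (trans p (sym q)))
      pigeon i j l (inj₁ p) (inj₂ q) (inj₁ r) = inj₂ (inj₁ (coloring-≡ {K} col i l (trans p (sym r))))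
      pigeon i j l (inj₁ p) (inj₂ q) (inj₂ r) = inj₂ (inj₂ (coloring-≡ {K} col j l (trans q (sym r))))
      pigeon i j l (inj₂ p) (inj₁ q) (inj₁ r) = inj₂ (inj₂ (coloring-≡ {K} col j l (trans q (sym r))))
      pigeon i j l (inj₂ p) (inj₁ q) (inj₂ r) = inj₂ (inj₁ (coloring-≡ {K} col i l (trans p (sym r))))

    flip-selected⁻ : ∀ S K {e} → Selected (lookup (flip c c′ S K) e) → Selected (lookup K e)
    flip-selected⁻ S K {e} s rewrite lookup-flip S K e with lookup S e
    ... | true  = swap-selected⁻ s
    ... | false = s

    flip-selected⁺ : ∀ S K {e} → Selected (lookup K e) → Selected (lookup (flip c c′ S K) e)
    flip-selected⁺ S K {e} s rewrite lookup-flip S K e with lookup S e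
    ... | true  = swap-selected s
    ... | false = s

    flip-unselected : ∀ S K {e} → ¬ Selected (lookup K e) → lookup (flip c c′ S K) e ≡ lookup K e
    flip-unselected S K {e} ¬s rewrite lookup-flip S K e with lookup S e
    ... | true  = swap-unselected ¬s
    ... | false = refl

    -- The set of edges colored `c` or `c′` does not change, and all other edges keep their colors.
    flip-tame : ∀ S {K} → Tame K → Tame (flip c c′ S K)
    flip-tame S {K} t = record
      { repeated-selected = rep
      ; atMostTwo = λ i j l s s′ s″ → atMostTwo t i j l (flip-selected⁻ S K s) (flip-selected⁻ S K s′) (flip-selected⁻ S K s″) }
      where
      rep : ∀ {e f v} → Incident e v → Incident f v → e ≢ f →
            lookup (flip c c′ S K) e ≡ lookup (flip c c′ S K) f → Selected (lookup (flip c c′ S K) e)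
      rep {e} {f} i j e≢f eq with selected? (lookup K e) | selected? (lookup K f)
      ... | yes s | _     = flip-selected⁺ S K s
      ... | no _  | yes s = subst Selected (sym eq) (flip-selected⁺ S K s)
      ... | no ¬s | no ¬s′ = contradiction
        (repeated-selected t i j e≢f (trans (sym (flip-unselected S K ¬s)) (trans eq (flip-unselected S K ¬s′)))) ¬s

    module _ {K : EdgeMap} (t : Tame K) where

      -- A repeated color is `c` or `c′`, and at most two edges of these colors meet in v: the two
      -- equally colored ones are all of them.
      doubled-exhausts : ∀ {v} (d : Doubled K v) {g} → Incident g v → Selected (lookup K g) →
                         g ≡ Doubled.e d ⊎ g ≡ Doubled.f d
      doubled-exhausts (doubled i j e≢f eq) l s
        with s₁ ← repeated-selected t i j e≢f eq
        with atMostTwo t i j l s₁ (subst Selected eq s₁) s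
      ... | inj₁ p        = contradiction p e≢f
      ... | inj₂ (inj₁ p) = inj₁ (sym p)
      ... | inj₂ (inj₂ p) = inj₂ (sym p)

      edgesAt-≤2 : ∀ {v a} → length (edgesAt K v a) ≤ 2
      edgesAt-≤2 {v} {a} = length-≤2 (edgesAt-unique {K} {v} {a}) λ x∈ y∈ z∈ → coincide (∈-edgesAt⁻ {K} x∈) (∈-edgesAt⁻ {K} y∈) (∈-edgesAt⁻ {K} z∈)
        where
        coincide : ∀ {x y z} → Incident x v × lookup K x ≡ a → Incident y v × lookup K y ≡ a → Incident z v × lookup K z ≡ a →
              x ≡ y ⊎ x ≡ z ⊎ y ≡ z
        coincide {x} {y} (i , p) (j , q) (l , r) with x ≟ y
        ... | yes x≡y = inj₁ x≡y
        ... | no  x≢y with s ← repeated-selected t i j x≢y (trans p (sym q)) =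
          atMostTwo t i j l s (subst Selected (trans p (sym q)) s) (subst Selected (trans p (sym r)) s)

      edgesAt-≤1-other : ∀ {v} (d : Doubled K v) {a} → a ≢ lookup K (Doubled.e d) → length (edgesAt K v a) ≤ 1
      edgesAt-≤1-other {v} d@(doubled {e} {f} i j e≢f eq) {a} a≢ = length-≤1 (edgesAt-unique {K} {v} {a}) one
        where
        one : ∀ {x y} → x ∈ edgesAt K v a → y ∈ edgesAt K v a → x ≡ y
        one {x} {y} x∈ y∈ with x ≟ y | ∈-edgesAt⁻ {K} x∈ | ∈-edgesAt⁻ {K} y∈
        ... | yes x≡y | _ | _ = x≡y
        ... | no  x≢y | l , p | l′ , q with doubled-exhausts d l (repeated-selected t l l′ x≢y (trans p (sym q)))
        ...   | inj₁ refl = contradiction (sym p) a≢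
        ...   | inj₂ refl = contradiction (trans (sym p) (sym eq)) a≢

      -- This is the missing color of the deficiency, and also the reason why an alternating trail
      -- that leaves v cannot return to it.
      doubled-partner-∉ : ∀ {v} (d : Doubled K v) {g} → Incident g v → lookup K g ≢ swap c c′ (lookup K (Doubled.e d))
      doubled-partner-∉ d@(doubled {e} {f} i j e≢f eq) l p
        with s ← repeated-selected t i j e≢f eq
        with doubled-exhausts d l (subst Selected (sym p) (swap-selected s))
      ... | inj₁ refl = swap-≢ s (sym p)
      ... | inj₂ refl = swap-≢ s (trans (sym p) (sym eq))

      doubled⇒deficiency : ∀ {v} (d : Doubled K v) →
        let a = lookup K (Doubled.e d) in Deficiency K v a (swap c c′ a)
      doubled⇒deficiency {v} d@(doubled {e} {f} i j e≢f eq) =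
          ℕ.≤-antisym (edgesAt-≤2 {v}) (≢⇒2≤length (∈-edgesAt⁺ {K} i refl) (∈-edgesAt⁺ {K} j (sym eq)) e≢f)
        , (λ _ a≢ → edgesAt-≤1-other d a≢)
        , none (λ g∈ → doubled-partner-∉ d (proj₁ (∈-edgesAt⁻ {K} g∈)) (proj₂ (∈-edgesAt⁻ {K} g∈)))
        where
        none : ∀ {xs : List Edge} → (∀ {g} → ¬ g ∈ xs) → length xs ≡ 0
        none {[]}    _ = refl
        none {_ ∷ _} ∉ = contradiction (here refl) ∉

      doubled⇒deficient : ∀ {v} → Doubled K v → Deficient K v
      doubled⇒deficient d = _ , _ , doubled⇒deficiency d

      ¬deficient⇒edgesAt-≤1 : ∀ {v a} → ¬ Deficient K v → length (edgesAt K v a) ≤ 1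
      ¬deficient⇒edgesAt-≤1 {v} {a} ¬d with length (edgesAt K v a) ℕ.≤? 1
      ... | yes ≤1 = ≤1
      ... | no ¬≤1 = contradiction (doubled⇒deficient (proj₁ (2≤edgesAt⇒doubled {K} {a = a} (ℕ.≰⇒> ¬≤1)))) ¬d

      -- Allows the results on colorings, such as the bound on the number of two-colored edges, to
      -- be applied to an intermediate map without deficient vertices.
      none⇒coloring : deficientVertices K ≡ [] → IsColoring K
      none⇒coloring eq e f v e≢f i j p
        with () ← subst (v ∈_) eq (∈-deficientVertices⁺ {K} (doubled⇒deficient (doubled i j e≢f p)))

      ∈-doubledEdges⁻ : ∀ {v e} → e ∈ doubledEdges K v →
        ∃[ d ] Doubled.e {K} {v} d ≡ e
      ∈-doubledEdges⁻ {v} {e} e∈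
        with i , two≡ ← proj₂ (∈-filter⁻ (λ e → incident? e v ×-dec (length (edgesAt K v (lookup K e)) ℕ.≟ 2)) {xs = allFin m} e∈)
        with x , y , x∈ , y∈ , x≢y ← 2≤length⇒≢ (edgesAt-unique {K} {v}) (ℕ.≤-reflexive (sym two≡))
        with j , p ← ∈-edgesAt⁻ {K} x∈ | l , q ← ∈-edgesAt⁻ {K} y∈
        -- Of the two edges with the color of `e`, one that differs from `e` becomes its partner.
        with x ≟ e
      ... | yes refl = doubled j l x≢y (sym q) , refl
      ... | no  x≢e  = doubled i j (x≢e ∘ sym) (sym p) , refl

      doubledEdges-≤2 : ∀ {v} → length (doubledEdges K v) ≤ 2
      doubledEdges-≤2 {v} = length-≤2 (filter⁺ _ (allFin⁺ m)) λ x∈ y∈ z∈ → coincide (∈-doubledEdges⁻ x∈) (∈-doubledEdges⁻ y∈) (∈-doubledEdges⁻ z∈)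
        where
        coincide : ∀ {x y z} → (∃[ d ] Doubled.e {K} {v} d ≡ x) → (∃[ d ] Doubled.e {K} {v} d ≡ y) → (∃[ d ] Doubled.e {K} {v} d ≡ z) →
              x ≡ y ⊎ x ≡ z ⊎ y ≡ z
        coincide (doubled i j p eq , refl) (doubled i′ j′ p′ eq′ , refl) (doubled i″ j″ p″ eq″ , refl) =
          atMostTwo t i i′ i″ (repeated-selected t i j p eq) (repeated-selected t i′ j′ p′ eq′) (repeated-selected t i″ j″ p″ eq″)

      deficient⇒doubledEdge : ∀ {v} → Deficient K v → ∃[ e ] e ∈ doubledEdges K v
      deficient⇒doubledEdge {v} def with d@(doubled {e} i j e≢f eq) ← deficient⇒doubled {K} def =
        e , ∈-filter⁺ (λ e → incident? e v ×-dec (length (edgesAt K v (lookup K e)) ℕ.≟ 2)) (∈-allFin e) (i , proj₁ (doubled⇒deficiency d))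

      flip-keeps-doubled : ∀ S {z} → Even K S z → Doubled (flip c c′ S K) z → Doubled K z
      flip-keeps-doubled S ev (doubled i j e≢f eq)
        with s ← repeated-selected (flip-tame S t) i j e≢f eq =
        doubled i j e≢f (flip-cancel S K (ev i j (flip-selected⁻ S K s) (flip-selected⁻ S K (subst Selected eq s))) eq)

      -- No further edge of color `c` or `c′` meets v, so after one of the two is recolored nothing
      -- is left to repeat a color.
      flip-resolves : ∀ {S v} (d : Doubled K v) → Doubled.e d ∈ₛ S → Doubled.f d ∉ₛ S → ¬ Doubled (flip c c′ S K) v
      flip-resolves {S} d e∈ f∉ (doubled {h} {h′} i i′ h≢h′ eq)
        with s ← repeated-selected (flip-tame S t) i i′ h≢h′ eq
        with doubled-exhausts d i (flip-selected⁻ S K s) | doubled-exhausts d i′ (flip-selected⁻ S K (subst Selected eq s))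
      ... | inj₁ refl | inj₁ refl = h≢h′ refl
      ... | inj₂ refl | inj₂ refl = h≢h′ refl
      ... | inj₁ refl | inj₂ refl = swap-≢ (flip-selected⁻ S K s)
        (trans (sym (lookup-flip-∈ K e∈)) (trans eq (trans (lookup-flip-∉ K f∉) (sym (Doubled.sameColor d)))))
      ... | inj₂ refl | inj₁ refl = swap-≢ (flip-selected⁻ S K (subst Selected eq s))
        (trans (sym (lookup-flip-∈ K e∈)) (trans (sym eq) (trans (lookup-flip-∉ K f∉) (sym (Doubled.sameColor d)))))

-- Sub-paths and cycles as walks in an oriented graph

module Alternating (G : Graph) (k : ℕ) (side : Fin (Graph.∣V∣ G) → Bool)
  (bipartite : ∀ e → side (Graph.src G e) ≢ side (Graph.tgt G e))
  where

  open Graph G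
  open Chain G k
  open Coloring G k

  side-opposite : ∀ {e v} → Incident e v → side (opposite e v) ≡ not (side v)
  side-opposite {e} i with ends i
  ... | inj₁ (refl , eq) rewrite eq = Bool.¬-not (bipartite e ∘ sym)
  ... | inj₂ (refl , eq) rewrite eq = Bool.¬-not (bipartite e)

  module Walks (c c′ : Color) (c≢c′ : c ≢ c′) (K : EdgeMap) (coloring : IsColoring K) where

    open TwoColors c c′ c≢c′

    -- Edges of color c are directed from one side to the other and edges of
    -- color c′ back (for σ = true; for σ = false the other way round).
    outColor : Bool → Vertex → Color
    outColor σ v = if σ xor side v then c else c′

    record Arc (σ : Bool) (v : Vertex) (e : Edge) : Set where
      constructor arc
      field
        incident : Incident e v
        color    : lookup K e ≡ outColor σ v
    open Arc

    arc? : ∀ σ v e → Dec (Arc σ v e)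
    arc? σ v e = map′ (λ (i , p) → arc i p) (λ (arc i p) → i , p) (incident? e v ×-dec (lookup K e ≟ outColor σ v))

    outColor-selected : ∀ σ v → Selected (outColor σ v)
    outColor-selected σ v with σ xor side v
    ... | true  = inj₁ refl
    ... | false = inj₂ refl

    outColor-not : ∀ σ v → outColor (not σ) v ≢ outColor σ v
    outColor-not true  v with side v
    ... | true  = c≢c′
    ... | false = c≢c′ ∘ sym
    outColor-not false v with side v
    ... | true  = c≢c′ ∘ sym
    ... | false = c≢c′

    arc-selected : ∀ {σ v e} → Arc σ v e → Selected (lookup K e)
    arc-selected {σ} {v} (arc _ eq) = subst Selected (sym eq) (outColor-selected σ v)

    arc-unique : ∀ {σ v e f} → Arc σ v e → Arc σ v f → e ≡ f
    arc-unique (arc i p) (arc j q) = coloring-≡ {K} coloring i j (trans p (sym q))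

    arc-not : ∀ {σ v e} → Arc σ v e → ¬ Arc (not σ) v e
    arc-not {σ} {v} (arc _ p) (arc _ q) = outColor-not σ v (trans (sym q) p)

    arc-opposite : ∀ {σ v e} → Arc σ v e → Arc (not σ) (opposite e v) e
    arc-opposite {σ} {v} {e} (arc i p) = arc (opposite-incident i) (trans p (cong (if_then c else c′)
      (trans (xor-not σ (side v)) (cong (not σ xor_) (sym (side-opposite i))))))
      where
      xor-not : ∀ s t → s xor t ≡ not s xor not t
      xor-not true  true  = refl
      xor-not true  false = refl
      xor-not false true  = refl
      xor-not false false = refl

    arc-cases : ∀ σ {v e} → Incident e v → Selected (lookup K e) → Arc σ v e ⊎ Arc (not σ) v e
    arc-cases σ {v} {e} i s with lookup K e ≟ outColor σ v
    ... | yes p = inj₁ (arc i p)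
    ... | no ¬p = inj₂ (arc i (trans (selected-≢ (outColor-selected σ v) s (¬p ∘ sym))
                              (sym (selected-≢ (outColor-selected σ v) (outColor-selected (not σ) v) (outColor-not σ v ∘ sym)))))

    arc-source : ∀ {σ v w e} → Arc σ v e → Arc σ w e → w ≡ v
    arc-source a b with incident-cases (incident a) (incident b)
    ... | inj₁ eq   = eq
    ... | inj₂ refl = contradiction (arc-opposite a) (arc-not b)

    H : EdgeSet
    H = twoColored c c′ K

    -- Alternation of the colors is enforced by the orientation. Nothing forbids going round a cycle
    -- repeatedly; start, direction and length determine the edge set all the same.
    data Walk (σ : Bool) : Vertex → ℕ → Vertex → EdgeSet → Set where
      nil  : ∀ {v} → Walk σ v 0 v ∅
      cons : ∀ {v ℓ w S e} → Arc σ v e → Walk σ (opposite e v) ℓ w S → Walk σ v (suc ℓ) w (⁅ e ⁆ ∪ S)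

    snoc : ∀ {σ v ℓ w S e} → Walk σ v ℓ w S → Arc σ w e → Walk σ v (suc ℓ) (opposite e w) (⁅ e ⁆ ∪ S)
    snoc nil a = cons a nil
    snoc {σ} {e = e} (cons {S = S} {e = f} b p) a = subst (Walk σ _ _ _) exchange (cons b (snoc p a))
      where
      exchange : ⁅ f ⁆ ∪ (⁅ e ⁆ ∪ S) ≡ ⁅ e ⁆ ∪ (⁅ f ⁆ ∪ S)
      exchange = trans (sym (∪-assoc ⁅ f ⁆ ⁅ e ⁆ S)) (trans (cong (_∪ S) (∪-comm ⁅ f ⁆ ⁅ e ⁆)) (∪-assoc ⁅ e ⁆ ⁅ f ⁆ S))

    reverse : ∀ {σ v ℓ w S} → Walk σ v ℓ w S → Walk (not σ) w ℓ v S
    reverse nil = nil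
    reverse (cons a p) = subst (λ u → Walk _ _ _ u _) (opposite-involutive (incident a)) (snoc (reverse p) (arc-opposite a))

    -- Reading each sub-path from the proper end fixes the direction, so that the keys (first
    -- vertex, length) give n² and not 2n².
    toTrue : ∀ {σ v ℓ w S} → Walk σ v ℓ w S → ∃[ u ] ∃[ u′ ] Walk true u ℓ u′ S
    toTrue {true}  p = _ , _ , p
    toTrue {false} p = _ , _ , reverse p

    walk-unique : ∀ {σ v ℓ w S w′ S′} → Walk σ v ℓ w S → Walk σ v ℓ w′ S′ → S ≡ S′
    walk-unique nil nil = refl
    walk-unique (cons a p) (cons b q) with refl ← arc-unique a b = cong (⁅ _ ⁆ ∪_) (walk-unique p q)

    Terminal : Bool → Vertex → Set
    Terminal σ w = ∀ {f} → ¬ Arc σ w f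

    maximal-unique : ∀ {σ v ℓ w S ℓ′ w′ S′} → Walk σ v ℓ w S → Terminal σ w →
                     Walk σ v ℓ′ w′ S′ → Terminal σ w′ → ℓ ≡ ℓ′ × S ≡ S′
    maximal-unique nil        _ nil        _  = refl , refl
    maximal-unique nil        t (cons b _) _  = contradiction b t
    maximal-unique (cons a _) _ nil        t′ = contradiction a t′
    maximal-unique (cons a p) t (cons b q) t′ with refl ← arc-unique a b
      with eq , eq′ ← maximal-unique p t q t′ = cong suc eq , cong (⁅ _ ⁆ ∪_) eq′

    firstArc : ∀ {σ v ℓ w S} → Walk σ v (suc ℓ) w S → ∃[ e ] Arc σ v e × e ∈ₛ S
    firstArc (cons {e = e} a _) = e , a , x∈p∪q⁺ (inj₁ (x∈⁅x⁆ e))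

    walk-selected : ∀ {σ v ℓ w S h} → Walk σ v ℓ w S → h ∈ₛ S → Selected (lookup K h)
    walk-selected nil h∈ = contradiction h∈ ∉⊥
    walk-selected (cons {S = S} {e = e} a p) h∈ with x∈p∪q⁻ ⁅ e ⁆ S h∈
    ... | inj₁ h∈e with refl ← x∈⁅y⁆⇒x≡y e h∈e = arc-selected a
    ... | inj₂ h∈S = walk-selected p h∈S

    -- A walk that leaves z has entered z before, unless z is its start.
    arcBefore : ∀ {σ v ℓ w S z h} → Walk σ v ℓ w S → Arc σ z h → h ∈ₛ S → z ≢ v → ∃[ f ] Arc (not σ) z f × f ∈ₛ S
    arcBefore nil _ h∈ _ = contradiction h∈ ∉⊥
    arcBefore {v = v} {z = z} (cons {S = S} {e = e} a p) b h∈ z≢v with x∈p∪q⁻ ⁅ e ⁆ S h∈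
    ... | inj₁ h∈e with refl ← x∈⁅y⁆⇒x≡y e h∈e = contradiction (arc-source a b) z≢v
    ... | inj₂ h∈S with z ≟ opposite e v
    ...   | yes refl = e , arc-opposite a , x∈p∪q⁺ (inj₁ (x∈⁅x⁆ e))
    ...   | no z≢ with f , b′ , f∈ ← arcBefore p b h∈S z≢ = f , b′ , x∈p∪q⁺ (inj₂ f∈)

    -- Cuts the walk just after it has entered z. That the rest is strictly shorter is used to show
    -- that a maximal walk never comes back to its start.
    remainder : ∀ {σ v ℓ w S z h} → Walk σ v ℓ w S → Arc (not σ) z h → h ∈ₛ S →
                ∃[ ℓ′ ] ∃[ S′ ] ℓ′ < ℓ × Walk σ z ℓ′ w S′ × (∀ {f} → f ∈ₛ S′ → f ∈ₛ S)
    remainder nil _ h∈ = contradiction h∈ ∉⊥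
    remainder {σ} {v} {z = z} (cons {ℓ = ℓ} {S = S} {e = e} a p) b h∈ with x∈p∪q⁻ ⁅ e ⁆ S h∈
    ... | inj₂ h∈S with ℓ′ , S′ , lt , q , sub ← remainder p b h∈S =
      ℓ′ , S′ , ℕ.m≤n⇒m≤1+n lt , q , λ f∈ → x∈p∪q⁺ (inj₂ (sub f∈))
    ... | inj₁ h∈e with refl ← x∈⁅y⁆⇒x≡y e h∈e
                   with refl ← arc-source (arc-opposite a) b = ℓ , S , ℕ.≤-refl , p , λ f∈ → x∈p∪q⁺ (inj₂ f∈)

    arcAfter : ∀ {σ v ℓ w S z h} → Walk σ v ℓ w S → Arc (not σ) z h → h ∈ₛ S → z ≢ w → ∃[ f ] Arc σ z f × f ∈ₛ S
    arcAfter p b h∈ z≢w with remainder p b h∈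
    ... | _ , _ , _ , nil        , _   = contradiction refl z≢w
    ... | _ , _ , _ , cons {e = e} a _ , sub = e , a , sub (x∈p∪q⁺ (inj₁ (x∈⁅x⁆ e)))

    -- At most one arc leaves z and at most one enters it; away from its ends the walk uses one
    -- exactly if it uses the other.
    walk-even : ∀ {σ v ℓ w S z} → Walk σ v ℓ w S → z ≢ v → z ≢ w → Even K S z
    walk-even {σ} {S = S} {z} p z≢v z≢w {h} {h′} i i′ s s′ = cases (arc-cases σ i s) (arc-cases σ i′ s′)
      where
      passes : ∀ {g g′} → Arc σ z g → Arc (not σ) z g′ → lookup S g ≡ lookup S g′
      passes a b = lookup-≡
        (λ g∈ → let f , b′ , f∈ = arcBefore p a g∈ z≢v in subst (_∈ₛ S) (arc-unique b′ b) f∈)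
        (λ g′∈ → let f , a′ , f∈ = arcAfter p b g′∈ z≢w in subst (_∈ₛ S) (arc-unique a′ a) f∈)
      cases : Arc σ z h ⊎ Arc (not σ) z h → Arc σ z h′ ⊎ Arc (not σ) z h′ → lookup S h ≡ lookup S h′
      cases (inj₁ a) (inj₁ b) = cong (lookup S) (arc-unique a b)
      cases (inj₂ a) (inj₂ b) = cong (lookup S) (arc-unique a b)
      cases (inj₁ a) (inj₂ b) = passes a b
      cases (inj₂ a) (inj₁ b) = sym (passes b a)

    ∈H⁻ : ∀ {e} → e ∈ₛ H → Selected (lookup K e)
    ∈H⁻ {e} e∈ with lookup K e ≟ c | lookup K e ≟ c′ | trans (sym (lookup∘tabulate _ e)) ([]=⇒lookup e∈)
    ... | yes p | _     | _ = inj₁ p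
    ... | no _  | yes p | _ = inj₂ p
    ... | no _  | no _  | ()

    ∈H⁺ : ∀ {e} → Selected (lookup K e) → e ∈ₛ H
    ∈H⁺ {e} s = lookup⇒[]= e H (trans (lookup∘tabulate _ e) (or s))
      where
      or : Selected (lookup K e) → does (lookup K e ≟ c) ∨ does (lookup K e ≟ c′) ≡ true
      or (inj₁ p) rewrite dec-true (lookup K e ≟ c) p = refl
      or (inj₂ p) rewrite dec-true (lookup K e ≟ c′) p = Bool.∨-zeroʳ _

    pathsFrom-suc⁻ : ∀ {ℓ seen v w S} → (w , S) ∈ pathsFrom H (suc ℓ) seen v →
      ∃[ e ] ∃[ S′ ] (e ∈ₛ H × Incident e v × ¬ (opposite e v ∈ₛ seen ∪ ⁅ v ⁆)) ×
        (w , S′) ∈ pathsFrom H ℓ (seen ∪ ⁅ v ⁆) (opposite e v) × S ≡ ⁅ e ⁆ ∪ S′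
    pathsFrom-suc⁻ {ℓ} {seen} {v} p∈
      with e , e∈ , p∈′ ← find (∈-concatMap⁻
        (λ e → map (λ (w , S) → (w , ⁅ e ⁆ ∪ S)) (pathsFrom H ℓ (seen ∪ ⁅ v ⁆) (opposite e v))) p∈)
      with (w , S′) , q∈ , refl ← ∈-map⁻ (λ (w , S) → (w , ⁅ e ⁆ ∪ S)) p∈′ =
      e , S′ , proj₂ (∈-filter⁻ (λ e → (e ∈? H) ×-dec incident? e v ×-dec ¬? (opposite e v ∈? seen ∪ ⁅ v ⁆)) {xs = allFin m} e∈) , q∈ , refl

    pathsFrom-end : ∀ ℓ {seen v w S} → v ∉ₛ seen → (w , S) ∈ pathsFrom H ℓ seen v → w ∉ₛ seen
    pathsFrom-end zero    v∉ (here refl) = v∉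
    pathsFrom-end (suc ℓ) v∉ p∈ with e , S′ , (_ , _ , new) , q∈ , _ ← pathsFrom-suc⁻ {ℓ} p∈ =
      λ w∈ → pathsFrom-end ℓ new q∈ (x∈p∪q⁺ (inj₁ w∈))

    -- A path keeps its direction: the only arc at v against the direction is the edge `e₀` by which
    -- v was reached, and that one leads back to a vertex already seen.
    pathsFrom⇒walk : ∀ ℓ {σ seen v w S e₀} → Arc (not σ) v e₀ → opposite e₀ v ∈ₛ seen →
                     (w , S) ∈ pathsFrom H ℓ seen v → Walk σ v ℓ w S
    pathsFrom⇒walk zero    _ _ (here refl) = nil
    pathsFrom⇒walk (suc ℓ) {σ} {seen} {v} a₀ ∈seen p∈
      with e , S′ , (e∈ , i , new) , q∈ , refl ← pathsFrom-suc⁻ {ℓ} p∈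
      with arc-cases σ i (∈H⁻ e∈)
    ... | inj₂ a with refl ← arc-unique a₀ a = contradiction (x∈p∪q⁺ (inj₁ ∈seen)) new
    ... | inj₁ a = cons a (pathsFrom⇒walk ℓ (arc-opposite a)
      (x∈p∪q⁺ {p = seen} (inj₂ (subst (_∈ₛ ⁅ v ⁆) (sym (opposite-involutive i)) (x∈⁅x⁆ v)))) q∈)

    pathsOfLength : Vertex → ℕ → List (Vertex × Vertex × EdgeSet)
    pathsOfLength v ℓ = map (v ,_) (pathsFrom H (suc ℓ) ∅ v)

    orientedPaths⁻ : ∀ {u w S} → (u , w , S) ∈ orientedPaths H →
                     ∃[ σ ] ∃[ ℓ ] ℓ ∈ upTo n × Walk σ u (suc ℓ) w S × u ≢ w
    orientedPaths⁻ {u} {w} {S} p∈ =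
      let v , _ , p∈₁ = find (∈-concatMap⁻ (λ v → concatMap (pathsOfLength v) (upTo n)) {xs = allFin n} p∈)
          ℓ , ℓ∈ , p∈₂ = find (∈-concatMap⁻ (pathsOfLength v) {xs = upTo n} p∈₁)
      in started ℓ∈ (∈-map⁻ (v ,_) p∈₂)
      where
      Result : Set
      Result = ∃[ σ ] ∃[ ℓ ] ℓ ∈ upTo n × Walk σ u (suc ℓ) w S × u ≢ w

      directed : ∀ {σ ℓ e S′} → ℓ ∈ upTo n → Arc σ u e → ¬ (opposite e u ∈ₛ ∅ ∪ ⁅ u ⁆) →
                 (w , S′) ∈ pathsFrom H ℓ (∅ ∪ ⁅ u ⁆) (opposite e u) → S ≡ ⁅ e ⁆ ∪ S′ → Result
      directed {σ} {ℓ} ℓ∈ a new q∈ refl = σ , ℓ , ℓ∈ ,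
        cons a (pathsFrom⇒walk ℓ (arc-opposite a)
          (x∈p∪q⁺ {p = ∅} (inj₂ (subst (_∈ₛ ⁅ u ⁆) (sym (opposite-involutive (incident a))) (x∈⁅x⁆ u)))) q∈) ,
        -- The path avoids all vertices seen before, and u was the first of them.
        λ { refl → pathsFrom-end ℓ new q∈ (x∈p∪q⁺ {p = ∅} (inj₂ (x∈⁅x⁆ u))) }

      started : ∀ {v ℓ} → ℓ ∈ upTo n → (∃[ p ] p ∈ pathsFrom H (suc ℓ) ∅ v × (u , w , S) ≡ (v , p)) → Result
      started {ℓ = ℓ} ℓ∈ (_ , p∈ , refl) =
        let e , S′ , (e∈ , i , new) , q∈ , S≡ = pathsFrom-suc⁻ {ℓ} p∈ in
        [ (λ a → directed ℓ∈ a new q∈ S≡) , (λ a → directed ℓ∈ a new q∈ S≡) ]′ (arc-cases true i (∈H⁻ e∈))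

    edgeSet : Vertex × Vertex × EdgeSet → EdgeSet
    edgeSet (_ , _ , S) = S

    subPaths⁻ : ∀ {S} → S ∈ subPaths H →
                ∃[ σ ] ∃[ u ] ∃[ w ] ∃[ ℓ ] ℓ ∈ upTo n × Walk σ u (suc ℓ) w S
    subPaths⁻ {S} S∈ = fromPath (∈-map⁻ edgeSet (∈-deduplicate⁻ _ (map edgeSet (orientedPaths H)) S∈))
      where
      fromPath : (∃[ p ] p ∈ orientedPaths H × S ≡ edgeSet p) → ∃[ σ ] ∃[ u ] ∃[ w ] ∃[ ℓ ] ℓ ∈ upTo n × Walk σ u (suc ℓ) w S
      fromPath ((u , w , S) , p∈ , refl) = let σ , ℓ , ℓ∈ , p , _ = orientedPaths⁻ p∈ in σ , u , w , ℓ , ℓ∈ , p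

    ClosingEdge : Vertex × Vertex × EdgeSet → Edge → Set
    ClosingEdge (u , v , S) e = e ∈ₛ H × e ∉ₛ S × Incident e u × Incident e v

    closingEdge? : ∀ p e → Dec (ClosingEdge p e)
    closingEdge? (u , v , S) e = (e ∈? H) ×-dec ¬? (e ∈? S) ×-dec incident? e u ×-dec incident? e v

    closures : Vertex × Vertex × EdgeSet → List EdgeSet
    closures p = map (λ e → ⁅ e ⁆ ∪ edgeSet p) (filter (closingEdge? p) (allFin m))

    -- The closing edge cannot leave u, since the arc leaving u is the first of the path. Hence it
    -- enters u and continues the walk from v back to u.
    close : ∀ {σ u v ℓ S e} → Walk σ u (suc ℓ) v S → u ≢ v → ClosingEdge (u , v , S) e → Walk σ u (suc (suc ℓ)) u (⁅ e ⁆ ∪ S)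
    close {σ} {e = e} p u≢v (e∈H , e∉S , i , j) with incident-cases j i | arc-cases σ i (∈H⁻ e∈H)
    ... | inj₁ u≡v  | _      = contradiction u≡v u≢v
    ... | inj₂ _    | inj₁ a with f , b , f∈ ← firstArc p with refl ← arc-unique a b = contradiction f∈ e∉S
    ... | inj₂ refl | inj₂ a = snoc p
      (subst₂ (λ τ y → Arc τ y e) (Bool.not-involutive σ) (opposite-involutive j) (arc-opposite a))

    cycles⁻ : ∀ {S} → S ∈ cycles H →
              ∃[ σ ] ∃[ u ] ∃[ ℓ ] ℓ ∈ upTo n × Walk σ u (suc (suc ℓ)) u S
    cycles⁻ {S} S∈ = fromPath (find (∈-concatMap⁻ closures {xs = orientedPaths H} (∈-deduplicate⁻ _ (concatMap closures (orientedPaths H)) S∈)))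
      where
      Result : Set
      Result = ∃[ σ ] ∃[ u ] ∃[ ℓ ] ℓ ∈ upTo n × Walk σ u (suc (suc ℓ)) u S

      closed : ∀ {p} → p ∈ orientedPaths H → (∃[ e ] e ∈ filter (closingEdge? p) (allFin m) × S ≡ ⁅ e ⁆ ∪ edgeSet p) → Result
      closed {u , v , T} p∈ (e , e∈ , refl) =
        let σ , ℓ , ℓ∈ , p , u≢v = orientedPaths⁻ p∈ in
        σ , u , ℓ , ℓ∈ , close p u≢v (proj₂ (∈-filter⁻ (closingEdge? (u , v , T)) {xs = allFin m} e∈))

      fromPath : (∃[ p ] p ∈ orientedPaths H × S ∈ closures p) → Result
      fromPath (p , p∈ , S∈) = closed p∈ (∈-map⁻ (λ e → ⁅ e ⁆ ∪ edgeSet p) S∈)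

    private
      keys : List (Vertex × ℕ)
      keys = cartesianProduct (allFin n) (upTo n)

      length-keys : length keys ≡ n * n
      length-keys = trans (length-cartesianProduct (allFin n) (upTo n)) (cong₂ _*_ (length-allFin n) (length-upTo n))

    subPaths-unique : Unique (subPaths H)
    subPaths-unique = deduplicate-! (≡-dec Bool._≟_) (map edgeSet (orientedPaths H))

    length-subPaths : length (subPaths H) ≤ n * n
    length-subPaths = ℕ.≤-trans (length-≤-via {R = λ S (v , ℓ) → ∃[ w ] Walk true v (suc ℓ) w S}
      subPaths-unique
      (λ S∈ → let _ , _ , _ , ℓ , ℓ∈ , p = subPaths⁻ S∈ ; u , w , q = toTrue p in
         (u , ℓ) , ∈-cartesianProduct⁺ (∈-allFin u) ℓ∈ , w , q)
      (λ _ _ (_ , p) (_ , q) → walk-unique p q)) (ℕ.≤-reflexive length-keys)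

    length-cycles : length (cycles H) ≤ n * n
    length-cycles = ℕ.≤-trans (length-≤-via {R = λ S (v , ℓ) → ∃[ w ] Walk true v (suc (suc ℓ)) w S}
      (deduplicate-! (≡-dec Bool._≟_) (concatMap closures (orientedPaths H)))
      (λ S∈ → let _ , _ , ℓ , ℓ∈ , p = cycles⁻ S∈ ; u , w , q = toTrue p in
         (u , ℓ) , ∈-cartesianProduct⁺ (∈-allFin u) ℓ∈ , w , q)
      (λ _ _ (_ , p) (_ , q) → walk-unique p q)) (ℕ.≤-reflexive length-keys)

    -- The key of an edge is the vertex that it leaves in direction `true`; no other arc leaves that
    -- vertex.
    length-twoColored : length (filter (_∈? H) (allFin m)) ≤ n
    length-twoColored = ℕ.≤-trans (length-≤-via {R = λ e v → Arc true v e}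
      (filter⁺ (_∈? H) (allFin⁺ m))
      (λ {e} e∈ → source (proj₂ (∈-filter⁻ (_∈? H) {xs = allFin m} e∈)))
      (λ _ _ → arc-unique)) (ℕ.≤-reflexive (length-allFin n))
      where
      source : ∀ {e} → e ∈ₛ H → ∃[ v ] v ∈ allFin n × Arc true v e
      source {e} e∈ with arc-cases true (inj₁ refl) (∈H⁻ e∈)
      ... | inj₁ a = _ , ∈-allFin _ , a
      ... | inj₂ a = _ , ∈-allFin _ , arc-opposite a

    End⁻ : ∀ {S v} → End S v → ∃[ e ] e ∈ₛ S × Incident e v × (∀ {f} → f ∈ₛ S → Incident f v → f ≡ e)
    End⁻ {S} {v} one
      with e , e∈ ← 0<length⇒∈ (ℕ.≤-reflexive (sym one))
      with _ , e∈S , i ← ∈-filter⁻ (λ e → (e ∈? S) ×-dec incident? e v) {xs = allFin m} e∈ =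
      e , e∈S , i , λ {f} f∈ j → length-≤1⇒≡ (ℕ.≤-reflexive one)
        (∈-filter⁺ (λ e → (e ∈? S) ×-dec incident? e v) (∈-allFin f) (f∈ , j)) e∈

    End⁺ : ∀ {S v e} → e ∈ₛ S → Incident e v → (∀ {f} → f ∈ₛ S → Incident f v → f ≡ e) → End S v
    End⁺ {S} {v} {e} e∈ i unique = ℕ.≤-antisym
      (length-≤1 (filter⁺ inS? (allFin⁺ m)) λ x∈ y∈ → trans (only x∈) (sym (only y∈)))
      (∈⇒0<length (∈-filter⁺ inS? (∈-allFin e) (e∈ , i)))
      where
      inS? = λ e → (e ∈? S) ×-dec incident? e v
      only : ∀ {x} → x ∈ filter inS? (allFin m) → x ≡ e
      only x∈ with _ , x∈S , j ← ∈-filter⁻ inS? {xs = allFin m} x∈ = unique x∈S j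

    -- A sub-path with the inner end x that reaches the end of its component in direction σ.
    record Tail (σ : Bool) (x : Vertex) (S : EdgeSet) : Set where
      field
        {size}   : ℕ
        {last}   : Vertex
        walk     : Walk σ x size last S
        terminal : Terminal σ last
        outArc   : ∃[ e ] Arc σ x e × e ∈ₛ S
        inArc    : ∃[ f ] Arc (not σ) x f × f ∉ₛ S
        even     : ∀ {z} → z ≢ x → Even K S z

    tail-unique : ∀ {σ x S S′} → Tail σ x S → Tail σ x S′ → S ≡ S′
    tail-unique t t′ = proj₂ (maximal-unique (Tail.walk t) (Tail.terminal t) (Tail.walk t′) (Tail.terminal t′))

    -- Directed towards its outer end, the sub-path runs up to the end of the component, and so it
    -- is the maximal walk from its inner end.
    oneOuterEnd⇒tail : ∀ {S} → S ∈ subPaths H → OneOuterEnd H S → ∃[ σ ] ∃[ x ] Tail σ x S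
    oneOuterEnd⇒tail {S} S∈ one = fromPath (subPaths⁻ S∈)
      where
      outer? = λ v → end? S v ×-dec end? H v

      outer-unique : ∀ {y z} → End S y → End H y → End S z → End H z → y ≡ z
      outer-unique a b a′ b′ = length-≤1⇒≡ (ℕ.≤-reflexive one)
        (∈-filter⁺ outer? (∈-allFin _) (a , b)) (∈-filter⁺ outer? (∈-allFin _) (a′ , b′))

      tail : ∀ {σ u ℓ w} → Walk σ u (suc ℓ) w S → End S w → End H w → Tail σ u S
      tail {σ} {u} {ℓ} {w} p endS endH = record
        { walk = p ; terminal = term ; outArc = firstArc p ; inArc = inArc ; even = λ z≢u → even z≢u }
        where
        -- As an end vertex in H, w has one edge only, and the walk has arrived by it.
        term : Terminal σ w
        term a with _ , _ , _ , uniq ← End⁻ {H} endH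
               with g , b , _ ← firstArc (reverse p)
               with refl ← trans (uniq (∈H⁺ (arc-selected a)) (incident a)) (sym (uniq (∈H⁺ (arc-selected b)) (incident b)))
               = arc-not a b

        -- If an arc entering u belonged to `S`, the walk would return to u, and the rest of it
        -- would be a shorter maximal walk from u. If no arc entered u at all, then u would be a
        -- second outer end.
        inArc : ∃[ f ] Arc (not σ) u f × f ∉ₛ S
        inArc with any? (arc? (not σ) u)
        ... | yes (f , a) = f , a , λ f∈ →
          let _ , _ , lt , q , _ = remainder p a f∈ in
          ℕ.<⇒≢ lt (proj₁ (maximal-unique q term p term))
        ... | no ¬a with e , a , e∈ ← firstArc p = ⊥-elim (term (subst (λ y → Arc σ y e)
            (outer-unique (End⁺ e∈ (incident a) λ f∈ j → only j (walk-selected p f∈))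
                          (End⁺ (∈H⁺ (arc-selected a)) (incident a) λ f∈ j → only j (∈H⁻ f∈)) endS endH) a))
          where
          only : ∀ {f} → Incident f u → Selected (lookup K f) → f ≡ e
          only {f} j s with arc-cases σ j s
          ... | inj₁ b = arc-unique b a
          ... | inj₂ b = contradiction (f , b) ¬a

        even : ∀ {z} → z ≢ u → Even K S z
        even {z} z≢u {h} {h′} i i′ s s′ with z ≟ w
        ... | no z≢w = walk-even p z≢u z≢w i i′ s s′
        ... | yes refl with arc-cases σ i s | arc-cases σ i′ s′
        ...   | inj₁ a | _      = contradiction a term
        ...   | inj₂ _ | inj₁ a = contradiction a term
        ...   | inj₂ a | inj₂ b = cong (lookup S) (arc-unique a b)

      fromPath : (∃[ σ ] ∃[ u ] ∃[ w ] ∃[ ℓ ] ℓ ∈ upTo n × Walk σ u (suc ℓ) w S) → ∃[ σ ] ∃[ x ] Tail σ x S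
      fromPath (σ , u , w , ℓ , _ , p)
        with v , v∈ ← 0<length⇒∈ (ℕ.≤-reflexive (sym one))
        with _ , endS , endH ← ∈-filter⁻ outer? {xs = allFin n} v∈
        with v ≟ u | v ≟ w
      ... | yes refl | _        = not σ , w , tail (reverse p) endS endH
      ... | no _     | yes refl = σ , u , tail p endS endH
      -- Inside the walk v has both an entering and a leaving arc in `S`, so it is no end of `S`.
      ... | no v≢u   | no v≢w
        with e , e∈ , i , uniq ← End⁻ {S} endS
        with arc-cases σ i (walk-selected p e∈)
      ...   | inj₁ a with f , b , f∈ ← arcBefore p a e∈ v≢u with refl ← uniq f∈ (incident b) = contradiction b (arc-not a)
      ...   | inj₂ a with f , b , f∈ ← arcAfter p a e∈ v≢w with refl ← uniq f∈ (incident b) = contradiction a (arc-not b)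

    -- The key is the inner end together with the direction, whence the factor 2.
    length-oneOuterEnd : length (filter (oneOuterEnd? H) (subPaths H)) ≤ 2 * n
    length-oneOuterEnd = ℕ.≤-trans (length-≤-via {R = λ S (σ , x) → Tail σ x S} (filter⁺ (oneOuterEnd? H) subPaths-unique)
        (λ S∈ → let S∈′ , one = ∈-filter⁻ (oneOuterEnd? H) S∈ ; σ , x , t = oneOuterEnd⇒tail S∈′ one in
           (σ , x) , ∈-cartesianProduct⁺ (∈-Bool σ) (∈-allFin x) , t)
        (λ _ _ → tail-unique))
      (ℕ.≤-reflexive (trans (length-cartesianProduct (true ∷ false ∷ []) (allFin n)) (cong (2 *_) (length-allFin n))))
      where
      ∈-Bool : ∀ b → b ∈ true ∷ false ∷ []
      ∈-Bool true  = here refl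
      ∈-Bool false = there (here refl)

-- Deficient vertices after φ₁⁻¹

module Flipping (G : Graph) (k : ℕ) (side : Fin (Graph.∣V∣ G) → Bool)
  (bipartite : ∀ e → side (Graph.src G e) ≢ side (Graph.tgt G e)) (c c′ : Fin k) (c≢c′ : c ≢ c′)
  (C : Chain.EdgeMap G k) (coloring : Chain.IsColoring G k C)
  where

  open Graph G
  open Chain G k
  open Coloring G k
  open Alternating G k side bipartite
  open TwoColors c c′ c≢c′
  open Walks c c′ c≢c′ C coloring

  ⊕-even : ∀ {S S′ z} → Even C S z → Even C S′ z → Even C (S ⊕ S′) z
  ⊕-even {S} {S′} ev ev′ {h} {h′} i i′ s s′ = trans (lookup-zipWith _xor_ h S S′)
    (trans (cong₂ _xor_ (ev i i′ s s′) (ev′ i i′ s s′)) (sym (lookup-zipWith _xor_ h′ S S′)))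

  even⇒¬deficient : ∀ {D z} → Even C D z → ¬ Deficient (flip c c′ D C) z
  even⇒¬deficient {D} {z} ev def =
    undoubled (flip-keeps-doubled (coloring⇒tame {C} coloring) D ev (deficient⇒doubled {flip c c′ D C} def))
    where
    undoubled : ¬ Doubled C z
    undoubled (doubled {e} {f} i j e≢f eq) = coloring e f z e≢f i j eq

  -- The two edges had the colors `c` and `c′`; swapping the color of exactly one of them makes them
  -- equal.
  odd⇒deficient : ∀ {D z h h′} → Incident h z → Incident h′ z → Selected (lookup C h) → Selected (lookup C h′) →
                  lookup D h ≢ lookup D h′ → Deficient (flip c c′ D C) z
  odd⇒deficient {D} {z} {h} {h′} i i′ s s′ odd =
    doubled⇒deficient (flip-tame D (coloring⇒tame {C} coloring)) (doubled i i′ h≢h′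
      (trans (lookup-flip D C h) (trans (unequal (lookup D h) (lookup D h′) odd) (sym (lookup-flip D C h′)))))
    where
    h≢h′ : h ≢ h′
    h≢h′ = odd ∘ cong (lookup D)
    h′-color : lookup C h′ ≡ swap c c′ (lookup C h)
    h′-color = selected-≢ s s′ (coloring h h′ z h≢h′ i i′)
    unequal : ∀ b b′ → b ≢ b′ →
      (if b then swap c c′ (lookup C h) else lookup C h) ≡ (if b′ then swap c c′ (lookup C h′) else lookup C h′)
    unequal true  true  ≢ = contradiction refl ≢
    unequal true  false _ = sym h′-color
    unequal false true  _ = trans (sym (swap-involutive _)) (cong (swap c c′) (sym h′-color))
    unequal false false ≢ = contradiction refl ≢

  evenExcept⇒deficient-≤2 : ∀ {D} x y → (∀ {z} → z ≢ x → z ≢ y → Even C D z) →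
                            length (deficientVertices (flip c c′ D C)) ≤ 2
  evenExcept⇒deficient-≤2 {D} x y ev = length-≤-⊆ {ys = x ∷ y ∷ []} (deficientVertices-unique (flip c c′ D C)) among
    where
    among : ∀ {z} → z ∈ deficientVertices (flip c c′ D C) → z ∈ x ∷ y ∷ []
    among {z} z∈ with z ≟ x | z ≟ y
    ... | yes refl | _        = here refl
    ... | no _     | yes refl = there (here refl)
    ... | no z≢x   | no z≢y   = contradiction (∈-deficientVertices⁻ {flip c c′ D C} z∈) (even⇒¬deficient {D} (ev z≢x z≢y))

  nowhere⇒[] : ∀ {K} → (∀ z → ¬ Deficient K z) → deficientVertices K ≡ []
  nowhere⇒[] {K} none = filter-none (deficient? K) (All.universal none (allFin n))

  coloring⇒[] : deficientVertices C ≡ []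
  coloring⇒[] = nowhere⇒[] {C} (λ _ → coloring⇒¬deficient {C} coloring)

  -- If the inner ends coincide, then the two paths make up a whole component;
  -- otherwise both inner ends become deficient.
  twoTails-deficient : ∀ {σ τ x y S S′} → Tail σ x S → Tail τ y S′ → S ≢ S′ →
    let K = flip c c′ (S ⊕ S′) C in
    deficientVertices K ≡ [] ⊎ (2 ≤ length (deficientVertices K) × 3 ≤ n)
  twoTails-deficient {σ} {τ} {x} {y} {S} {S′} t t′ S≢S′ = cases (x ≟ y)
    where
    D : EdgeSet
    D = S ⊕ S′

    lookup-D : ∀ e → lookup D e ≡ lookup S e xor lookup S′ e
    lookup-D e = lookup-zipWith _xor_ e S S′

    xor-cancelʳ : ∀ p q r → p xor r ≡ q xor r → p ≡ q
    xor-cancelʳ true  true  _     _ = refl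
    xor-cancelʳ false false _     _ = refl
    xor-cancelʳ true  false true  ()
    xor-cancelʳ true  false false ()
    xor-cancelʳ false true  true  ()
    xor-cancelʳ false true  false ()

    -- Of the two arcs at z, `T` contains just one and `T′` both or neither, so their symmetric
    -- difference contains just one.
    deficientAt : ∀ {ρ z T T′} → Tail ρ z T → Even C T′ z → (∀ e → lookup D e ≡ lookup T e xor lookup T′ e) →
                  Deficient (flip c c′ D C) z
    deficientAt {ρ} {z} {T} {T′} t ev D≡ = odd⇒deficient {D} {z} {e} {f} (Arc.incident a) (Arc.incident b) (arc-selected a) (arc-selected b) odd
      where
      e = proj₁ (Tail.outArc t)
      a = proj₁ (proj₂ (Tail.outArc t))
      f = proj₁ (Tail.inArc t)
      b = proj₁ (proj₂ (Tail.inArc t))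
      odd : lookup D e ≢ lookup D f
      odd eq = lookup-≢ {S = T} (proj₂ (proj₂ (Tail.outArc t))) (proj₂ (proj₂ (Tail.inArc t)))
        (xor-cancelʳ (lookup T e) (lookup T f) (lookup T′ f)
          (trans (cong (lookup T e xor_) (sym (ev (Arc.incident a) (Arc.incident b) (arc-selected a) (arc-selected b))))
            (trans (sym (D≡ e)) (trans eq (D≡ f)))))

    -- The two tails leave x in opposite directions: each contains the arc that the other one lacks.
    bothArcs : Tail (not σ) x S′ → ∀ {g} → Incident g x → Selected (lookup C g) → lookup D g ≡ true
    bothArcs t′ {g} i s
      with e , a , e∈ ← Tail.outArc t | f , b , f∉ ← Tail.inArc t
         | e′ , a′ , e′∈ ← Tail.outArc t′ | f′ , b′ , f′∉ ← Tail.inArc t′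
         | arc-cases σ i s
    ... | inj₁ p with refl ← arc-unique p a | refl ← arc-unique p (subst (λ ρ → Arc ρ x f′) (Bool.not-involutive σ) b′) =
      trans (lookup-D g) (cong₂ _xor_ ([]=⇒lookup e∈) (∉⇒lookup f′∉))
    ... | inj₂ p with refl ← arc-unique p b | refl ← arc-unique p a′ =
      trans (lookup-D g) (cong₂ _xor_ (∉⇒lookup f∉) ([]=⇒lookup e′∈))

    cases : Dec (x ≡ y) → deficientVertices (flip c c′ D C) ≡ [] ⊎ (2 ≤ length (deficientVertices (flip c c′ D C)) × 3 ≤ n)
    cases (no x≢y) = inj₂ (≢⇒2≤length {xs = deficientVertices (flip c c′ D C)}
        (∈-deficientVertices⁺ {flip c c′ D C} (deficientAt {T = S} {S′} t (Tail.even t′ x≢y) lookup-D))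
        (∈-deficientVertices⁺ {flip c c′ D C} (deficientAt {T = S′} {S} t′ (Tail.even t (x≢y ∘ sym))
           (λ e → trans (lookup-D e) (Bool.xor-comm (lookup S e) (lookup S′ e)))))
        x≢y ,
      (let e , a , e∈ = Tail.outArc t ; f , b , f∉ = Tail.inArc t in
       degree≥2⇒3≤n (Arc.incident a) (Arc.incident b) λ { refl → f∉ e∈ }))
    cases (yes refl) = inj₁ (nowhere⇒[] {flip c c′ D C} λ z → even⇒¬deficient {D} (everywhere z (z ≟ x)))
      where
      τ≡ : τ ≡ not σ
      -- In the same direction both would be the same maximal walk.
      τ≡ = Bool.¬-not λ { refl → S≢S′ (tail-unique t t′) }

      everywhere : ∀ z → Dec (z ≡ x) → Even C D z
      everywhere z (no z≢x)   = ⊕-even {S} {S′} (Tail.even t z≢x) (Tail.even t′ z≢x)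
      everywhere z (yes refl) i i′ s s′ = trans (all i s) (sym (all i′ s′))
        where
        all : ∀ {g} → Incident g x → Selected (lookup C g) → lookup D g ≡ true
        all = bothArcs (subst (λ ρ → Tail ρ x S′) τ≡ t′)

  -- `N` bounds the number of alternatives when a single set is flipped. The second case of `bound`
  -- is a flipped pair; it keeps the knowledge about deficient vertices on which the three-color
  -- estimate of f depends.
  record Flip (N : ℕ) (r : ℚ) (K : EdgeMap) : Set where
    field
      tame        : Tame K
      deficient≤2 : length (deficientVertices K) ≤ 2
      bound       : Recip r (3 * N) ⊎
        (Recip r (3 * (2 * (n * n))) × (deficientVertices K ≡ [] ⊎ (2 ≤ length (deficientVertices K) × 3 ≤ n)))

  private
    third : Recip (+ 1 / 3) 3
    third = recip-1/suc 2

  unflipped : ∀ {N r} → Recip r (3 * N) → Flip N r C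
  unflipped bd = record { tame = coloring⇒tame {C} coloring ; deficient≤2 = subst (λ vs → length vs ≤ 2) (sym coloring⇒[]) z≤n ; bound = inj₁ bd }

  module _ (1≤n : 1 ≤ n) where

    outerPaths : List EdgeSet
    outerPaths = filter (oneOuterEnd? H) (subPaths H)

    tailOf : ∀ {S} → S ∈ outerPaths → ∃[ σ ] ∃[ x ] Tail σ x S
    tailOf S∈ = let S∈′ , one = ∈-filter⁻ (oneOuterEnd? H) {xs = subPaths H} S∈ in oneOuterEnd⇒tail S∈′ one

    twoTails : ∀ {N r S S′} → (∃[ σ ] ∃[ x ] Tail σ x S) → (∃[ τ ] ∃[ y ] Tail τ y S′) → S ≢ S′ →
               Recip r (3 * (2 * (n * n))) → Flip N r (flip c c′ S′ (flip c c′ S C))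
    twoTails {N} {r} {S} {S′} (σ , x , t) (τ , y , t′) S≢S′ bd = subst (Flip N r) (sym (flip-⊕ S S′ C)) record
      { tame = flip-tame (S ⊕ S′) (coloring⇒tame {C} coloring)
      ; deficient≤2 = evenExcept⇒deficient-≤2 {S ⊕ S′} x y (λ z≢x z≢y → ⊕-even {S} {S′} (Tail.even t z≢x) (Tail.even t′ z≢y))
      ; bound = inj₂ (bd , twoTails-deficient t t′ S≢S′) }

    subPath-even : ∀ {S} → S ∈ subPaths H → ∃[ x ] ∃[ y ] (∀ {z} → z ≢ x → z ≢ y → Even C S z)
    subPath-even S∈ = let _ , u , w , _ , _ , p = subPaths⁻ S∈ in u , w , walk-even p

    1≤n*n : 1 ≤ n * n
    1≤n*n = ℕ.*-mono-≤ 1≤n 1≤n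

    flipOne : List EdgeSet → Dist EdgeMap
    flipOne xs = choose xs (pure C) λ S → pure (flip c c′ S C)

    flipPair : EdgeSet × EdgeSet → EdgeMap
    flipPair (S , S′) = flip c c′ S′ (flip c c′ S C)

    flipBoth : Dist EdgeMap
    flipBoth = choose (pairs outerPaths) (pure C) λ SS′ → pure (flipPair SS′)

    notFlipped : ∀ {N r K} → 1 ≤ N → K ≡ C → (∀ {M} → 1 ≤ M → Recip r M) → Flip N (+ 1 / 3 ℚ.* r) K
    notFlipped 1≤N refl bd = unflipped (recip-* third (bd 1≤N))

    oneFlip : ∀ {N xs r K} → 1 ≤ N → length xs ≤ N →
              (∀ {S} → S ∈ xs → ∃[ x ] ∃[ y ] (∀ {z} → z ≢ x → z ≢ y → Even C S z)) →
              (r , K) ∈ flipOne xs → Flip N (+ 1 / 3 ℚ.* r) K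
    oneFlip {N} {xs} {r} {K} 1≤N len ev K∈ =
      [ (λ (K≡ , bd) → notFlipped 1≤N K≡ bd)
      , (λ (S , S∈ , K≡ , bd) → flipped (ev S∈) K≡ (bd len)) ]′ (∈-choose-pure⁻ xs {C} {λ S → flip c c′ S C} K∈)
      where
      flipped : ∀ {S} → ∃[ x ] ∃[ y ] (∀ {z} → z ≢ x → z ≢ y → Even C S z) → K ≡ flip c c′ S C → Recip r N → Flip N (+ 1 / 3 ℚ.* r) K
      flipped {S} (x , y , even) refl rec = record
        { tame = flip-tame S (coloring⇒tame {C} coloring)
        ; deficient≤2 = evenExcept⇒deficient-≤2 {S} x y even
        ; bound = inj₁ (recip-* third rec) }

    bothFlip : ∀ {N r K} → 1 ≤ N → (r , K) ∈ flipBoth → Flip N (+ 1 / 3 ℚ.* r) K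
    bothFlip {N} {r} {K} 1≤N K∈ =
      [ (λ (K≡ , bd) → notFlipped 1≤N K≡ bd)
      , (λ (SS′ , p∈ , K≡ , bd) → flipped SS′ (pairs⁻ (filter⁺ (oneOuterEnd? H) subPaths-unique) p∈) K≡
           (bd (length-pairs-≤ outerPaths {n} length-oneOuterEnd))) ]′ (∈-choose-pure⁻ (pairs outerPaths) {C} {flipPair} K∈)
      where
      flipped : ∀ SS′ → proj₁ SS′ ∈ outerPaths × proj₂ SS′ ∈ outerPaths × proj₁ SS′ ≢ proj₂ SS′ →
                K ≡ flipPair SS′ → Recip r (2 * (n * n)) → Flip N (+ 1 / 3 ℚ.* r) K
      flipped (S , S′) (S∈ , S′∈ , S≢S′) refl rec = twoTails (tailOf S∈) (tailOf S′∈) S≢S′ (recip-* third rec)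

    flipMix : ∀ {N} xs → 1 ≤ N → length xs ≤ N →
              (∀ {S} → S ∈ xs → ∃[ x ] ∃[ y ] (∀ {z} → z ≢ x → z ≢ y → Even C S z)) → ∀ {r K} →
              (r , K) ∈ mix ((+ 1 / 3 , pure C) ∷ (+ 1 / 3 , flipOne xs) ∷ (+ 1 / 3 , flipBoth) ∷ []) → Flip N r K
    flipMix {N} xs 1≤N len even {K = K} = mix₃-elim {p₁ = + 1 / 3} {+ 1 / 3} {+ 1 / 3} {pure C} {flipOne xs} {flipBoth} (λ r → Flip N r K)
      (λ {q} K∈ → let r≡ , K≡ = ∈-pure⁻ K∈ in notFlipped 1≤N K≡ λ {M} 1≤M → subst (λ r → Recip r M) (sym r≡) (recip-mono 1≤M recip-1))
      (oneFlip {xs = xs} 1≤N len even)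
      (bothFlip 1≤N)

    -- At most n² sub-paths and n² cycles, together as many as the bound 2n² for pairs.
    flipSelected₂ : ∀ {r K} → (r , K) ∈ flipSelected (Selection.two c c′) C → Flip (2 * (n * n)) r K
    flipSelected₂ = flipMix (subPaths H ++ cycles H) (ℕ.*-mono-≤ {1} {2} (s≤s z≤n) 1≤n*n)
      (subst₂ _≤_ (sym (length-++ (subPaths H))) (cong (n * n ℕ.+_) (sym (ℕ.+-identityʳ (n * n)))) (ℕ.+-mono-≤ length-subPaths length-cycles))
      even
      where
      even : ∀ {S} → S ∈ subPaths H ++ cycles H → ∃[ x ] ∃[ y ] (∀ {z} → z ≢ x → z ≢ y → Even C S z)
      even S∈ = [ subPath-even , (λ S∈′ → let _ , u , _ , _ , p = cycles⁻ S∈′ in u , u , walk-even p) ]′ (∈-++⁻ (subPaths H) S∈)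

    flipSelected₃ : ∀ {c″ r K} → (r , K) ∈ flipSelected (three c c′ c″) C → Flip (n * n) r K
    flipSelected₃ = flipMix (filter (hasInnerEnd? H) (subPaths H)) 1≤n*n
      (ℕ.≤-trans (length-filter (hasInnerEnd? H) (subPaths H)) length-subPaths)
      (λ S∈ → subPath-even (proj₁ (∈-filter⁻ (hasInnerEnd? H) S∈)))

-- One step of a prolongation

module Prolongation (G : Graph) (k : ℕ) where
  open Graph G
  open Chain G k
  open Coloring G k

  nextEdges : EdgeMap → EdgeSet → Vertex → Color → List Edge
  nextEdges K X w x = filter (λ e → ¬? (e ∈? X)) (edgesAt K w x)

  ∈-nextEdges⁻ : ∀ {K X w x e} → e ∈ nextEdges K X w x → Incident e w × lookup K e ≡ x
  ∈-nextEdges⁻ {K} {X} {w} {x} e∈ = ∈-edgesAt⁻ {K} (proj₁ (∈-filter⁻ (λ e → ¬? (e ∈? X)) {xs = edgesAt K w x} e∈))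

  prolong-suc⁻ : ∀ {t K X T w x y r T′} → (r , T′) ∈ prolong (suc t) K X T w x y →
    (Any (_∈ₛ T) (nextEdges K X w x) × r ≡ 1ℚ × T′ ≡ T) ⊎
    (nextEdges K X w x ≡ [] × r ≡ 1ℚ × T′ ≡ T) ⊎
    (∃[ e ] ∃[ q ] e ∈ nextEdges K X w x × ¬ Any (_∈ₛ T) (nextEdges K X w x) ×
       (q , T′) ∈ prolong t K X (T ∪ ⁅ e ⁆) (opposite e w) y x ×
       (∀ {N M} → length (nextEdges K X w x) ≤ N → Recip q M → Recip r (N * M)))
  prolong-suc⁻ {K = K} {X} {T} {w} {x} p∈ with filter (λ e → ¬? (e ∈? X)) (edgesAt K w x)
  ... | next with Any.any? (_∈? T) next
  ...   | yes closed = inj₁ (closed , ∈-pure⁻ p∈)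
  ...   | no ¬closed with ∈-choose⁻ {xs = next} p∈
  ...     | inj₁ (eq , p∈′)          = inj₂ (inj₁ (eq , ∈-pure⁻ p∈′))
  ...     | inj₂ (e , q , e∈ , q∈ , bd) = inj₂ (inj₂ (e , q , e∈ , ¬closed , q∈ , bd))

-- Elimination of deficiencies

module Elimination (G : Graph) (k : ℕ) (side : Fin (Graph.∣V∣ G) → Bool)
  (bipartite : ∀ e → side (Graph.src G e) ≢ side (Graph.tgt G e)) (c c′ : Fin k) (c≢c′ : c ≢ c′)
  where

  open Graph G
  open Chain G k
  open Coloring G k
  open Prolongation G k
  open Alternating G k side bipartite using (side-opposite)
  open TwoColors c c′ c≢c′
  open Tame

  module _ {K : EdgeMap} (tame : Tame K) {v : Vertex} (d : Doubled K v) where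

    private
      e e′ : Edge
      e  = Doubled.e d
      e′ = Doubled.f d

      a b : Color
      a = lookup K e
      b = swap c c′ a

      a-selected : Selected a
      a-selected = repeated-selected tame (Doubled.incident₁ d) (Doubled.incident₂ d) (Doubled.different d) (Doubled.sameColor d)

      -- The colors alternate like the sides, so the side of the current vertex
      -- tells which color comes next; in particular a trail that returned to v
      -- would do so by an edge of color b, which does not exist.
      nextColor : Vertex → Color
      nextColor w = if side w xor side v then b else a

      nextColor-opposite : ∀ {f w} → Incident f w → nextColor (opposite f w) ≡ swap c c′ (nextColor w)
      nextColor-opposite {f} {w} i rewrite side-opposite i with side w | side v
      ... | true  | true  = refl
      ... | true  | false = sym (swap-involutive a)
      ... | false | true  = sym (swap-involutive a)
      ... | false | false = refl

      nextColor-v : nextColor v ≡ a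
      nextColor-v with side v
      ... | true  = refl
      ... | false = refl

      nextColor-selected : ∀ w → Selected (nextColor w)
      nextColor-selected w with side w xor side v
      ... | true  = swap-selected a-selected
      ... | false = a-selected

    -- T starts at v with the edge e and has reached w; the next edge has color x.
    record Reached (T : EdgeSet) (w : Vertex) (x : Color) : Set where
      field
        start∈    : e ∈ₛ T
        other∉    : e′ ∉ₛ T
        end≢start : w ≢ v
        color     : x ≡ nextColor w
        {arrival} : Edge
        arrival-incident : Incident arrival w
        arrival-color    : lookup K arrival ≡ swap c c′ x
        arrival∈  : arrival ∈ₛ T
        others∉   : ∀ {h} → Incident h w → Selected (lookup K h) → h ≢ arrival → h ∉ₛ T
        even      : ∀ {z} → z ≢ v → z ≢ w → Even K T z

    record Finished (T : EdgeSet) : Set where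
      field
        {end}    : Vertex
        {color}  : Color
        reached  : Reached T end color
        maximal  : ∀ {h} → Incident h end → lookup K h ≢ color

    private
      module Extend {T w x} (r : Reached T w x) {f} (i : Incident f w) (p : lookup K f ≡ x) where
        open Reached r

        x-selected : Selected x
        x-selected = subst Selected (sym color) (nextColor-selected w)

        f≢arrival : f ≢ arrival
        f≢arrival refl = swap-≢ x-selected (trans (sym arrival-color) p)

        f-selected : Selected (lookup K f)
        f-selected = subst Selected (sym p) x-selected

        f∉ : f ∉ₛ T
        f∉ = others∉ i f-selected f≢arrival

        arrival-selected : Selected (lookup K arrival)
        arrival-selected = subst Selected (sym arrival-color) (swap-selected x-selected)

        only-two : ∀ {h} → Incident h w → Selected (lookup K h) → h ≡ f ⊎ h ≡ arrival
        only-two j s with atMostTwo tame i arrival-incident j f-selected arrival-selected s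
        ... | inj₁ eq        = contradiction eq f≢arrival
        ... | inj₂ (inj₁ eq) = inj₁ (sym eq)
        ... | inj₂ (inj₂ eq) = inj₂ (sym eq)

        -- Since the color expected at v is `a`, an edge by which the trail reached v would have
        -- color `b`, which is missing there.
        w′≢v : opposite f w ≢ v
        w′≢v refl = doubled-partner-∉ tame d (opposite-incident i) (trans p (trans color (trans
          (sym (swap-involutive (nextColor w))) (cong (swap c c′) (trans (sym (nextColor-opposite i)) nextColor-v)))))

        at-ends : ∀ {z} → Incident f z → z ≢ w → z ≡ opposite f w
        at-ends j z≢w with incident-cases i j
        ... | inj₁ eq = contradiction eq z≢w
        ... | inj₂ eq = eq

        ∈T∪f⁻ : ∀ {h} → h ≢ f → h ∈ₛ T ∪ ⁅ f ⁆ → h ∈ₛ T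
        ∈T∪f⁻ h≢f h∈ with x∈p∪q⁻ T ⁅ f ⁆ h∈
        ... | inj₁ h∈T = h∈T
        ... | inj₂ h∈f = contradiction (x∈⁅y⁆⇒x≡y f h∈f) h≢f

        f∈T∪f : f ∈ₛ T ∪ ⁅ f ⁆
        f∈T∪f = x∈p∪q⁺ (inj₂ (x∈⁅x⁆ f))

        all∈ : ∀ {h} → Incident h w → Selected (lookup K h) → h ∈ₛ T ∪ ⁅ f ⁆
        all∈ j s with only-two j s
        ... | inj₁ refl = f∈T∪f
        ... | inj₂ refl = x∈p∪q⁺ (inj₁ arrival∈)

        -- The vertex w becomes an inner one: its two edges, `arrival` and `f`, now both belong to
        -- the trail. At other vertices off the two ends nothing changes.
        even′ : ∀ {z} → z ≢ v → z ≢ opposite f w → Even K (T ∪ ⁅ f ⁆) z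
        even′ {z} z≢v z≢w′ {h} {h′} j j′ s s′ with z ≟ w
        ... | yes refl = lookup-≡ (λ _ → all∈ j′ s′) (λ _ → all∈ j s)
        ... | no z≢w = lookup-≡ (transfer j j′ s s′) (transfer j′ j s′ s)
          where
          transfer : ∀ {h h′} → Incident h z → Incident h′ z → Selected (lookup K h) → Selected (lookup K h′) →
                     h ∈ₛ T ∪ ⁅ f ⁆ → h′ ∈ₛ T ∪ ⁅ f ⁆
          transfer {h} {h′} j j′ s s′ h∈ = x∈p∪q⁺ (inj₁ (lookup⇒[]= h′ T
            (trans (sym (even z≢v z≢w j j′ s s′)) ([]=⇒lookup (∈T∪f⁻ (λ { refl → z≢w′ (at-ends j z≢w) }) h∈)))))

        -- The old trail is even at the new end and does not contain `f`, so it contains no edge of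
        -- colors `c`, `c′` there: the trail has reached a vertex that it had not visited.
        others∉′ : ∀ {h} → Incident h (opposite f w) → Selected (lookup K h) → h ≢ f → h ∉ₛ T ∪ ⁅ f ⁆
        others∉′ {h} j s h≢f h∈ = f∉ (lookup⇒[]= f T
          (trans (even w′≢v (opposite-≢ i) (opposite-incident i) j f-selected s) ([]=⇒lookup (∈T∪f⁻ h≢f h∈))))

        other∉′ : e′ ∉ₛ T ∪ ⁅ f ⁆
        other∉′ e′∈ = other∉ (∈T∪f⁻ (λ { refl → w′≢v (sym (at-ends (Doubled.incident₂ d) (end≢start ∘ sym))) }) e′∈)

        extended : Reached (T ∪ ⁅ f ⁆) (opposite f w) (swap c c′ x)
        extended = record
          { start∈ = x∈p∪q⁺ (inj₁ start∈)
          ; other∉ = other∉′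
          ; end≢start = w′≢v
          ; color = trans (cong (swap c c′) color) (sym (nextColor-opposite i))
          ; arrival-incident = opposite-incident i
          ; arrival-color = trans p (sym (swap-involutive x))
          ; arrival∈ = f∈T∪f
          ; others∉ = others∉′
          ; even = even′ }

        larger : ∣ T ∣ < ∣ T ∪ ⁅ f ⁆ ∣
        larger = p⊂q⇒∣p∣<∣q∣ (p⊆p∪q ⁅ f ⁆ , f , f∈T∪f , f∉)

    -- The next edge is unique even at another deficient vertex, because besides the edge of arrival
    -- at most one edge of colors `c`, `c′` is present. It is also new, so `∣ T ∣` grows and cannot
    -- exceed `m`; the trail therefore ends before the steps run out.
    prolong-reaches-end : ∀ t {T w x y r T′} → Reached T w x → y ≡ swap c c′ x → m < ∣ T ∣ ℕ.+ t →
      (r , T′) ∈ prolong t K ∅ T w x y → Recip r 1 × Finished T′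
    prolong-reaches-end zero {T} _ _ m< _ = contradiction (∣p∣≤n T) (ℕ.<⇒≱ (subst (m <_) (ℕ.+-identityʳ _) m<))
    prolong-reaches-end (suc t) {T} {w} {x} reached refl m< p∈
      with prolong-suc⁻ {t} {K} {∅} {T} {w} {x} p∈
    ... | inj₁ (closed , _) with h , h∈ , h∈T ← find closed
                            with i , p ← ∈-nextEdges⁻ {K} {∅} {w} {x} h∈ =
      contradiction h∈T (Extend.f∉ reached i p)
    ... | inj₂ (inj₁ (none , refl , refl)) = recip-1 , record { reached = reached ; maximal = maximal }
      where
      maximal : ∀ {h} → Incident h w → lookup K h ≢ x
      maximal {h} i p with () ← subst (h ∈_) none (∈-filter⁺ (λ e → ¬? (e ∈? ∅)) (∈-edgesAt⁺ {K} i p) ∉⊥)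
    ... | inj₂ (inj₂ (f , q , f∈ , _ , q∈ , bd))
      with i , p ← ∈-nextEdges⁻ {K} {∅} {w} {x} f∈
      with rec , fin ← prolong-reaches-end t (Extend.extended reached i p) (sym (swap-involutive x))
                         (ℕ.≤-trans m< (ℕ.≤-trans (ℕ.≤-reflexive (ℕ.+-suc ∣ T ∣ t)) (ℕ.+-monoˡ-≤ t (Extend.larger reached i p)))) q∈
      = bd (length-≤1 (filter⁺ (λ e → ¬? (e ∈? ∅)) (edgesAt-unique {K})) single) rec , fin
      where
      only : ∀ {h} → h ∈ nextEdges K ∅ w x → h ≡ f
      only h∈ with j , p′ ← ∈-nextEdges⁻ {K} {∅} {w} {x} h∈
              with Extend.only-two reached i p j (subst Selected (sym p′) (Extend.x-selected reached i p))
      ... | inj₁ eq = eq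
      ... | inj₂ eq = contradiction eq (Extend.f≢arrival reached j p′)
      single : ∀ {h h′} → h ∈ nextEdges K ∅ w x → h′ ∈ nextEdges K ∅ w x → h ≡ h′
      single h∈ h′∈ = trans (only h∈) (sym (only h′∈))

    started : Reached ⁅ e ⁆ (opposite e v) b
    started = record
      { start∈ = x∈⁅x⁆ e
      ; other∉ = λ e′∈ → Doubled.different d (sym (x∈⁅y⁆⇒x≡y e e′∈))
      ; end≢start = opposite-≢ (Doubled.incident₁ d)
      ; color = sym (trans (nextColor-opposite (Doubled.incident₁ d)) (cong (swap c c′) nextColor-v))
      ; arrival-incident = opposite-incident (Doubled.incident₁ d)
      ; arrival-color = sym (swap-involutive a)
      ; arrival∈ = x∈⁅x⁆ e
      ; others∉ = λ _ _ h≢ h∈ → h≢ (x∈⁅y⁆⇒x≡y e h∈)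
      ; even = λ z≢v z≢w i i′ _ _ → trans (∉⇒lookup (away z≢v z≢w i)) (sym (∉⇒lookup (away z≢v z≢w i′))) }
      where
      away : ∀ {z h} → z ≢ v → z ≢ opposite e v → Incident h z → h ∉ₛ ⁅ e ⁆
      away z≢v z≢w i h∈ with refl ← x∈⁅y⁆⇒x≡y e h∈ with incident-cases (Doubled.incident₁ d) i
      ... | inj₁ eq = z≢v eq
      ... | inj₂ eq = z≢w eq

    module _ {T} (fin : Finished T) where
      open Finished fin
      open Reached reached hiding (color)

      private
        K′ : EdgeMap
        K′ = flip c c′ T K

      -- The trail is even except at `v`, where just one of the two equal edges is flipped, and at
      -- its end.
      doubled-remains : ∀ {z} → Doubled K′ z → Doubled K z × z ≢ v
      doubled-remains {z} d′@(doubled {h} {h′} i i′ h≢h′ eq) = cases (z ≟ v) (z ≟ end)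
        where
        s : Selected (lookup K h)
        s = flip-selected⁻ T K (repeated-selected (flip-tame T tame) i i′ h≢h′ eq)
        s′ : Selected (lookup K h′)
        s′ = flip-selected⁻ T K (subst Selected eq (repeated-selected (flip-tame T tame) i i′ h≢h′ eq))

        color-arrival : lookup K′ arrival ≡ color
        color-arrival = trans (lookup-flip-∈ K arrival∈) (trans (cong (swap c c′) arrival-color) (swap-involutive color))

        c-selected : Selected color
        c-selected = subst Selected (sym (Reached.color reached)) (nextColor-selected end)

        -- The edge of arrival receives the color that would have continued the trail, and by
        -- maximality no edge at the end has it.
        notEnd : ∀ {g g′} → Incident g′ end → Selected (lookup K g′) → g ≡ arrival → g ≢ g′ → lookup K′ g ≢ lookup K′ g′
        notEnd j s refl g≢g′ eq = maximal j (trans (sym (lookup-flip-∉ K (others∉ j s (g≢g′ ∘ sym)))) (trans (sym eq) color-arrival))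

        cases : Dec (z ≡ v) → Dec (z ≡ end) → Doubled K z × z ≢ v
        cases (no z≢v)   (no z≢end) = flip-keeps-doubled tame T (even z≢v z≢end) d′ , z≢v
        cases (yes refl) _ = contradiction d′ (flip-resolves tame d start∈ other∉)
        cases (no _)     (yes refl)
          with atMostTwo tame arrival-incident i i′ (subst Selected (sym arrival-color) (swap-selected c-selected)) s s′
        ... | inj₁ p        = contradiction eq (notEnd i′ s′ (sym p) h≢h′)
        ... | inj₂ (inj₁ p) = contradiction (sym eq) (notEnd i s (sym p) (h≢h′ ∘ sym))
        ... | inj₂ (inj₂ p) = contradiction p h≢h′

      -- The vertex `v` drops out and none enters, whence the strict inequality.
      fewer-deficient : length (deficientVertices K′) < length (deficientVertices K)
      fewer-deficient = length-≤-⊆ {xs = v ∷ deficientVertices K′}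
        (All.tabulate (λ z∈ v≡z → proj₂ (remains z∈) (sym v≡z)) ∷ deficientVertices-unique K′)
        λ { (here refl) → ∈-deficientVertices⁺ {K} (doubled⇒deficient tame d)
          ; (there z∈)  → ∈-deficientVertices⁺ {K} (doubled⇒deficient tame (proj₁ (remains z∈))) }
        where
        remains : ∀ {z} → z ∈ deficientVertices K′ → Doubled K z × z ≢ v
        remains z∈ = doubled-remains (deficient⇒doubled {K′} (∈-deficientVertices⁻ {K′} z∈))

    -- The color against which the deficiency is eliminated is forced and costs no factor. In
    -- particular φ₂ does not resort to the distinguished color on a tame map.
    candidates-≡ : filter (deficiency? K v a) (c ∷ c′ ∷ []) ≡ b ∷ []
    candidates-≡ = cases a-selected
      where
      def : Deficiency K v a b
      def = doubled⇒deficiency tame d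
      ¬def : ¬ Deficiency K v a a
      ¬def (p , _ , q) with () ← trans (sym p) q
      cases : Selected a → filter (deficiency? K v a) (c ∷ c′ ∷ []) ≡ b ∷ []
      cases (inj₁ p) = trans (filter-reject (deficiency? K v a) (subst (¬_ ∘ Deficiency K v a) p ¬def))
        (trans (filter-accept (deficiency? K v a) (subst (Deficiency K v a) b≡c′ def)) (cong (_∷ []) (sym b≡c′)))
        where
        b≡c′ : b ≡ c′
        b≡c′ = trans (cong (swap c c′) p) swap-c
      cases (inj₂ p) = trans (filter-accept (deficiency? K v a) (subst (Deficiency K v a) b≡c def))
        (trans (cong (c ∷_) (filter-reject (deficiency? K v a) (subst (¬_ ∘ Deficiency K v a) p ¬def))) (cong (_∷ []) (sym b≡c)))
        where
        b≡c : b ≡ c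
        b≡c = trans (cong (swap c c′) p) swap-c′

  data Selects : Selection → Set where
    two   : Selects (Selection.two c c′)
    three : ∀ {c″} → Selects (Selection.three c c′ c″)

  partners-≡ : ∀ {s K v} → Selects s → (tame : Tame K) (d : Doubled K v) →
    let a = lookup K (Doubled.e d) in partners s K v a ≡ swap c c′ a ∷ []
  partners-≡ two   tame d = candidates-≡ tame d
  partners-≡ three tame d rewrite candidates-≡ tame d = refl

  flip-comm : ∀ {a} → Selected a → ∀ S K → flip a (swap c c′ a) S K ≡ flip c c′ S K
  flip-comm (inj₁ refl) S K = cong (λ b → flip c b S K) swap-c
  flip-comm (inj₂ refl) S K = trans (cong (λ b → flip c′ b S K) swap-c′)
    (tabulate-cong λ e → cong (λ d → if does (e ∈? S) then d else lookup K e) (swap-comm (lookup K e)))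
    where
    swap-comm : ∀ d → swap c′ c d ≡ swap c c′ d
    swap-comm d with d ≟ c | d ≟ c′
    ... | yes refl | yes p = contradiction p c≢c′
    ... | yes _    | no _  = refl
    ... | no _     | yes _ = refl
    ... | no _     | no _  = refl

  module _ (s : Selection) (K : EdgeMap) (v : Vertex) where

    eliminateWith : Edge → Color → Dist EdgeMap
    eliminateWith e b = prolong m K ∅ ⁅ e ⁆ (opposite e v) b (lookup K e) >>= λ T → pure (flip (lookup K e) b T K)

    eliminateFrom : Edge → Dist EdgeMap
    eliminateFrom e = choose (partners s K v (lookup K e)) (pure K) (eliminateWith e)

    Reduces : ℕ → ℚ → EdgeMap → Set
    Reduces N r K′ = Recip r N × Tame K′ × length (deficientVertices K′) < length (deficientVertices K)

    eliminateWith⁻ : ∀ {r K′} → Tame K → (d : Doubled K v) →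
      (r , K′) ∈ eliminateWith (Doubled.e d) (swap c c′ (lookup K (Doubled.e d))) → Reduces 1 r K′
    eliminateWith⁻ {r} {K′} tame d K′∈ =
      let p , T , q , T∈ , K′∈′ , r≡ = ∈->>=⁻ {d = prolong m K ∅ ⁅ e ⁆ (opposite e v) b a} {f = λ T → pure (flip a b T K)} K′∈
          q≡ , K′≡ = ∈-pure⁻ K′∈′
          rec , fin = prolong-reaches-end tame d m (started tame d) (sym (swap-involutive a))
            (ℕ.≤-reflexive (cong (ℕ._+ m) (sym (∣⁅x⁆∣≡1 e)))) T∈
      in subst (λ r → Recip r 1) (sym (trans r≡ (cong (p ℚ.*_) q≡))) (recip-* rec recip-1) ,
         subst Reduced (sym (trans K′≡ (flip-comm selected T K))) (flip-tame T tame , fewer-deficient tame d fin)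
      where
      e : Edge
      e = Doubled.e d
      a b : Color
      a = lookup K e
      b = swap c c′ a
      Reduced : EdgeMap → Set
      Reduced K′ = Tame K′ × length (deficientVertices K′) < length (deficientVertices K)
      selected : Selected a
      selected = repeated-selected tame (Doubled.incident₁ d) (Doubled.incident₂ d) (Doubled.different d) (Doubled.sameColor d)

    eliminateFrom⁻ : ∀ {r K′} → Selects s → Tame K → (d : Doubled K v) →
      (r , K′) ∈ eliminateFrom (Doubled.e d) → Reduces 1 r K′
    eliminateFrom⁻ {r} {K′} sel tame d K′∈ =
      let b , q , b∈ , K′∈′ , bd = ∈-choose⁻-∈ {xs = partners s K v a} {d = pure K} {f = eliminateWith (Doubled.e d)}
            (subst (swap c c′ a ∈_) (sym partners≡) (here refl)) K′∈
          rec , reduced = eliminateWith⁻ tame d (subst (λ b → (q , K′) ∈ eliminateWith (Doubled.e d) b) (only (subst (b ∈_) partners≡ b∈)) K′∈′)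
      in bd (ℕ.≤-reflexive (cong length partners≡)) rec , reduced
      where
      a : Color
      a = lookup K (Doubled.e d)
      partners≡ : partners s K v a ≡ swap c c′ a ∷ []
      partners≡ = partners-≡ sel tame d
      only : ∀ {b b′ : Color} → b ∈ b′ ∷ [] → b ≡ b′
      only (here eq) = eq

    eliminateAt⁻ : ∀ {r K′} → Selects s → Tame K → Deficient K v → (r , K′) ∈ eliminateAt s K v → Reduces 2 r K′
    eliminateAt⁻ {r} {K′} sel tame def K′∈ =
      let e , q , e∈ , K′∈′ , bd = ∈-choose⁻-∈ {xs = doubledEdges K v} {d = pure K} {f = eliminateFrom} (proj₂ (deficient⇒doubledEdge tame def)) K′∈
          d , e≡ = ∈-doubledEdges⁻ tame e∈
          rec , reduced = eliminateFrom⁻ sel tame d (subst (λ e → (q , K′) ∈ eliminateFrom e) (sym e≡) K′∈′)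
      in bd (doubledEdges-≤2 tame) rec , reduced

  eliminate-suc⁻ : ∀ t {s K r K′} → (r , K′) ∈ eliminate (suc t) s K →
                   (r ≡ 1ℚ) ⊎ (∃[ v ] Deficient K v × (r , K′) ∈ (eliminateAt s K v >>= eliminate t s))
  eliminate-suc⁻ t {s} {K} {r} {K′} K′∈ = byVertices (deficientVertices K) refl K′∈
    where
    byVertices : ∀ vs → deficientVertices K ≡ vs → (r , K′) ∈ eliminate (suc t) s K →
                 (r ≡ 1ℚ) ⊎ (∃[ v ] Deficient K v × (r , K′) ∈ (eliminateAt s K v >>= eliminate t s))
    byVertices []       eq K′∈ rewrite eq = inj₁ (proj₁ (∈-pure⁻ K′∈))
    byVertices (v ∷ vs) eq K′∈ = inj₂ (v , ∈-deficientVertices⁻ {K} (subst (v ∈_) (sym eq) (here refl)) , reduce eq K′∈)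
      where
      reduce : deficientVertices K ≡ v ∷ vs → (r , K′) ∈ eliminate (suc t) s K → (r , K′) ∈ (eliminateAt s K v >>= eliminate t s)
      reduce eq K′∈ rewrite eq = K′∈

  -- Each round costs a factor 2, for the choice between the two equally colored edges, and lowers
  -- the number of deficient vertices. So the exponent is that number and not the allowance `t`.
  eliminate⁻ : ∀ t {s K r K′ δ} → Selects s → Tame K → length (deficientVertices K) ≤ δ →
               (r , K′) ∈ eliminate t s K → Recip r (2 ^ δ)
  eliminate⁻ zero    {δ = δ} _ _ _ K′∈ with refl , _ ← ∈-pure⁻ K′∈ = recip-mono (ℕ.>-nonZero⁻¹ (2 ^ δ) {{ℕ.m^n≢0 2 δ}}) recip-1
  eliminate⁻ (suc t) {s} {K} {r} {K′} {δ} sel tame le K′∈ = cases (eliminate-suc⁻ t {s} {K} K′∈)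
    where
    eliminated : ∀ {v δ} → Deficient K v → length (deficientVertices K) ≤ δ →
                 (∃[ p ] ∃[ K₁ ] ∃[ q ] (p , K₁) ∈ eliminateAt s K v × (q , K′) ∈ eliminate t s K₁ × r ≡ p ℚ.* q) → Recip r (2 ^ δ)
    eliminated {v} {zero} def le _ = contradiction (∈⇒0<length (∈-deficientVertices⁺ {K} def)) (ℕ.<⇒≱ (s≤s le))
    eliminated {v} {suc δ} def le (p , K₁ , q , K₁∈ , K′∈ , refl) =
      let rec , tame₁ , lt = eliminateAt⁻ s K v sel tame def K₁∈ in
      recip-* rec (eliminate⁻ t sel tame₁ (ℕ.≤-pred (ℕ.≤-trans lt le)) K′∈)

    cases : (r ≡ 1ℚ) ⊎ (∃[ v ] Deficient K v × (r , K′) ∈ (eliminateAt s K v >>= eliminate t s)) → Recip r (2 ^ δ)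
    cases (inj₁ refl)           = recip-mono (ℕ.>-nonZero⁻¹ (2 ^ δ) {{ℕ.m^n≢0 2 δ}}) recip-1
    cases (inj₂ (v , def , K′∈)) = eliminated def le (∈->>=⁻ {d = eliminateAt s K v} {f = eliminate t s} K′∈)

-- How often a prolongation can branch

module Branching (G : Graph) (k : ℕ) (K : Chain.EdgeMap G k) where
  open Graph G
  open Chain G k
  open Coloring G k
  open Prolongation G k

  -- No random choice is made at z in color x: either there is at most one edge to continue with, or
  -- the trail already contains one of them and `prolong` stops.
  Closed : (X T : EdgeSet) → Vertex → Color → Set
  Closed X T z x = length (nextEdges K X z x) ≤ 1 ⊎ Any (_∈ₛ T) (nextEdges K X z x)

  Safe : (X T : EdgeSet) → Set
  Safe X T = ∀ z x → Closed X T z x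

  -- Describes a map in which a single deficient vertex `w₀` is left to branch at; two edges of one
  -- color meet there.
  record AlmostSafe (X T : EdgeSet) (w₀ : Vertex) : Set where
    field
      elsewhere : ∀ {z} x → z ≢ w₀ → Closed X T z x
      one-color : ∀ {x y} → x ≢ y → length (nextEdges K X w₀ x) ≤ 1 ⊎ length (nextEdges K X w₀ y) ≤ 1
      at-most-2 : ∀ x → length (nextEdges K X w₀ x) ≤ 2
  open AlmostSafe

  closed-mono : ∀ {X T T′ z x} → T ⊆ T′ → Closed X T z x → Closed X T′ z x
  closed-mono T⊆ (inj₁ ≤1)    = inj₁ ≤1
  closed-mono T⊆ (inj₂ among) = inj₂ (Any.map T⊆ among)

  almostSafe-mono : ∀ {X T T′ w₀} → T ⊆ T′ → AlmostSafe X T w₀ → AlmostSafe X T′ w₀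
  almostSafe-mono T⊆ as = record
    { elsewhere = λ x z≢ → closed-mono T⊆ (elsewhere as x z≢) ; one-color = one-color as ; at-most-2 = at-most-2 as }

  closed⇒≤1 : ∀ {X T z x} → ¬ Any (_∈ₛ T) (nextEdges K X z x) → Closed X T z x → length (nextEdges K X z x) ≤ 1
  closed⇒≤1 _     (inj₁ ≤1)    = ≤1
  closed⇒≤1 ¬among (inj₂ among) = contradiction among ¬among

  prolong-safe : ∀ t {X T w x y r T′} → Safe X T → (r , T′) ∈ prolong t K X T w x y → Recip r 1 × T ⊆ T′
  prolong-safe zero    _ T∈ with refl , refl ← ∈-pure⁻ T∈ = recip-1 , id
  prolong-safe (suc t) {X} {T} {w} {x} {y} safe T∈ with prolong-suc⁻ {t} {K} {X} {T} {w} {x} {y} T∈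
  ... | inj₁ (_ , refl , refl)        = recip-1 , id
  ... | inj₂ (inj₁ (_ , refl , refl)) = recip-1 , id
  ... | inj₂ (inj₂ (e , q , e∈ , ¬among , T∈′ , bd))
    with rec , T⊆ ← prolong-safe t (λ z x → closed-mono (p⊆p∪q ⁅ e ⁆) (safe z x)) T∈′
    = bd (closed⇒≤1 ¬among (safe w x)) rec , T⊆ ∘ p⊆p∪q ⁅ e ⁆

  -- A branching at w₀ puts one of its two equally colored edges into the
  -- trail, and from then on the trail cannot branch again.
  prolong-almostSafe : ∀ t {X T w₀ w x y r T′} → AlmostSafe X T w₀ → (r , T′) ∈ prolong t K X T w x y →
    (Recip r 1 × T ⊆ T′) ⊎ (Recip r 2 × Safe X T′)
  prolong-almostSafe zero    _ T∈ with refl , refl ← ∈-pure⁻ T∈ = inj₁ (recip-1 , id)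
  prolong-almostSafe (suc t) {X} {T} {w₀} {w} {x} {y} {r} {T′} as T∈ with prolong-suc⁻ {t} {K} {X} {T} {w} {x} {y} T∈
  ... | inj₁ (_ , refl , refl)        = inj₁ (recip-1 , id)
  ... | inj₂ (inj₁ (_ , refl , refl)) = inj₁ (recip-1 , id)
  ... | inj₂ (inj₂ (e , q , e∈ , ¬among , T∈′ , bd)) = cases (w ≟ w₀) (length (nextEdges K X w x) ℕ.≤? 1)
    where
    unbranched : length (nextEdges K X w x) ≤ 1 → (Recip r 1 × T ⊆ T′) ⊎ (Recip r 2 × Safe X T′)
    unbranched ≤1 with prolong-almostSafe t (almostSafe-mono (p⊆p∪q ⁅ e ⁆) as) T∈′
    ... | inj₁ (rec , T⊆)   = inj₁ (bd ≤1 rec , T⊆ ∘ p⊆p∪q ⁅ e ⁆)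
    ... | inj₂ (rec , safe) = inj₂ (bd ≤1 rec , safe)

    cases : Dec (w ≡ w₀) → Dec (length (nextEdges K X w x) ≤ 1) → (Recip r 1 × T ⊆ T′) ⊎ (Recip r 2 × Safe X T′)
    cases _          (yes ≤1) = unbranched ≤1
    cases (no w≢w₀)  _        = unbranched (closed⇒≤1 ¬among (elsewhere as x w≢w₀))
    cases (yes refl) (no ¬≤1) = inj₂ (bd (at-most-2 as x) (proj₁ result) , λ z x′ → closed-mono (proj₂ result) (safe z x′))
      where
      safe : Safe X (T ∪ ⁅ e ⁆)
      safe z x′ with z ≟ w₀ | x ≟ x′
      ... | no z≢w₀  | _        = closed-mono (p⊆p∪q ⁅ e ⁆) (elsewhere as x′ z≢w₀)
      ... | yes refl | yes refl = inj₂ (lose e∈ (x∈p∪q⁺ (inj₂ (x∈⁅x⁆ e))))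
      ... | yes refl | no x≢x′ with one-color as x≢x′
      ...   | inj₁ ≤1 = contradiction ≤1 ¬≤1
      ...   | inj₂ ≤1 = inj₁ ≤1
      result : Recip q 1 × T ∪ ⁅ e ⁆ ⊆ T′
      result = prolong-safe t safe T∈′

-- The perturbation for three colors

module ThreeColors (G : Graph) (k : ℕ) (c c′ c″ : Fin k) (K : Chain.EdgeMap G k) where
  open Graph G
  open Chain G k
  open Coloring G k using (n; m)

  -- The definitions of this module restate the local ones of `perturb₃` with a name for every
  -- continuation; both agree by computation.
  flipThrough : Vertex → Edge → EdgeSet → Dist EdgeMap
  flipThrough v e T = prolong m K ∅ T v c″ (lookup K e) >>= λ T′ → pure (flip (lookup K e) c″ T′ K)

  atDeficientEdge : Vertex → Edge → Dist EdgeMap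
  atDeficientEdge v e = prolong m K ∅ ⁅ e ⁆ (opposite e v) c″ (lookup K e) >>= flipThrough v e

  atDeficient : Vertex → Dist EdgeMap
  atDeficient v = choose (doubledEdges K v) (pure K) (atDeficientEdge v)

  flipBeyond : Vertex → Edge → Edge → Dist EdgeMap
  flipBeyond v e f = prolong m K ⁅ f ⁆ ⁅ e ⁆ (opposite e v) (lookup K f) c″ >>= λ T → pure (flip (lookup K f) c″ T K)

  companions : Vertex → List Edge
  companions v = edgesAt K v c ++ edgesAt K v c′

  atNondeficientEdge : Vertex → Edge → Dist EdgeMap
  atNondeficientEdge v e = choose (companions v) (pure K) (flipBeyond v e)

  atNondeficient : Vertex → Dist EdgeMap
  atNondeficient v = choose (edgesAt K v c″) (pure K) (atNondeficientEdge v)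

  candidate? : ∀ v → Dec ((¬ Deficient K v) × (1 ≤ length (edgesAt K v c″)) × (1 ≤ length (companions v)))
  candidate? v = ¬? (deficient? K v) ×-dec (1 ℕ.≤? length (edgesAt K v c″)) ×-dec (1 ℕ.≤? length (companions v))

  candidates : List Vertex
  candidates = filter candidate? (allFin n)

  nondeficient : Dist EdgeMap
  nondeficient = choose candidates (pure K) atNondeficient

  perturb₃-cases : ∀ {r K′} → (r , K′) ∈ perturb₃ c c′ c″ K →
    (deficientVertices K ≡ [] × (r , K′) ∈ nondeficient) ⊎
    (∃[ v ] deficientVertices K ≡ v ∷ [] × (r , K′) ∈ mix ((½ , atDeficient v) ∷ (½ , nondeficient) ∷ [])) ⊎
    (2 ≤ length (deficientVertices K) × (r , K′) ∈ choose (deficientVertices K) (pure K) atDeficient)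
  perturb₃-cases K′∈ with deficientVertices K
  ... | []        = inj₁ (refl , K′∈)
  ... | v ∷ []    = inj₂ (inj₁ (v , refl , K′∈))
  ... | _ ∷ _ ∷ _ = inj₂ (inj₂ (s≤s (s≤s z≤n) , K′∈))

-- `general` is for a single flipped path; `ifNone` and `ifTwo` are the better bounds available for
-- a flipped pair.
record Outcome₃ (G : Graph) (k : ℕ) (K : Chain.EdgeMap G k) (r : ℚ) : Set where
  open Graph G using (∣V∣)
  open Chain G k using (deficientVertices)
  field
    general : Recip r (8 * (∣V∣ ∸ 1))
    ifNone  : deficientVertices K ≡ [] → Recip r (2 * ∣V∣)
    ifTwo   : 2 ≤ length (deficientVertices K) → Recip r 8

n≤2[n∸1] : ∀ {n} → 2 ≤ n → n ≤ 2 * (n ∸ 1)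
n≤2[n∸1] {suc zero}    (s≤s ())
n≤2[n∸1] {suc (suc n)} _ = s≤s (ℕ.≤-trans (ℕ.m≤n+m (suc n) n) (ℕ.+-monoʳ-≤ n (ℕ.m≤m+n (suc n) 0)))

-- Lower bounds for the perturbation f

module Perturbation (G : Graph) (k : ℕ) (side : Fin (Graph.∣V∣ G) → Bool)
  (bipartite : ∀ e → side (Graph.src G e) ≢ side (Graph.tgt G e)) (2≤n : 2 ≤ Graph.∣V∣ G)
  (c c′ : Fin k) (c≢c′ : c ≢ c′) (K : Chain.EdgeMap G k) (tame : Coloring.TwoColors.Tame G k c c′ c≢c′ K)
  (deficient≤2 : length (Chain.deficientVertices G k K) ≤ 2)
  where

  open Graph G
  open Chain G k
  open Coloring G k
  open Prolongation G k
  open Branching G k K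
  open TwoColors c c′ c≢c′

  1≤n∸1 : 1 ≤ n ∸ 1
  1≤n∸1 = ℕ.∸-monoˡ-≤ 1 2≤n

  recip-½ : Recip ½ 2
  recip-½ = recip-1/suc 1

  -- The deficiency at `v` disappears, and only the other end of the recolored edge can become
  -- deficient; in the count it takes the place of `v`.
  flipEdge-deficient : ∀ {v} (d : Doubled K v) →
    length (deficientVertices (flip c c′ ⁅ Doubled.e d ⁆ K)) ≤ length (deficientVertices K)
  flipEdge-deficient {v} d = length-≤-via {R = Key} (deficientVertices-unique K′) key inj
    where
    e : Edge
    e = Doubled.e d
    K′ : EdgeMap
    K′ = flip c c′ ⁅ e ⁆ K

    Key : Vertex → Vertex → Set
    Key z u = (z ≡ u × u ≢ v) ⊎ (z ≡ opposite e v × u ≡ v)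

    inj : ∀ {z z′ u} → z ∈ deficientVertices K′ → z′ ∈ deficientVertices K′ → Key z u → Key z′ u → z ≡ z′
    inj _ _ (inj₁ (p , _)) (inj₁ (q , _)) = trans p (sym q)
    inj _ _ (inj₂ (p , _)) (inj₂ (q , _)) = trans p (sym q)
    inj _ _ (inj₁ (_ , p)) (inj₂ (_ , q)) = contradiction q p
    inj _ _ (inj₂ (_ , p)) (inj₁ (_ , q)) = contradiction p q

    away : ∀ {z h} → z ≢ v → z ≢ opposite e v → Incident h z → h ∉ₛ ⁅ e ⁆
    away z≢v z≢w i h∈ with refl ← x∈⁅y⁆⇒x≡y e h∈ with incident-cases (Doubled.incident₁ d) i
    ... | inj₁ eq = z≢v eq
    ... | inj₂ eq = z≢w eq

    key : ∀ {z} → z ∈ deficientVertices K′ → ∃[ u ] u ∈ deficientVertices K × Key z u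
    key {z} z∈ = cases (z ≟ v) (z ≟ opposite e v)
      where
      d′ : Doubled K′ z
      d′ = deficient⇒doubled {K′} (∈-deficientVertices⁻ {K′} z∈)
      cases : Dec (z ≡ v) → Dec (z ≡ opposite e v) → ∃[ u ] u ∈ deficientVertices K × Key z u
      cases (yes refl) _ = contradiction d′ (flip-resolves tame d (x∈⁅x⁆ e)
        λ f∈ → Doubled.different d (sym (x∈⁅y⁆⇒x≡y e f∈)))
      cases (no _) (yes z≡w) = v , ∈-deficientVertices⁺ {K} (doubled⇒deficient tame d) , inj₂ (z≡w , refl)
      cases (no z≢v) (no z≢w) = z , ∈-deficientVertices⁺ {K} (doubled⇒deficient tame
        (flip-keeps-doubled tame ⁅ e ⁆ (λ i i′ _ _ → trans (∉⇒lookup (away z≢v z≢w i)) (sym (∉⇒lookup (away z≢v z≢w i′)))) d′)) ,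
        inj₁ (refl , z≢v)

  H : EdgeSet
  H = twoColored c c′ K

  recolorAny : Dist EdgeMap
  recolorAny = choose (filter (_∈? H) (allFin m)) (pure K) λ e → pure (flip c c′ ⁅ e ⁆ K)

  recolorAt : Vertex → Dist EdgeMap
  recolorAt v = choose (doubledEdges K v) (pure K) λ e → pure (flip c c′ ⁅ e ⁆ K)

  perturb₂-cases : ∀ {r K′} → (r , K′) ∈ perturb₂ c c′ K →
    (deficientVertices K ≡ [] × (r , K′) ∈ mix ((½ , recolorAny) ∷ (½ , pure K) ∷ [])) ⊎
    (1 ≤ length (deficientVertices K) × (r , K′) ∈ choose (deficientVertices K) (pure K) recolorAt)
  perturb₂-cases K′∈ with deficientVertices K
  ... | []    = inj₁ (refl , K′∈)
  ... | _ ∷ _ = inj₂ (s≤s z≤n , K′∈)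

  Outcome₂ : ℕ → ℚ → EdgeMap → Set
  Outcome₂ N r K′ = Recip r N × Tame K′ × length (deficientVertices K′) ≤ 2

  unchanged : ∀ {K′} → K′ ≡ K → Tame K′ × length (deficientVertices K′) ≤ 2
  unchanged refl = tame , deficient≤2

  recolorAt⁻ : ∀ {v r K′} → (r , K′) ∈ recolorAt v → Outcome₂ 2 r K′
  recolorAt⁻ {v} {r} {K′} K′∈ =
    [ (λ (K′≡ , bd) → bd (s≤s z≤n) , unchanged K′≡) , (λ (e , e∈ , K′≡ , bd) → bd (doubledEdges-≤2 tame) , recolored (∈-doubledEdges⁻ tame e∈) K′≡) ]′
      (∈-choose-pure⁻ (doubledEdges K v) {K} {λ e → flip c c′ ⁅ e ⁆ K} K′∈)
    where
    recolored : ∀ {e} → ∃[ d ] Doubled.e {K} {v} d ≡ e → K′ ≡ flip c c′ ⁅ e ⁆ K → Tame K′ × length (deficientVertices K′) ≤ 2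
    recolored (d , refl) refl = flip-tame ⁅ Doubled.e d ⁆ tame , ℕ.≤-trans (flipEdge-deficient d) deficient≤2

  recolorAny⁻ : ∀ {r K′} → IsColoring K → (r , K′) ∈ recolorAny → Outcome₂ n r K′
  recolorAny⁻ {r} {K′} coloring K′∈ =
    [ (λ (K′≡ , bd) → bd (ℕ.≤-trans (s≤s z≤n) 2≤n) , unchanged K′≡)
    , (λ (e , _ , K′≡ , bd) → bd (Alternating.Walks.length-twoColored G k side bipartite c c′ c≢c′ K coloring) , recolored e K′≡) ]′
      (∈-choose-pure⁻ (filter (_∈? H) (allFin m)) {K} {λ e → flip c c′ ⁅ e ⁆ K} K′∈)
    where
    away : ∀ {e z h} → z ≢ src e → z ≢ tgt e → Incident h z → h ∉ₛ ⁅ e ⁆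
    away {e} z≢s z≢t i h∈ with refl ← x∈⁅y⁆⇒x≡y e h∈ = [ z≢s ∘ sym , z≢t ∘ sym ]′ i

    recolored : ∀ e → K′ ≡ flip c c′ ⁅ e ⁆ K → Tame K′ × length (deficientVertices K′) ≤ 2
    recolored e refl = flip-tame ⁅ e ⁆ tame ,
      Flipping.evenExcept⇒deficient-≤2 G k side bipartite c c′ c≢c′ K coloring {⁅ e ⁆} (src e) (tgt e)
        (λ z≢s z≢t i i′ _ _ → trans (∉⇒lookup (away z≢s z≢t i)) (sym (∉⇒lookup (away z≢s z≢t i′))))

  perturb₂⁻ : ∀ {r K′} → (r , K′) ∈ perturb₂ c c′ K → Outcome₂ (4 * (n ∸ 1)) r K′
  perturb₂⁻ {r} {K′} K′∈ = [ whenNone , whenSome ]′ (perturb₂-cases K′∈)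
    where
    -- Without deficient vertices: a factor 2 for recoloring at all, and at most n edges.
    2n≤ : 2 * n ≤ 4 * (n ∸ 1)
    2n≤ = ℕ.≤-trans (ℕ.*-monoʳ-≤ 2 (n≤2[n∸1] 2≤n)) (ℕ.≤-reflexive (sym (ℕ.*-assoc 2 2 (n ∸ 1))))
    -- Otherwise at most two deficient vertices, with two edges at each.
    4≤ : 4 ≤ 4 * (n ∸ 1)
    4≤ = ℕ.*-monoʳ-≤ 4 1≤n∸1

    whenSome : 1 ≤ length (deficientVertices K) × (r , K′) ∈ choose (deficientVertices K) (pure K) recolorAt →
               Outcome₂ (4 * (n ∸ 1)) r K′
    whenSome (1≤ , K′∈) =
      let v , _ , _ , K′∈′ , bd = ∈-choose⁻-∈ {xs = deficientVertices K} {d = pure K} {f = recolorAt} (proj₂ (0<length⇒∈ 1≤)) K′∈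
          rec , rest = recolorAt⁻ {v} K′∈′
      in recip-mono 4≤ (bd deficient≤2 rec) , rest

    whenNone : deficientVertices K ≡ [] × (r , K′) ∈ mix ((½ , recolorAny) ∷ (½ , pure K) ∷ []) → Outcome₂ (4 * (n ∸ 1)) r K′
    whenNone (none , K′∈) = mix₂-elim {p₁ = ½} {½} {recolorAny} {pure K} (λ r → Outcome₂ (4 * (n ∸ 1)) r K′)
      (λ {q} K′∈ → let rec , rest = recolorAny⁻ (none⇒coloring tame none) K′∈ in recip-mono 2n≤ (recip-* recip-½ rec) , rest)
      (λ {q} K′∈ → let q≡ , K′≡ = ∈-pure⁻ K′∈ in
         recip-mono (ℕ.≤-trans (s≤s (s≤s z≤n)) 4≤) (recip-* recip-½ (subst (λ q → Recip q 1) (sym q≡) recip-1)) , unchanged K′≡)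
      K′∈

  module _ (c″ : Color) where

    open ThreeColors G k c c′ c″ K

    nextEdges-≤1 : ∀ {X z x} → ¬ Deficient K z → length (nextEdges K X z x) ≤ 1
    nextEdges-≤1 {X} {z} {x} ¬def = ℕ.≤-trans (length-filter (λ e → ¬? (e ∈? X)) (edgesAt K z x)) (¬deficient⇒edgesAt-≤1 tame ¬def)

    -- In a tame map at most one color is repeated at `w₀`, and it is carried by two edges only.
    almostSafe : ∀ {X T w₀} → (∀ {z} x → z ≢ w₀ → Closed X T z x) → AlmostSafe X T w₀
    almostSafe {X} {T} {w₀} elsewhere = record
      { elsewhere = elsewhere
      ; one-color = λ x≢y → one-color x≢y
      ; at-most-2 = λ x → ℕ.≤-trans (length-filter (λ e → ¬? (e ∈? X)) (edgesAt K w₀ x)) (edgesAt-≤2 tame {w₀}) }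
      where
      one-color : ∀ {x y} → x ≢ y → length (nextEdges K X w₀ x) ≤ 1 ⊎ length (nextEdges K X w₀ y) ≤ 1
      one-color {x} {y} x≢y with length (edgesAt K w₀ x) ℕ.≤? 1
      ... | yes ≤1 = inj₁ (ℕ.≤-trans (length-filter (λ e → ¬? (e ∈? X)) (edgesAt K w₀ x)) ≤1)
      ... | no ¬≤1 with d , refl ← 2≤edgesAt⇒doubled {K} {w₀} {x} (ℕ.≰⇒> ¬≤1) =
        inj₂ (ℕ.≤-trans (length-filter (λ e → ¬? (e ∈? X)) (edgesAt K w₀ y)) (edgesAt-≤1-other tame d (x≢y ∘ sym)))

    -- The trail is prolonged at both ends, yet only one factor 2 arises: after a branching in the
    -- first prolongation the trail contains one of the two edges at `w₀`, and the second one cannot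
    -- branch.
    twoProlongations : ∀ {v e w₀ r K′} → AlmostSafe ∅ ⁅ e ⁆ w₀ → (r , K′) ∈ atDeficientEdge v e → Recip r 2
    twoProlongations {v} {e} {w₀} {r} {K′} as K′∈ = first
      (∈->>=⁻ {d = prolong m K ∅ ⁅ e ⁆ (opposite e v) c″ (lookup K e)} {f = flipThrough v e} K′∈)
      where
      second : ∀ {T q} → (q , K′) ∈ flipThrough v e T → (AlmostSafe ∅ T w₀ → Recip q 2) × (Safe ∅ T → Recip q 1)
      second {T} {q} K′∈ =
        let p , T′ , q′ , T′∈ , K′∈′ , q≡ = ∈->>=⁻ {d = prolong m K ∅ T v c″ (lookup K e)} {f = λ T′ → pure (flip (lookup K e) c″ T′ K)} K′∈
            q≡p*1 = trans q≡ (cong (p ℚ.*_) (proj₁ (∈-pure⁻ K′∈′)))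
        in (λ as → subst (λ q → Recip q 2) (sym q≡p*1)
              ([ (λ (rec , _) → recip-mono (s≤s z≤n) (recip-* rec recip-1)) , (λ (rec , _) → recip-* rec recip-1) ]′
                (prolong-almostSafe m as T′∈))) ,
           (λ safe → subst (λ q → Recip q 1) (sym q≡p*1) (recip-* (proj₁ (prolong-safe m safe T′∈)) recip-1))

      first : (∃[ p ] ∃[ T ] ∃[ q ] (p , T) ∈ prolong m K ∅ ⁅ e ⁆ (opposite e v) c″ (lookup K e) ×
                (q , K′) ∈ flipThrough v e T × r ≡ p ℚ.* q) → Recip r 2
      first (p , T , q , T∈ , K′∈′ , r≡) = subst (λ r → Recip r 2) (sym r≡)
        ([ (λ (rec , T⊆) → recip-* rec (proj₁ (second K′∈′) (almostSafe-mono T⊆ as))) , (λ (rec , safe) → recip-* rec (proj₂ (second K′∈′) safe)) ]′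
          (prolong-almostSafe m as T∈))

    -- At v the repeated color is that of the starting edge, which already lies in the trail. So
    -- only the other deficient vertex, if there is one, remains for branching.
    atDeficient-safe : ∀ {v w₀} → (∀ {z} → z ∈ deficientVertices K → z ≡ v ⊎ z ≡ w₀) → (d : Doubled K v) →
                       AlmostSafe ∅ ⁅ Doubled.e d ⁆ w₀
    atDeficient-safe {v} {w₀} others d = almostSafe {w₀ = w₀} λ {z} x z≢w₀ → closed x z≢w₀ (z ≟ v) (x ≟ lookup K (Doubled.e d))
      where
      closed : ∀ {z} x → z ≢ w₀ → Dec (z ≡ v) → Dec (x ≡ lookup K (Doubled.e d)) → Closed ∅ ⁅ Doubled.e d ⁆ z x
      closed x _ (yes refl) (yes refl) =
        inj₂ (lose (∈-filter⁺ (λ e → ¬? (e ∈? ∅)) (∈-edgesAt⁺ {K} (Doubled.incident₁ d) refl) ∉⊥) (x∈⁅x⁆ (Doubled.e d)))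
      closed x _ (yes refl) (no x≢a) =
        inj₁ (ℕ.≤-trans (length-filter (λ e → ¬? (e ∈? ∅)) (edgesAt K v x)) (edgesAt-≤1-other tame d x≢a))
      closed x z≢w₀ (no z≢v) _ = inj₁ (nextEdges-≤1 λ def → [ z≢v , z≢w₀ ]′ (others (∈-deficientVertices⁺ {K} def)))

    atDeficient⁻ : ∀ {v r K′} → v ∈ deficientVertices K → (r , K′) ∈ atDeficient v → Recip r 4
    atDeficient⁻ {v} {r} {K′} v∈ K′∈ =
      choose-recip {xs = doubledEdges K v} {x = K} {f = atDeficientEdge v} 2 2 (doubledEdges-≤2 tame) (s≤s z≤n)
        (λ e∈ K′∈′ → each (∈-doubledEdges⁻ tame e∈) K′∈′) K′∈
      where
      each : ∀ {e q} → ∃[ d ] Doubled.e {K} {v} d ≡ e → (q , K′) ∈ atDeficientEdge v e → Recip q 2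
      each (d , refl) K′∈′ = twoProlongations (atDeficient-safe (proj₂ (among-two deficient≤2 v∈)) d) K′∈′

    companions-≤2 : ∀ {v} → ¬ Deficient K v → length (companions v) ≤ 2
    companions-≤2 {v} ¬def = subst (_≤ 2) (sym (length-++ (edgesAt K v c)))
      (ℕ.+-mono-≤ (¬deficient⇒edgesAt-≤1 tame {v} {c} ¬def) (¬deficient⇒edgesAt-≤1 tame {v} {c′} ¬def))

    -- The factors are `M` for the vertex, 1 for its only edge of color `c″`, 2 for the edge not to
    -- be passed, and `N` for the prolongation.
    nondeficient⁻ : ∀ {N M r K′} → 1 ≤ N → length candidates ≤ M → 1 ≤ M →
      (∀ {v e f q T} → (q , T) ∈ prolong m K ⁅ f ⁆ ⁅ e ⁆ (opposite e v) (lookup K f) c″ → Recip q N) →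
      (r , K′) ∈ nondeficient → Recip r (M * (2 * N))
    nondeficient⁻ {N} {M} {_} {K′} 1≤N len 1≤M bound = choose-recip {xs = candidates} {x = K} {f = atNondeficient} M (2 * N) len
      (ℕ.*-mono-≤ 1≤M 1≤2N) λ {v} v∈ K′∈ →
      let ¬def , _ = proj₂ (∈-filter⁻ candidate? {xs = allFin n} v∈) in
      subst (Recip _) (ℕ.*-identityˡ (2 * N))
        (choose-recip {xs = edgesAt K v c″} {x = K} {f = atNondeficientEdge v} 1 (2 * N) (¬deficient⇒edgesAt-≤1 tame ¬def)
          (subst (1 ≤_) (sym (ℕ.*-identityˡ (2 * N))) 1≤2N)
          (λ {e} _ K′∈′ → choose-recip {xs = companions v} {x = K} {f = flipBeyond v e} 2 N (companions-≤2 ¬def) 1≤2N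
            (λ {f} _ K′∈″ → prolonged {v} {e} {f} (∈->>=⁻ {d = prolong m K ⁅ f ⁆ ⁅ e ⁆ (opposite e v) (lookup K f) c″}
              {f = λ T → pure (flip (lookup K f) c″ T K)} K′∈″)) K′∈′) K′∈)
      where
      1≤2N : 1 ≤ 2 * N
      1≤2N = ℕ.*-mono-≤ {1} {2} (s≤s z≤n) 1≤N
      prolonged : ∀ {v e f q} → (∃[ p ] ∃[ T ] ∃[ q′ ] (p , T) ∈ prolong m K ⁅ f ⁆ ⁅ e ⁆ (opposite e v) (lookup K f) c″ ×
                    (q′ , K′) ∈ pure (flip (lookup K f) c″ T K) × q ≡ p ℚ.* q′) → Recip q N
      prolonged {q = q} (p , T , q′ , T∈ , K′∈ , q≡) = subst (λ q → Recip q N) (sym (trans q≡ (cong (p ℚ.*_) (proj₁ (∈-pure⁻ K′∈)))))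
        (subst (Recip (p ℚ.* 1ℚ)) (ℕ.*-identityʳ N) (recip-* (bound T∈) recip-1))

    private
      8≤ : 8 ≤ 8 * (n ∸ 1)
      8≤ = ℕ.*-monoʳ-≤ 8 1≤n∸1

      2n≤8[n∸1] : 2 * n ≤ 8 * (n ∸ 1)
      2n≤8[n∸1] = ℕ.≤-trans (ℕ.*-monoʳ-≤ 2 (n≤2[n∸1] 2≤n))
        (ℕ.≤-trans (ℕ.≤-reflexive (sym (ℕ.*-assoc 2 2 (n ∸ 1)))) (ℕ.*-monoˡ-≤ (n ∸ 1) {4} {8} (s≤s (s≤s (s≤s (s≤s z≤n))))))

      candidates-≤n : length candidates ≤ n
      candidates-≤n = ℕ.≤-trans (length-filter candidate? (allFin n)) (ℕ.≤-reflexive (length-allFin n))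

      -- The deficient vertex is itself no candidate. This is where n - 1, rather than n, enters
      -- with three colors.
      candidates-≤n∸1 : ∀ {v} → Deficient K v → length candidates ≤ n ∸ 1
      candidates-≤n∸1 {v} def = ℕ.∸-monoˡ-≤ 1 (subst (length candidates <_) (length-allFin n)
        (filter-notAll candidate? (allFin n) (lose (∈-allFin v) λ (¬def , _) → ¬def def)))

      commute : ∀ p → 2 * (p * 4) ≡ 8 * p
      commute = solve-∀

    perturb₃-none : ∀ {r K′} → deficientVertices K ≡ [] → (r , K′) ∈ nondeficient → Recip r (2 * n)
    perturb₃-none {r} none K′∈ = subst (Recip r) (ℕ.*-comm n 2)
      (nondeficient⁻ {1} {n} (s≤s z≤n) candidates-≤n (ℕ.≤-trans (s≤s z≤n) 2≤n)
        (λ {_} {_} {f} T∈ → proj₁ (prolong-safe m {X = ⁅ f ⁆} (λ z x → inj₁ (nextEdges-≤1 (¬def z))) T∈)) K′∈)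
      where
      ¬def : ∀ z → ¬ Deficient K z
      ¬def z def with () ← subst (z ∈_) none (∈-deficientVertices⁺ {K} def)

    perturb₃-one : ∀ {v r K′} → deficientVertices K ≡ v ∷ [] →
      (r , K′) ∈ mix ((½ , atDeficient v) ∷ (½ , nondeficient) ∷ []) → Recip r (8 * (n ∸ 1))
    perturb₃-one {v} one = mix₂-elim {p₁ = ½} {½} {atDeficient v} {nondeficient} (λ r → Recip r (8 * (n ∸ 1)))
      (λ K′∈ → recip-mono 8≤ (recip-* recip-½ (atDeficient⁻ (subst (v ∈_) (sym one) (here refl)) K′∈)))
      -- One half for this alternative, 1/(n - 1) for the vertex, one half for the edge not to be
      -- passed and one half for a branching at `v`.
      (λ {q} K′∈ → subst (Recip (½ ℚ.* q)) (commute (n ∸ 1)) (recip-* recip-½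
        (nondeficient⁻ {2} {n ∸ 1} (s≤s z≤n) (candidates-≤n∸1 def) 1≤n∸1
          (λ {_} {_} {f} T∈ → [ (λ (rec , _) → recip-mono (s≤s z≤n) rec) , proj₁ ]′
             (prolong-almostSafe m {X = ⁅ f ⁆} (almostSafe {w₀ = v} (λ x z≢v → inj₁ (nextEdges-≤1 (z≢v ∘ only)))) T∈)) K′∈)))
      where
      def : Deficient K v
      def = ∈-deficientVertices⁻ {K} (subst (v ∈_) (sym one) (here refl))
      only : ∀ {z} → Deficient K z → z ≡ v
      only {z} def = single (subst (z ∈_) one (∈-deficientVertices⁺ {K} def))
        where
        single : z ∈ v ∷ [] → z ≡ v
        single (here eq) = eq

    perturb₃⁻ : ∀ {r K′} → (r , K′) ∈ perturb₃ c c′ c″ K → Outcome₃ G k K r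
    perturb₃⁻ {r} {K′} K′∈ = cases (perturb₃-cases K′∈)
      where
      cases : (deficientVertices K ≡ [] × (r , K′) ∈ nondeficient) ⊎
        (∃[ v ] deficientVertices K ≡ v ∷ [] × (r , K′) ∈ mix ((½ , atDeficient v) ∷ (½ , nondeficient) ∷ [])) ⊎
        (2 ≤ length (deficientVertices K) × (r , K′) ∈ choose (deficientVertices K) (pure K) atDeficient) → Outcome₃ G k K r
      cases (inj₁ (none , K′∈)) = record
        { general = recip-mono 2n≤8[n∸1] (perturb₃-none none K′∈)
        ; ifNone = λ _ → perturb₃-none none K′∈
        ; ifTwo = λ 2≤ → contradiction (subst (λ vs → 2 ≤ length vs) none 2≤) λ () }
      cases (inj₂ (inj₁ (v , one , K′∈))) = record
        { general = perturb₃-one one K′∈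
        ; ifNone = λ none → contradiction (trans (sym one) none) λ ()
        ; ifTwo = λ 2≤ → contradiction (subst (λ vs → 2 ≤ length vs) one 2≤) λ { (s≤s ()) } }
      cases (inj₂ (inj₂ (2≤ , K′∈))) = record
        { general = recip-mono 8≤ bound
        ; ifNone = λ none → contradiction (subst (λ vs → 2 ≤ length vs) none 2≤) λ ()
        ; ifTwo = λ _ → bound }
        where
        bound : Recip r 8
        bound = choose-recip {xs = deficientVertices K} {x = K} {f = atDeficient} 2 4 deficient≤2 (s≤s z≤n) (λ v∈ → atDeficient⁻ v∈) K′∈

-- Comparing two experiments term by term

module _ {A : Set} where

  private
    0≤⅓ : 0ℚ ℚ.≤ + 1 / 3
    0≤⅓ = 1/suc≥0 2
    0≤½ : 0ℚ ℚ.≤ ½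
    0≤½ = 1/suc≥0 1

  thirds-sub : {d₁ d₂ d₃ : Dist A} → SubProbability d₁ → SubProbability d₂ → SubProbability d₃ →
               SubProbability (mix ((+ 1 / 3 , d₁) ∷ (+ 1 / 3 , d₂) ∷ (+ 1 / 3 , d₃) ∷ []))
  thirds-sub s₁ s₂ s₃ = mix-sub (0≤⅓ ∷ 0≤⅓ ∷ 0≤⅓ ∷ []) ℚ.≤-refl (s₁ ∷ s₂ ∷ s₃ ∷ [])

  halves-sub : {d₁ d₂ : Dist A} → SubProbability d₁ → SubProbability d₂ →
               SubProbability (mix ((½ , d₁) ∷ (½ , d₂) ∷ []))
  halves-sub s₁ s₂ = mix-sub (0≤½ ∷ 0≤½ ∷ []) ℚ.≤-refl (s₁ ∷ s₂ ∷ [])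

module _ {A : Set} {Q R : A → Set} (Q? : ∀ x → Dec (Q x)) (R? : ∀ x → Dec (R x)) (b : ℚ) where

  -- Written as a product so that it passes through mixtures with equal coefficients. The colors are
  -- drawn alike from both states, so their probabilities cancel and k does not enter the bound.
  record Dominated (d d′ : Dist A) : Set where
    constructor dominated
    field ≤* : prob Q? d ℚ.≤ prob R? d′ ℚ.* b

  dominated-mix-∷ : ∀ {p d d′} ds ds′ → 0ℚ ℚ.≤ p → Dominated d d′ → Dominated (mix ds) (mix ds′) →
                    Dominated (mix ((p , d) ∷ ds)) (mix ((p , d′) ∷ ds′))
  dominated-mix-∷ {p} {d} {d′} ds ds′ 0≤p (dominated dom) (dominated doms) = dominated (begin
    prob Q? (mix ((p , d) ∷ ds))                              ≡⟨ prob-mix-∷ Q? p d ds ⟩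
    p ℚ.* prob Q? d ℚ.+ prob Q? (mix ds)                      ≤⟨ ℚ.+-mono-≤ (ℚ.*-monoˡ-≤-nonNeg p {{ℚ.nonNegative 0≤p}} dom) doms ⟩
    p ℚ.* (prob R? d′ ℚ.* b) ℚ.+ prob R? (mix ds′) ℚ.* b      ≡⟨ cong (ℚ._+ prob R? (mix ds′) ℚ.* b) (ℚ.*-assoc p (prob R? d′) b) ⟨
    p ℚ.* prob R? d′ ℚ.* b ℚ.+ prob R? (mix ds′) ℚ.* b        ≡⟨ ℚ.*-distribʳ-+ b (p ℚ.* prob R? d′) (prob R? (mix ds′)) ⟨
    (p ℚ.* prob R? d′ ℚ.+ prob R? (mix ds′)) ℚ.* b            ≡⟨ cong (ℚ._* b) (prob-mix-∷ R? p d′ ds′) ⟨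
    prob R? (mix ((p , d′) ∷ ds′)) ℚ.* b                      ∎)
    where open ℚ.≤-Reasoning

  dominated-[] : Dominated (mix []) (mix [])
  dominated-[] = dominated (ℚ.≤-reflexive (sym (ℚ.*-zeroˡ b)))

  dominated-mix₃ : ∀ {p₁ p₂ p₃ d₁ d₂ d₃ e₁ e₂ e₃} → 0ℚ ℚ.≤ p₁ → 0ℚ ℚ.≤ p₂ → 0ℚ ℚ.≤ p₃ →
                   Dominated d₁ e₁ → Dominated d₂ e₂ → Dominated d₃ e₃ →
                   Dominated (mix ((p₁ , d₁) ∷ (p₂ , d₂) ∷ (p₃ , d₃) ∷ [])) (mix ((p₁ , e₁) ∷ (p₂ , e₂) ∷ (p₃ , e₃) ∷ []))
  dominated-mix₃ {p₁} {p₂} {p₃} {d₁} {d₂} {d₃} {e₁} {e₂} {e₃} 0≤p₁ 0≤p₂ 0≤p₃ dom₁ dom₂ dom₃ =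
    dominated-mix-∷ {p₁} {d₁} {e₁} ((p₂ , d₂) ∷ (p₃ , d₃) ∷ []) ((p₂ , e₂) ∷ (p₃ , e₃) ∷ []) 0≤p₁ dom₁
      (dominated-mix-∷ {p₂} {d₂} {e₂} ((p₃ , d₃) ∷ []) ((p₃ , e₃) ∷ []) 0≤p₂ dom₂
        (dominated-mix-∷ {p₃} {d₃} {e₃} [] [] 0≤p₃ dom₃ dominated-[]))

  dominated-choose : ∀ {B : Set} (xs : List B) {d d′ f f′} → Dominated d d′ → (∀ y → Dominated (f y) (f′ y)) →
                     Dominated (choose xs d f) (choose xs d′ f′)
  dominated-choose []       dom _ = dom
  dominated-choose (x ∷ xs) {f = f} {f′} _ doms = go (x ∷ xs)
    where
    w : ℚ
    w = + 1 / suc (length xs)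
    go : ∀ ys → Dominated (mix (map (λ y → (w , f y)) ys)) (mix (map (λ y → (w , f′ y)) ys))
    go []       = dominated-[]
    go (y ∷ ys) = dominated-mix-∷ {w} {f y} {f′ y} (map (λ y → (w , f y)) ys) (map (λ y → (w , f′ y)) ys) (1/suc≥0 (length xs)) (doms y) (go ys)

1/-≤ : ∀ a b (a⁺ : Positive a) → 1ℚ ℚ.≤ a ℚ.* b → (ℚ.1/ a) {{ℚ.pos⇒nonZero a {{a⁺}}}} ℚ.≤ b
1/-≤ a b a⁺ 1≤ab = begin
  a⁻¹                    ≡⟨ ℚ.*-identityʳ a⁻¹ ⟨
  a⁻¹ ℚ.* 1ℚ             ≤⟨ ℚ.*-monoˡ-≤-nonNeg a⁻¹ {{ℚ.pos⇒nonNeg a⁻¹ {{ℚ.1/pos⇒pos a {{a⁺}}}}}} 1≤ab ⟩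
  a⁻¹ ℚ.* (a ℚ.* b)      ≡⟨ ℚ.*-assoc a⁻¹ a b ⟨
  a⁻¹ ℚ.* a ℚ.* b        ≡⟨ cong (ℚ._* b) (ℚ.*-inverseˡ a {{ℚ.pos⇒nonZero a {{a⁺}}}}) ⟩
  1ℚ ℚ.* b               ≡⟨ ℚ.*-identityˡ b ⟩
  b                      ∎
  where
  open ℚ.≤-Reasoning
  a⁻¹ = (ℚ.1/ a) {{ℚ.pos⇒nonZero a {{a⁺}}}}

÷-≥1 : ∀ a a′ b (a⁺ : Positive a) → a ℚ.≤ a′ ℚ.* b → 1ℚ ℚ.≤ (ℚ._÷_ a′ a {{ℚ.pos⇒nonZero a {{a⁺}}}}) ℚ.* b
÷-≥1 a a′ b a⁺ a≤ = begin
  1ℚ                     ≡⟨ ℚ.*-inverseˡ a {{ℚ.pos⇒nonZero a {{a⁺}}}} ⟨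
  a⁻¹ ℚ.* a              ≤⟨ ℚ.*-monoˡ-≤-nonNeg a⁻¹ {{ℚ.pos⇒nonNeg a⁻¹ {{ℚ.1/pos⇒pos a {{a⁺}}}}}} a≤ ⟩
  a⁻¹ ℚ.* (a′ ℚ.* b)     ≡⟨ ℚ.*-assoc a⁻¹ a′ b ⟨
  a⁻¹ ℚ.* a′ ℚ.* b       ≡⟨ cong (ℚ._* b) (ℚ.*-comm a⁻¹ a′) ⟩
  a′ ℚ.* a⁻¹ ℚ.* b       ∎
  where
  open ℚ.≤-Reasoning
  a⁻¹ = (ℚ.1/ a) {{ℚ.pos⇒nonZero a {{a⁺}}}}

1≤⊓* : ∀ q b → 1ℚ ℚ.≤ b → 1ℚ ℚ.≤ q ℚ.* b → 1ℚ ℚ.≤ (1ℚ ℚ.⊓ q) ℚ.* b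
1≤⊓* q b 1≤b 1≤qb with ℚ.⊓-sel 1ℚ q
... | inj₁ eq = subst (λ a → 1ℚ ℚ.≤ a ℚ.* b) (sym eq) (ℚ.≤-trans 1≤b (ℚ.≤-reflexive (sym (ℚ.*-identityˡ b))))
... | inj₂ eq = subst (λ a → 1ℚ ℚ.≤ a ℚ.* b) (sym eq) 1≤qb

-- One step of the chain

module Step (G : Graph) (k : ℕ) where

  open Graph G
  open Chain G k
  open Coloring G k using (n; m)

  prolong-sub : ∀ t K X T w x y → SubProbability (prolong t K X T w x y)
  prolong-sub zero    K X T w x y = pure-sub T
  prolong-sub (suc t) K X T w x y with filter (λ e → ¬? (e ∈? X)) (edgesAt K w x)
  ... | next with Any.any? (_∈? T) next
  ...   | yes _ = pure-sub T
  ...   | no  _ = choose-sub next (pure-sub T) λ e → prolong-sub t K X (T ∪ ⁅ e ⁆) (opposite e w) y x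

  eliminateAt-sub : ∀ s K v → SubProbability (eliminateAt s K v)
  eliminateAt-sub s K v = choose-sub (doubledEdges K v) (pure-sub K) λ e →
    choose-sub (partners s K v (lookup K e)) (pure-sub K) λ b →
    >>=-sub (prolong-sub m K ∅ ⁅ e ⁆ (opposite e v) b (lookup K e)) λ T → pure-sub (flip (lookup K e) b T K)

  eliminate-sub : ∀ t s K → SubProbability (eliminate t s K)
  eliminate-sub zero    s K = pure-sub K
  eliminate-sub (suc t) s K with deficientVertices K
  ... | []    = pure-sub K
  ... | v ∷ _ = >>=-sub (eliminateAt-sub s K v) (eliminate-sub t s)

  flipSelected-sub : ∀ s C → SubProbability (flipSelected s C)
  flipSelected-sub (Selection.two c c′) C = let H = twoColored c c′ C in
    thirds-sub (pure-sub C)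
      (choose-sub (subPaths H ++ cycles H) (pure-sub C) λ S → pure-sub (flip c c′ S C))
      (choose-sub (pairs (filter (oneOuterEnd? H) (subPaths H))) (pure-sub C) λ (S , S′) → pure-sub (flip c c′ S′ (flip c c′ S C)))
  flipSelected-sub (three c c′ _) C = let H = twoColored c c′ C in
    thirds-sub (pure-sub C)
      (choose-sub (filter (hasInnerEnd? H) (subPaths H)) (pure-sub C) λ S → pure-sub (flip c c′ S C))
      (choose-sub (pairs (filter (oneOuterEnd? H) (subPaths H))) (pure-sub C) λ (S , S′) → pure-sub (flip c c′ S′ (flip c c′ S C)))

  perturb₂-sub : ∀ c c′ K → SubProbability (perturb₂ c c′ K)
  perturb₂-sub c c′ K with deficientVertices K
  ... | []           = halves-sub
    (choose-sub (filter (_∈? twoColored c c′ K) (allFin m)) (pure-sub K) λ e → pure-sub (flip c c′ ⁅ e ⁆ K))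
    (pure-sub K)
  ... | vs@(_ ∷ _)   = choose-sub vs (pure-sub K) λ v → choose-sub (doubledEdges K v) (pure-sub K) λ e → pure-sub (flip c c′ ⁅ e ⁆ K)

  module _ (c c′ c″ : Color) (K : EdgeMap) where
    open ThreeColors G k c c′ c″ K

    atDeficient-sub : ∀ v → SubProbability (atDeficient v)
    atDeficient-sub v = choose-sub (doubledEdges K v) (pure-sub K) λ e →
      >>=-sub (prolong-sub m K ∅ ⁅ e ⁆ (opposite e v) c″ (lookup K e)) λ T →
      >>=-sub (prolong-sub m K ∅ T v c″ (lookup K e)) λ T′ → pure-sub (flip (lookup K e) c″ T′ K)

    nondeficient-sub : SubProbability nondeficient
    nondeficient-sub = choose-sub candidates (pure-sub K) λ v →
      choose-sub (edgesAt K v c″) (pure-sub K) λ e → choose-sub (companions v) (pure-sub K) λ f →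
      >>=-sub (prolong-sub m K ⁅ f ⁆ ⁅ e ⁆ (opposite e v) (lookup K f) c″) λ T → pure-sub (flip (lookup K f) c″ T K)

    perturb₃-sub : SubProbability (perturb₃ c c′ c″ K)
    perturb₃-sub with deficientVertices K
    ... | []             = nondeficient-sub
    ... | v ∷ []         = halves-sub (atDeficient-sub v) nondeficient-sub
    ... | vs@(_ ∷ _ ∷ _) = choose-sub vs (pure-sub K) atDeficient-sub

  perturb-sub : ∀ s K → SubProbability (perturb s K)
  perturb-sub (Selection.two c c′) = perturb₂-sub c c′
  perturb-sub (three c c′ c″)      = perturb₃-sub c c′ c″

  finish : Selection → (K₁ K₂ : EdgeMap) → Dist (Way × EdgeMap)
  finish s K₁ K₂ = eliminate n s K₂ >>= λ C′ → pure (via s K₁ K₂ , C′)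

  continue : Selection → EdgeMap → Dist (Way × EdgeMap)
  continue s K₁ = perturb s K₁ >>= finish s K₁

  transform-sub : ∀ C s → SubProbability (transform C s)
  transform-sub C s = >>=-sub (flipSelected-sub s C) λ K₁ → >>=-sub (perturb-sub s K₁) λ K₂ →
    >>=-sub (eliminate-sub n s K₂) λ C′ → pure-sub (via s K₁ K₂ , C′)

  record Run (C : EdgeMap) (s : Selection) (K₁ K₂ C′ : EdgeMap) (r : ℚ) : Set where
    field
      {p₁ p₂ p₃} : ℚ
      flipped    : (p₁ , K₁) ∈ flipSelected s C
      perturbed  : (p₂ , K₂) ∈ perturb s K₁
      eliminated : (p₃ , C′) ∈ eliminate n s K₂
      -- The last factor is the weight of the `pure` that records the way; it reappears as `4 * 1`
      -- in the arithmetic of the bound.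
      weight     : r ≡ p₁ ℚ.* (p₂ ℚ.* (p₃ ℚ.* 1ℚ))

  transform⁻ : ∀ {C s r x} → (r , x) ∈ transform C s →
               ∃[ K₁ ] ∃[ K₂ ] ∃[ C′ ] Run C s K₁ K₂ C′ r × x ≡ (via s K₁ K₂ , C′)
  transform⁻ {C} {s} {r} {x} x∈ =
    let p₁ , K₁ , q₁ , flipped , x∈₁ , r≡ = ∈->>=⁻ {d = flipSelected s C} {f = continue s} x∈
        p₂ , K₂ , q₂ , perturbed , x∈₂ , q₁≡ = ∈->>=⁻ {d = perturb s K₁} {f = finish s K₁} x∈₁
        p₃ , C′ , q₃ , eliminated , x∈₃ , q₂≡ = ∈->>=⁻ {d = eliminate n s K₂} {f = λ C′ → pure (via s K₁ K₂ , C′)} x∈₂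
        q₃≡ , x≡ = ∈-pure⁻ x∈₃
    in K₁ , K₂ , C′ ,
       record { flipped = flipped ; perturbed = perturbed ; eliminated = eliminated
              ; weight = trans r≡ (cong (p₁ ℚ.*_) (trans q₁≡ (cong (p₂ ℚ.*_) (trans q₂≡ (cong (p₃ ℚ.*_) q₃≡))))) } , x≡

  data TwoSelected : Selection → Set where
    two   : ∀ {c c′} → c ≢ c′ → TwoSelected (Selection.two c c′)
    three : ∀ {c c′ c″} → c ≢ c′ → TwoSelected (Selection.three c c′ c″)

  selections₂⁻ : ∀ {s} → s ∈ selections₂ → TwoSelected s
  selections₂⁻ s∈ with (c , c′) , p∈ , refl ← ∈-map⁻ (λ (c , c′) → Selection.two c c′) s∈
                  with _ , _ , c≢c′ ← pairs⁻ (allFin⁺ k) p∈ = two c≢c′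

  selections₃⁻ : ∀ {s} → s ∈ selections₃ → TwoSelected s
  selections₃⁻ s∈
    with (a , b , d) , t∈ , s∈′ ← find (∈-concatMap⁻
           (λ (a , b , d) → Selection.three a b d ∷ three a d b ∷ three b d a ∷ []) {xs = triples (allFin k)} s∈)
    with a≢b , a≢d , b≢d ← triples⁻ (allFin⁺ k) t∈ with s∈′
  ... | here refl                 = three a≢b
  ... | there (here refl)         = three a≢d
  ... | there (there (here refl)) = three b≢d

  step⁻ : ∀ {C r x} → (r , x) ∈ step C →
          x ≡ (nothing , C) ⊎ (∃[ s ] ∃[ q ] TwoSelected s × (q , x) ∈ transform C s)
  step⁻ {C} {r} {x} = mix₃-elim {p₁ = ½} {+ 1 / 4} {+ 1 / 4}
    {stay C} {choose selections₂ (stay C) (transform C)} {choose selections₃ (stay C) (transform C)}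
    (λ _ → Result) (λ x∈ → inj₁ (proj₂ (∈-pure⁻ x∈))) (fromChoice selections₂⁻) (fromChoice selections₃⁻)
    where
    Result : Set
    Result = x ≡ (nothing , C) ⊎ (∃[ s ] ∃[ q ] TwoSelected s × (q , x) ∈ transform C s)

    fromChoice : ∀ {ss q} → (∀ {s} → s ∈ ss → TwoSelected s) → (q , x) ∈ choose ss (stay C) (transform C) → Result
    fromChoice {ss} sel x∈ =
      [ (λ (_ , x∈′) → inj₁ (proj₂ (∈-pure⁻ x∈′))) , (λ (s , q , s∈ , x∈′ , _) → inj₂ (s , q , sel s∈ , x∈′)) ]′
        (∈-choose⁻ {xs = ss} {d = stay C} {f = transform C} x∈)

  outcome? : ∀ w C (x : Way × EdgeMap) → Dec (x ≡ (w , C))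
  outcome? w C x = Product.≡-dec _≟ʷ_ _≟ᵐ_ x (w , C)

  isWay⇒entry : ∀ {C C′ w} → IsWay C C′ w → ∃[ r ] (r , (w , C′)) ∈ step C
  isWay⇒entry {C} {C′} {w} way with r , _ , x∈ , refl ← prob>0⇒entry (outcome? w C′) (step C) way = r , x∈

  isWay⇒run : ∀ {C C′ s K₁ K₂} → IsWay C C′ (via s K₁ K₂) →
    TwoSelected s × (∃[ r ] (r , (via s K₁ K₂ , C′)) ∈ transform C s × Run C s K₁ K₂ C′ r)
  isWay⇒run {C} {C′} {s} {K₁} {K₂} way = fromStep (step⁻ {C} (proj₂ (isWay⇒entry {C} {C′} {via s K₁ K₂} way)))
    where
    Result : Set
    Result = TwoSelected s × (∃[ r ] (r , (via s K₁ K₂ , C′)) ∈ transform C s × Run C s K₁ K₂ C′ r)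

    fromRun : ∀ {t q} → TwoSelected t → (q , (via s K₁ K₂ , C′)) ∈ transform C t →
              ∃[ L₁ ] ∃[ L₂ ] ∃[ D ] Run C t L₁ L₂ D q × (via s K₁ K₂ , C′) ≡ (via t L₁ L₂ , D) → Result
    fromRun sel x∈ (_ , _ , _ , run , refl) = sel , _ , x∈ , run

    fromStep : (via s K₁ K₂ , C′) ≡ (nothing , C) ⊎
               (∃[ t ] ∃[ q ] TwoSelected t × (q , (via s K₁ K₂ , C′)) ∈ transform C t) → Result
    fromStep (inj₂ (t , q , sel , x∈)) = fromRun sel x∈ (transform⁻ {C} {t} x∈)

  isWay-nothing : ∀ {C C′} → IsWay C C′ nothing → C′ ≡ C
  isWay-nothing {C} {C′} way = fromStep (step⁻ {C} (proj₂ (isWay⇒entry {C} {C′} {nothing} way)))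
    where
    noRun : ∀ {t q} → ∃[ L₁ ] ∃[ L₂ ] ∃[ D ] Run C t L₁ L₂ D q × (nothing , C′) ≡ (via t L₁ L₂ , D) → C′ ≡ C
    noRun (_ , _ , _ , _ , ())

    fromStep : (nothing , C′) ≡ (nothing , C) ⊎
               (∃[ t ] ∃[ q ] TwoSelected t × (q , (nothing , C′)) ∈ transform C t) → C′ ≡ C
    fromStep (inj₁ refl)               = refl
    fromStep (inj₂ (t , q , sel , x∈)) = noRun (transform⁻ {C} {t} x∈)

  -- Every selection of colors other than s contributes nothing on the left, so
  -- only s has to be compared, and no probability exceeds 1.
  way-dominated : ∀ {C₁ C₂ s K₁ K₂ L₁ L₂ r N} → (r , (via s L₁ L₂ , C₁)) ∈ transform C₂ s → Recip r N →
                  P⟨ C₂ , via s K₁ K₂ ∣ C₁ ⟩ ℚ.≤ P⟨ C₁ , via s L₁ L₂ ∣ C₂ ⟩ ℚ.* ι N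
  way-dominated {C₁} {C₂} {s} {K₁} {K₂} {L₁} {L₂} {r} {N} entry rec = Dominated.≤* steps
    where
    Q? = outcome? (via s K₁ K₂) C₂
    R? = outcome? (via s L₁ L₂) C₁
    b  = ι N

    impossible : ∀ d d′ → SubProbability d′ → (∀ {r x} → (r , x) ∈ d → x ≢ (via s K₁ K₂ , C₂)) → Dominated Q? R? b d d′
    impossible d d′ sub none = dominated (begin
      prob Q? d            ≡⟨ prob-none Q? d none ⟩
      0ℚ                   ≡⟨ ℚ.*-zeroˡ b ⟨
      0ℚ ℚ.* b             ≤⟨ ℚ.*-monoʳ-≤-nonNeg b {{ι-nonNegative N}} (prob≥0 R? {d′} (SubProbability.nonNeg sub)) ⟩
      prob R? d′ ℚ.* b     ∎)
      where open ℚ.≤-Reasoning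

    stays : Dominated Q? R? b (stay C₁) (stay C₂)
    stays = impossible (stay C₁) (stay C₂) (pure-sub (nothing , C₂)) λ { (here refl) () }

    certain : ∀ d d′ → SubProbability d → SubProbability d′ → (r , (via s L₁ L₂ , C₁)) ∈ d′ → Dominated Q? R? b d d′
    certain d d′ sub sub′ entry = dominated (begin
      prob Q? d            ≤⟨ prob≤mass Q? {d} (SubProbability.nonNeg sub) ⟩
      mass d               ≤⟨ SubProbability.mass≤1 sub ⟩
      1ℚ                   ≤⟨ Recip.1≤* rec ⟩
      r ℚ.* b              ≤⟨ ℚ.*-monoʳ-≤-nonNeg b {{ι-nonNegative N}} (entry≤prob R? {d′} (SubProbability.nonNeg sub′) entry refl) ⟩
      prob R? d′ ℚ.* b     ∎)
      where open ℚ.≤-Reasoning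

    -- A way records its selection of colors, so a different selection cannot produce it.
    otherSelection : ∀ {t r x} → t ≢ s → (r , x) ∈ transform C₁ t → x ≢ (via s K₁ K₂ , C₂)
    otherSelection {t} t≢s x∈ = distinguish (transform⁻ {C₁} {t} x∈)
      where
      distinguish : ∀ {r x} → ∃[ M₁ ] ∃[ M₂ ] ∃[ D ] Run C₁ t M₁ M₂ D r × x ≡ (via t M₁ M₂ , D) → x ≢ (via s K₁ K₂ , C₂)
      distinguish (_ , _ , _ , _ , refl) refl = t≢s refl

    transforms : ∀ t → Dominated Q? R? b (transform C₁ t) (transform C₂ t)
    transforms t with t ≟ˢ s
    ... | yes refl = certain (transform C₁ s) (transform C₂ s) (transform-sub C₁ s) (transform-sub C₂ s) entry
    ... | no t≢s   = impossible (transform C₁ t) (transform C₂ t) (transform-sub C₂ t) (otherSelection t≢s)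

    by₂ by₃ : EdgeMap → Dist (Way × EdgeMap)
    by₂ C = choose selections₂ (stay C) (transform C)
    by₃ C = choose selections₃ (stay C) (transform C)

    steps : Dominated Q? R? b (step C₁) (step C₂)
    steps = dominated-mix₃ Q? R? b {½} {+ 1 / 4} {+ 1 / 4} {stay C₁} {by₂ C₁} {by₃ C₁} {stay C₂} {by₂ C₂} {by₃ C₂}
      (1/suc≥0 1) (1/suc≥0 3) (1/suc≥0 3) stays
      (dominated-choose Q? R? b selections₂ {stay C₁} {stay C₂} {transform C₁} {transform C₂} stays transforms)
      (dominated-choose Q? R? b selections₃ {stay C₁} {stay C₂} {transform C₁} {transform C₂} stays transforms)

-- Assembling the constant 96

module Bound (G : Graph) (k : ℕ) (side : Fin (Graph.∣V∣ G) → Bool)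
  (bipartite : ∀ e → side (Graph.src G e) ≢ side (Graph.tgt G e)) (2≤n : 2 ≤ Graph.∣V∣ G)
  where

  open Graph G
  open Chain G k
  open Coloring G k using (n; module TwoColors)
  open Step G k

  bound : ℕ
  bound = 96 * n ^ 2 * (n ∸ 1)

  private
    1≤n : 1 ≤ n
    1≤n = ℕ.≤-trans (s≤s z≤n) 2≤n

    -- In these four estimates the factors belong to φ₁⁻¹, f and φ₂ in this order, p stands for n -
    -- 1, and `n * (n * 1)` is what `n ^ 2` computes to.
    twoBound : ∀ n p → 3 * (2 * (n * n)) * ((4 * p) * (4 * 1)) ≡ 96 * (n * (n * 1)) * p
    twoBound = solve-∀

    pathBound : ∀ n p → 3 * (n * n) * ((8 * p) * (4 * 1)) ≡ 96 * (n * (n * 1)) * p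
    pathBound = solve-∀

    coloringBound : ∀ n p → n ≤ 2 * p → 3 * (2 * (n * n)) * ((2 * n) * (4 * 1)) ≤ 96 * (n * (n * 1)) * p
    coloringBound n p n≤2p = begin
      3 * (2 * (n * n)) * ((2 * n) * (4 * 1))    ≡⟨ left n ⟩
      48 * (n * n) * n                           ≤⟨ ℕ.*-monoʳ-≤ (48 * (n * n)) n≤2p ⟩
      48 * (n * n) * (2 * p)                     ≡⟨ right n p ⟩
      96 * (n * (n * 1)) * p                     ∎
      where
      open ℕ.≤-Reasoning
      left : ∀ n → 3 * (2 * (n * n)) * ((2 * n) * (4 * 1)) ≡ 48 * (n * n) * n
      left = solve-∀
      right : ∀ n p → 48 * (n * n) * (2 * p) ≡ 96 * (n * (n * 1)) * p
      right = solve-∀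

    pairBound : ∀ n p → 2 ≤ p → 3 * (2 * (n * n)) * (8 * (4 * 1)) ≤ 96 * (n * (n * 1)) * p
    pairBound n p 2≤p = begin
      3 * (2 * (n * n)) * (8 * (4 * 1))    ≡⟨ left n ⟩
      96 * (n * (n * 1)) * 2               ≤⟨ ℕ.*-monoʳ-≤ (96 * (n * (n * 1))) 2≤p ⟩
      96 * (n * (n * 1)) * p               ∎
      where
      open ℕ.≤-Reasoning
      left : ∀ n → 3 * (2 * (n * n)) * (8 * (4 * 1)) ≡ 96 * (n * (n * 1)) * 2
      left = solve-∀

  run₂ : ∀ {c c′ C K₁ K₂ C′ r} → c ≢ c′ → IsColoring C → Run C (Selection.two c c′) K₁ K₂ C′ r → Recip r bound
  run₂ {c} {c′} {C} {K₁} {K₂} {C′} {r} c≢c′ col run = combine (Flipping.flipSelected₂ G k side bipartite c c′ c≢c′ C col 1≤n (Run.flipped run))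
    where
    finished : Recip (Run.p₁ run) (3 * (2 * (n * n))) →
               Recip (Run.p₂ run) (4 * (n ∸ 1)) × TwoColors.Tame c c′ c≢c′ K₂ × length (deficientVertices K₂) ≤ 2 → Recip r bound
    finished rec (perturbed , tame , deficient≤2) = subst (λ r → Recip r bound) (sym (Run.weight run))
      (subst (Recip (Run.p₁ run ℚ.* (Run.p₂ run ℚ.* (Run.p₃ run ℚ.* 1ℚ)))) (twoBound n (n ∸ 1))
        (recip-* rec (recip-* perturbed (recip-* eliminated recip-1))))
      where
      eliminated : Recip (Run.p₃ run) 4
      eliminated = Elimination.eliminate⁻ G k side bipartite c c′ c≢c′ n {δ = 2} Elimination.two tame deficient≤2 (Run.eliminated run)

    combine : Flipping.Flip G k side bipartite c c′ c≢c′ C col (2 * (n * n)) (Run.p₁ run) K₁ → Recip r bound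
    -- With two colors both cases of the flip yield 6n², so the deficiency data of a pair are
    -- dropped.
    combine flip₁ = finished ([ id , proj₁ ]′ (Flipping.Flip.bound flip₁))
      (Perturbation.perturb₂⁻ G k side bipartite 2≤n c c′ c≢c′ K₁ (Flipping.Flip.tame flip₁) (Flipping.Flip.deficient≤2 flip₁) (Run.perturbed run))

  -- The run is that of the inverse way. Its last part, φ₂ on `K₁`, is controlled by the first part
  -- of the given way, in which `K₁` arises from `C₁` by flips of `c` and `c′`.
  run₃ : ∀ {c c′ c″ C₁ C₂ K₁ K₂ p r} → c ≢ c′ → IsColoring C₁ → IsColoring C₂ →
         (p , K₁) ∈ flipSelected (three c c′ c″) C₁ → Run C₂ (three c c′ c″) K₂ K₁ C₁ r → Recip r bound
  run₃ {c} {c′} {c″} {C₁} {C₂} {K₁} {K₂} {p} {r} c≢c′ col₁ col₂ K₁∈ run =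
    combine (Flipping.flipSelected₃ G k side bipartite c c′ c≢c′ C₁ col₁ 1≤n {c″} K₁∈)
            (Flipping.flipSelected₃ G k side bipartite c c′ c≢c′ C₂ col₂ 1≤n {c″} (Run.flipped run))
    where
    combine : Flipping.Flip G k side bipartite c c′ c≢c′ C₁ col₁ (n * n) p K₁ →
              Flipping.Flip G k side bipartite c c′ c≢c′ C₂ col₂ (n * n) (Run.p₁ run) K₂ → Recip r bound
    combine flip₁ flip₂ = subst (λ r → Recip r bound) (sym (Run.weight run))
      (cases (Perturbation.perturb₃⁻ G k side bipartite 2≤n c c′ c≢c′ K₂
                (Flipping.Flip.tame flip₂) (Flipping.Flip.deficient≤2 flip₂) c″ (Run.perturbed run))
             (Flipping.Flip.bound flip₂))
      where
      eliminated : Recip (Run.p₃ run ℚ.* 1ℚ) (4 * 1)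
      eliminated = recip-* (Elimination.eliminate⁻ G k side bipartite c c′ c≢c′ n {δ = 2} Elimination.three
        (Flipping.Flip.tame flip₁) (Flipping.Flip.deficient≤2 flip₁) (Run.eliminated run)) recip-1

      weight : ℚ
      weight = Run.p₁ run ℚ.* (Run.p₂ run ℚ.* (Run.p₃ run ℚ.* 1ℚ))

      cases : Outcome₃ G k K₂ (Run.p₂ run) → Recip (Run.p₁ run) (3 * (n * n)) ⊎
        (Recip (Run.p₁ run) (3 * (2 * (n * n))) × (deficientVertices K₂ ≡ [] ⊎ (2 ≤ length (deficientVertices K₂) × 3 ≤ n))) →
        Recip weight bound
      cases perturbed (inj₁ rec) = subst (Recip weight) (pathBound n (n ∸ 1)) (recip-* rec (recip-* (Outcome₃.general perturbed) eliminated))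
      cases perturbed (inj₂ (rec , inj₁ none)) = recip-mono (coloringBound n (n ∸ 1) (n≤2[n∸1] 2≤n))
        (recip-* rec (recip-* (Outcome₃.ifNone perturbed none) eliminated))
      cases perturbed (inj₂ (rec , inj₂ (2≤ , 3≤n))) = recip-mono (pairBound n (n ∸ 1) (ℕ.∸-monoˡ-≤ 1 3≤n))
        (recip-* rec (recip-* (Outcome₃.ifTwo perturbed 2≤) eliminated))

  -- Needed because an acceptance probability never exceeds 1; the case where the minimum is 1 and
  -- the way of doing nothing rest on it. For a single vertex the product would be 0.
  1≤bound : 1 ≤ bound
  1≤bound = ℕ.*-mono-≤ {1} {96 * n ^ 2} (ℕ.*-mono-≤ {1} {96} (s≤s z≤n) (ℕ.*-mono-≤ 1≤n (ℕ.*-mono-≤ 1≤n (ℕ.≤-refl {1})))) (ℕ.∸-monoˡ-≤ 1 2≤n)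

  via-dominated : ∀ {C₁ C₂ s K₁ K₂ L₁ L₂} →
    (∀ {r} → TwoSelected s → Run C₂ s L₁ L₂ C₁ r → Recip r bound) → IsWay C₂ C₁ (via s L₁ L₂) →
    P⟨ C₂ , via s K₁ K₂ ∣ C₁ ⟩ ℚ.≤ P⟨ C₁ , via s L₁ L₂ ∣ C₂ ⟩ ℚ.* ι bound
  via-dominated {C₁} {C₂} {s} {K₁} {K₂} {L₁} {L₂} bounded p′ =
    let sel , r , entry , run = isWay⇒run {C₂} {C₁} {s} {L₁} {L₂} p′ in
    way-dominated {C₁} {C₂} {s} {K₁} {K₂} {L₁} {L₂} {r} {bound} entry (bounded sel run)

  nothing-dominated : ∀ {C₁ C₂} → C₂ ≡ C₁ → IsWay C₁ C₂ nothing →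
    P⟨ C₂ , nothing ∣ C₁ ⟩ ℚ.≤ P⟨ C₁ , nothing ∣ C₂ ⟩ ℚ.* ι bound
  nothing-dominated {C₁} {C₂} refl p = ≤-*bound P⟨ C₁ , nothing ∣ C₁ ⟩ p
    where
    ≤-*bound : ∀ q → Positive q → q ℚ.≤ q ℚ.* ι bound
    ≤-*bound q q⁺ = subst (ℚ._≤ q ℚ.* ι bound) (ℚ.*-identityʳ q) (ℚ.*-monoˡ-≤-nonNeg q {{ℚ.pos⇒nonNeg q {{q⁺}}}} (ι-mono {1} {bound} 1≤bound))

  run₂′ : ∀ {C C′ c c′ K₁ K₂ r} → IsColoring C → TwoSelected (Selection.two c c′) → Run C (Selection.two c c′) K₁ K₂ C′ r → Recip r bound
  run₂′ col (two c≢c′) = run₂ c≢c′ col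

  reversed-run : ∀ {C₁ C₂ s K₁ K₂ q r} → IsColoring C₁ → IsColoring C₂ → Run C₁ s K₁ K₂ C₂ q →
                 TwoSelected s → Run C₂ s K₂ K₁ C₁ r → Recip r bound
  reversed-run col₁ col₂ _    (two c≢c′)   run = run₂ c≢c′ col₂ run
  reversed-run col₁ col₂ run₁ (three c≢c′) run = run₃ c≢c′ col₁ col₂ (Run.flipped run₁) run

  inverse-dominated : ∀ {C₁ C₂ w w′} → IsColoring C₁ → IsColoring C₂ → Inverse C₁ C₂ w w′ →
    IsWay C₁ C₂ w → IsWay C₂ C₁ w′ → P⟨ C₂ , w ∣ C₁ ⟩ ℚ.≤ P⟨ C₁ , w′ ∣ C₂ ⟩ ℚ.* ι bound
  inverse-dominated {C₁} {C₂} _ _ nothing p _ = nothing-dominated {C₁} {C₂} (isWay-nothing {C₁} {C₂} p) p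
  inverse-dominated {C₁} {C₂} col₁ col₂ (repeated {c} {c′} {K₁} {K₂} {L₁} {L₂} _ _ _ _ _ _) p p′ =
    via-dominated {C₁} {C₂} {Selection.two c c′} {K₁} {K₂} {L₁} {L₂} (run₂′ col₂) p′
  inverse-dominated {C₁} {C₂} col₁ col₂ (reversed {s} {K₁} {K₂}) p p′ =
    via-dominated {C₁} {C₂} {s} {K₁} {K₂} {K₂} {K₁}
      (reversed-run col₁ col₂ (proj₂ (proj₂ (proj₂ (isWay⇒run {C₁} {C₂} {s} {K₁} {K₂} p))))) p′

theorem3p2 : (G : Graph) → Bipartite G → 2 ≤ Graph.∣V∣ G →
    (k : ℕ) → Graph.maxDegree G ≤ k →
    (γ : ℚ) (γ⁺ : Positive γ) →
    let open Chain G k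
        open MetropolisHastings (λ _ → γ) (λ _ → γ⁺)
    in
    (C₁ C₂ : EdgeMap) → IsColoring C₁ → IsColoring C₂ →
    (w w′ : Way) → Inverse C₁ C₂ w w′ →
    (p : IsWay C₁ C₂ w) (p′ : IsWay C₂ C₁ w′) →
    acceptance⁻¹ C₁ C₂ w w′ p p′ ℚ.≤ + (96 * Graph.∣V∣ G ^ 2 * (Graph.∣V∣ G ∸ 1)) / 1
theorem3p2 G (side , bipartite) 2≤n k _ γ γ⁺ C₁ C₂ col₁ col₂ w w′ inv p p′ =
  1/-≤ (acceptance C₁ C₂ w w′ p) (ι bound) (acceptance⁺ C₁ C₂ w w′ p p′) accepted
  where
  open Chain G k
  open MetropolisHastings (λ _ → γ) (λ _ → γ⁺)
  open Bound G k side bipartite 2≤n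

  weights : weight C₁ C₂ w ℚ.≤ weight C₂ C₁ w′ ℚ.* ι bound
  weights = subst (weight C₁ C₂ w ℚ.≤_) (sym (ℚ.*-assoc γ P⟨ C₁ , w′ ∣ C₂ ⟩ (ι bound)))
    (ℚ.*-monoˡ-≤-nonNeg γ {{ℚ.pos⇒nonNeg γ {{γ⁺}}}} (inverse-dominated {C₁} {C₂} {w} {w′} col₁ col₂ inv p p′))

  accepted : 1ℚ ℚ.≤ acceptance C₁ C₂ w w′ p ℚ.* ι bound
  accepted = 1≤⊓* (ratio C₁ C₂ w w′ p) (ι bound) (ι-mono {1} {bound} 1≤bound)
    (÷-≥1 (weight C₁ C₂ w) (weight C₂ C₁ w′) (ι bound) (weight⁺ C₁ C₂ w p) weights)
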